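{- Let $a$ and $b$ be integers with $2\leq a\leq b\leq 2a$ and $a+b\equiv 2\pmod 3$. Let $n=b+1-a$ and $k=(2a-b-1)/3$, so that $(a,b)=(n+3k,\,2n+3k-1)$. Then the number of tilings of the $(a,b)$-benzel using only right stones, rising bones, and falling bones is \[ \prod_{j=1}^{k}\frac{(2j)!\,(2j+2n-2)!}{(j+n-1)!\,(j+n+k-1)!}. \]
   Context: Let $\omega=e^{2\pi i/3}$. The hexagonal grid is the tiling of the complex plane $\mathbb{C}$ by regular hexagons of side length $1$ (called cells) in which one cell has vertices $1\pm\omega^j$, $j\in\{0,1,2\}$; the cell centers are the points $1+m\left(\tfrac32-\tfrac{\sqrt3}{2}i\right)+n\sqrt3\, i$ with $m,n\in\mathbb{Z}$, and two cells are adjacent when their centers differ by $\pm\sqrt3 i$ or $\pm\tfrac32\pm\tfrac{\sqrt3}{2}i$. For positive integers $a,b$, the $(a,b)$-benzel is the union of all cells lying entirely within the hexagon with vertices $\omega^j(a\omega+b)$ and $-\omega^j(a+b\omega)$ for $j\in\{0,1,2\}$. The allowed tiles are translates of sets of three cells, with $c$ denoting a cell center: a right stone has centers $\{c,\ c+\sqrt3 i,\ c+\tfrac32+\tfrac{\sqrt3}{2}i\}$ (two vertically stacked cells with a third cell to their right); a left stone has centers $\{c,\ c+\sqrt3 i,\ c-\tfrac32+\tfrac{\sqrt3}{2}i\}$ (two vertically stacked cells with a third cell to their left); a rising bone has centers $\{c,\ c+(\tfrac32+\tfrac{\sqrt3}{2}i),\ c+2(\tfrac32+\tfrac{\sqrt3}{2}i)\}$;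 a falling bone has centers $\{c,\ c+(\tfrac32-\tfrac{\sqrt3}{2}i),\ c+2(\tfrac32-\tfrac{\sqrt3}{2}i)\}$. A tiling of a region is a partition of its cells into such tiles (only the indicated tile types allowed). An empty product equals $1$. -}

module Defs where

open import Data.Nat as ℕ using (ℕ; zero; suc)
open import Data.Integer as ℤ using (ℤ; +_; _+_; _-_; _*_; -_; _≤_)
open import Data.Product using (_×_; _,_; proj₁; proj₂; ∃)
open import Data.List using (List; []; _∷_; _++_; [_]; zip; length; lookup)
open import Data.List.Membership.Propositional using (_∈_)
open import Data.List.Relation.Unary.All using (All)
open import Data.List.Relation.Unary.Any using (Any)
open import Data.List.Relation.Unary.AllPairs using (AllPairs)
open import Relation.Binary.PropositionalEquality using (_≡_)
open import Relation.Nullary using (¬_)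

-- Exact coordinates.
-- A point  X/2 + i·√3·Y/2  of ℂ (X, Y ∈ ℤ) is represented by the pair (X , Y).
-- All cell vertices, cell centres and benzel-hexagon vertices are of this form.

Point : Set
Point = ℤ × ℤ

-- A cell is indexed by (m , n) ∈ ℤ², its centre being
--   1 + m(3/2 − (√3/2) i) + n √3 i   =  (2 + 3m)/2 + i √3 (2n − m)/2.
Cell : Set
Cell = ℤ × ℤ

center : Cell → Point
center (m , n) = (+ 2 + + 3 * m , + 2 * n - m)

_⊕ᵖ_ : Point → Point → Point
(x , y) ⊕ᵖ (u , v) = (x + u , y + v)

-- The six vertices of a cell: centre ± ω^j, with
--   1 ↦ (2,0),  ω = −1/2 + (√3/2) i ↦ (−1,1),  ω² = −1/2 − (√3/2) i ↦ (−1,−1).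
cellVertices : Cell → List Point
cellVertices c =
  let p = center c in
  (p ⊕ᵖ (+ 2 , + 0)) ∷ (p ⊕ᵖ (- + 2 , + 0)) ∷
  (p ⊕ᵖ (- + 1 , + 1)) ∷ (p ⊕ᵖ (+ 1 , - + 1)) ∷
  (p ⊕ᵖ (- + 1 , - + 1)) ∷ (p ⊕ᵖ (+ 1 , + 1)) ∷ []

-- Multiplication by ω in these coordinates: (X , Y) ↦ ((−X−3Y)/2 , (X−Y)/2).
-- The hexagon vertices  ω^j(aω+b)  and  −ω^j(a+bω)  (j = 0,1,2) are
--   aω+b      = (2b−a , a)        −(a+bω)     = (b−2a , −b)
--   ω(aω+b)   = (−(a+b) , b−a)    −ω(a+bω)    = (a+b , b−a)
--   ω²(aω+b)  = (2a−b , −b)       −ω²(a+bω)   = (a−2b , a)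
-- listed below in counterclockwise order (for positive a, b).
hexVertices : ℤ → ℤ → List Point
hexVertices a b =
  (a + b , b - a) ∷ (+ 2 * b - a , a) ∷ (a - + 2 * b , a) ∷
  (- (a + b) , b - a) ∷ (b - + 2 * a , - b) ∷ (+ 2 * a - b , - b) ∷ []

edgesOf : List Point → List (Point × Point)
edgesOf [] = []
edgesOf (v ∷ vs) = zip (v ∷ vs) (vs ++ [ v ])

-- (V − U) × (P − U), up to the positive factor √3/4.
cross : Point → Point → Point → ℤ
cross (ux , uy) (vx , vy) (px , py) =
  (vx - ux) * (py - uy) - (vy - uy) * (px - ux)

inHex : ℤ → ℤ → Point → Set
inHex a b p = All (λ e → + 0 ≤ cross (proj₁ e) (proj₂ e) p) (edgesOf (hexVertices a b))

-- A cell lies entirely within the hexagon iff all its vertices do (convexity).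
inBenzel : ℤ → ℤ → Cell → Set
inBenzel a b c = All (inHex a b) (cellVertices c)

data Kind : Set where
  rightStone leftStone risingBone fallingBone : Kind

Tile : Set
Tile = Kind × Cell

_⊕_ : Cell → Cell → Cell
(x , y) ⊕ (u , v) = (x + u , y + v)

-- In cell coordinates:  +√3 i ↦ (0,1),  3/2+(√3/2)i ↦ (1,1),
--   3/2−(√3/2)i ↦ (1,0),  −3/2+(√3/2)i ↦ (−1,0).
tileCells : Tile → List Cell
tileCells (rightStone  , c) = c ∷ (c ⊕ (+ 0 , + 1)) ∷ (c ⊕ (+ 1 , + 1)) ∷ []
tileCells (leftStone   , c) = c ∷ (c ⊕ (+ 0 , + 1)) ∷ (c ⊕ (- + 1 , + 0)) ∷ []
tileCells (risingBone  , c) = c ∷ (c ⊕ (+ 1 , + 1)) ∷ (c ⊕ (+ 2 , + 2)) ∷ []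
tileCells (fallingBone , c) = c ∷ (c ⊕ (+ 1 , + 0)) ∷ (c ⊕ (+ 2 , + 0)) ∷ []

data RightStonesAndBones : Kind → Set where
  rs : RightStonesAndBones rightStone
  rb : RightStonesAndBones risingBone
  fb : RightStonesAndBones fallingBone

IsTiling : (Kind → Set) → (Cell → Set) → List Tile → Set
IsTiling Allowed R T =
  All (λ t → Allowed (proj₁ t) × All R (tileCells t)) T ×
  (∀ c → R c →
     ∃ (λ i → c ∈ tileCells (lookup T i)) ×
     (∀ i j → c ∈ tileCells (lookup T i) → c ∈ tileCells (lookup T j) → i ≡ j))

SameTiling : List Tile → List Tile → Set
SameTiling T U = ∀ t → (t ∈ T → t ∈ U) × (t ∈ U → t ∈ T)

HasNTilings : (Kind → Set) → (Cell → Set) → ℕ → Set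
HasNTilings Allowed R N =
  ∃ λ (L : List (List Tile)) →
    length L ≡ N ×
    All (IsTiling Allowed R) L ×
    (∀ T → IsTiling Allowed R T → Any (SameTiling T) L) ×
    AllPairs (λ T U → ¬ SameTiling T U) L

prod1 : ℕ → (ℕ → ℕ) → ℕ
prod1 zero f = 1
prod1 (suc k) f = prod1 k f ℕ.* f (suc k)

{-# OPTIONS --safe #-}
module Submission where

-- Call the cells whose centres have the same imaginary part a row: every right stone or bone has
-- one cell in each of three consecutive rows. Number the rows of the lower half 0, 1, … from
-- below and those of the upper half from above. Going from left to right one sees that rows 3q+1
-- and 3q+2 must be matched into pairs of neighbours, so that a tile is such a pair together with
-- one cell of row 3q or one of two cells of row 3q+3. Call a cell of row 3q occupied if its tile
-- reaches it from outside. From one such row to the next a new particle enters on the left and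
-- every particle moves one or two sites to the right, no two of them to the same site. Starting
-- from empty rows there are k such steps above and m = k+n-1 below the central row, on which the
-- two occupied sets must be complementary.
--
-- Such a step is a linear map of exterior powers. With u = z+z² and hᵢ = (1+z)uⁱ the
-- configurations of the two halves are therefore counted by h₀ ∧ … ∧ hₖ₋₁ and h₀ ∧ … ∧ hₘ₋₁,
-- modulo z^(k+m), and pairing complementary sets gives
-- N = h̄ₖ₋₁ ∧ … ∧ h̄₀ ∧ h₀ ∧ … ∧ hₘ₋₁, where h̄(z) = h(-z). Modulo the other factors
-- h̄ⱼ = 2(j+1)uʲ, which leaves a determinant in the powers of u and the hᵢ. Its value for k+1 is an
-- explicit multiple of that for k, because a combination of 1, u, …, uᵏ, h₀, …, hₘ₋₁ vanishes to
-- order k+m. These combinations are Padé remainders of √(1+4u) = 1+2z; their coefficients are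
-- hypergeometric and satisfy a two-term recurrence.

open import Data.Empty using (⊥-elim; ⊥)
import Data.Integer.Properties as ℤP
import Data.Integer.Tactic.RingSolver as ℤSolver
open import Data.List
  using (List; []; _∷_; foldr; map; applyUpTo; _++_; filter; concatMap; length; lookup; upTo)
open import Data.List.Membership.Propositional using (_∈_; find)
open import Data.List.Membership.Propositional.Properties
  using (∈-++⁺ˡ; ∈-++⁺ʳ; ∈-applyUpTo⁺; ∈-map⁺; ∈-map⁻; ∈-++⁻; ∈-concatMap⁺; ∈-concatMap⁻;
    ∈-filter⁺; ∈-filter⁻; ∈-lookup; ∈-upTo⁺; ∈-upTo⁻)
import Data.List.Properties as LP
open import Data.List.Relation.Unary.All as All using (All; []; _∷_)
import Data.List.Relation.Unary.All.Properties as AllP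
open import Data.List.Relation.Unary.AllPairs as AllPairs using (AllPairs; []; _∷_)
import Data.List.Relation.Unary.AllPairs.Properties as APP
open import Data.List.Relation.Unary.Any as Any using (here; there; Any)
import Data.List.Relation.Unary.Any.Properties as AnyP
import Data.List.Relation.Unary.Unique.Propositional.Properties as UP
import Data.Nat.Properties as ℕP
open import Data.Product using (_,_; Σ; _×_; proj₁; proj₂; ∃)
open import Data.Sum using (inj₁; inj₂; _⊎_)
open import Function using (_∘_)
open import Relation.Binary.PropositionalEquality
  using (_≡_; refl; sym; trans; cong; cong₂; module ≡-Reasoning; _≢_; subst)
open import Relation.Nullary using (¬_; yes; no)

-- Exterior algebra fits because of exclusion: two particles on one site are a repeated factor,
-- which vanishes, and short steps never reverse an order, so no sign enters the count. One argument
-- serves both halves: complex conjugation preserves the set of three tiles (it exchanges the bones)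
-- and maps the (a,b)-benzel to the (b,a)-benzel, which exchanges k and m.
--
-- The obstacle is the determinant. The Padé coefficients are never written down; only the
-- membership of the remainder in a span is proved. Two facts make this possible. After coordinate i
-- is scaled by (i+1)!, the remainder for (k, m) depends on k only through its order and becomes, up
-- to a constant, a Bessel polynomial whose degree depends on e = m - k alone. And the recurrence of
-- these polynomials links (k, e), (k, e+1) and (k-1, e+2), so that an induction on k and then on e
-- can start from z^(2k), which is congruent to u^k, and from hₑ, which after scaling is itself a
-- multiple of a shifted Bessel polynomial.

module Exterior where

  -- Exterior multiplication by power series and saturated spans.

  open import Data.Nat using (ℕ; zero; suc)
  open import Data.Bool using (Bool; true; false)
  open import Data.Integer as ℤ using (ℤ; +_; _+_; _-_; _*_; -_)
  open import Data.Integer.Tactic.RingSolver using (solve-∀)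
  open import Data.Vec using (Vec; []; _∷_)

  -- Coefficients of power series in z. Below, Z is multiplication by z, A by 1 + z and mulu by
  -- u = z + z².
  Series : Set
  Series = ℕ → ℤ

  infix 4 _≈ˢ_ _≈_
  _≈ˢ_ : Series → Series → Set
  v ≈ˢ w = ∀ i → v i ≡ w i

  infixl 6 _+ˢ_ _-ˢ_
  infixr 7 _·ˢ_
  _+ˢ_ _-ˢ_ : Series → Series → Series
  (v +ˢ w) i = v i + w i
  (v -ˢ w) i = v i - w i

  _·ˢ_ : ℤ → Series → Series
  (c ·ˢ v) i = c * v i

  0ˢ : Series
  0ˢ i = + 0

  Z : Series → Series
  Z v zero    = + 0
  Z v (suc i) = v i

  1ˢ : Series
  1ˢ zero    = + 1
  1ˢ (suc i) = + 0

  -- The exterior algebra on sites 0, …, n-1, an element being given by its coefficients on the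
  -- basis of site subsets.
  Fock : ℕ → Set
  Fock n = Vec Bool n → ℤ

  _≈_ : ∀ {n} → Fock n → Fock n → Set
  x ≈ y = ∀ S → x S ≡ y S

  -- Coefficients beyond the first n are never read: an element of `Fock n` sees a series modulo
  -- z^n. The minus sign comes from carrying `v` past an occupied site 0.
  wedge : ∀ {n} → Series → Fock n → Fock n
  wedge v x []          = + 0
  wedge v x (false ∷ S) = wedge (v ∘ suc) (x ∘ (false ∷_)) S
  wedge v x (true ∷ S)  = v 0 * x (false ∷ S) - wedge (v ∘ suc) (x ∘ (true ∷_)) S

  wedge-cong : ∀ {n} {v w : Series} {x y : Fock n} → v ≈ˢ w → x ≈ y → wedge v x ≈ wedge w y
  wedge-cong p q []          = refl
  wedge-cong p q (false ∷ S) = wedge-cong (p ∘ suc) (q ∘ (false ∷_)) S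
  wedge-cong p q (true ∷ S)  =
    cong₂ _-_ (cong₂ _*_ (p 0) (q (false ∷ S))) (wedge-cong (p ∘ suc) (q ∘ (true ∷_)) S)

  wedge-congʳ : ∀ {n} v {x y : Fock n} → x ≈ y → wedge v x ≈ wedge v y
  wedge-congʳ v = wedge-cong {v = v} (λ _ → refl)

  private
    lin-series : ∀ c a b p q r s → (c * a + b) * p - (c * r + s) ≡ c * (a * p - r) + (b * p - s)
    lin-series = solve-∀

    lin-fock : ∀ c v p q r s → v * (c * p + q) - (c * r + s) ≡ c * (v * p - r) + (v * q - s)
    lin-fock = solve-∀

    zero-fock : ∀ c → + 0 ≡ c * + 0 + + 0
    zero-fock = solve-∀

  wedge-linˢ : ∀ {n} c v w (x : Fock n) S → wedge ((c ·ˢ v) +ˢ w) x S ≡ c * wedge v x S + wedge w x S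
  wedge-linˢ c v w x []          = zero-fock c
  wedge-linˢ c v w x (false ∷ S) = wedge-linˢ c (v ∘ suc) (w ∘ suc) _ S
  wedge-linˢ c v w x (true ∷ S)  =
    trans (cong (λ t → (c * v 0 + w 0) * x (false ∷ S) - t) (wedge-linˢ c (v ∘ suc) (w ∘ suc) _ S))
      (lin-series c (v 0) (w 0) (x (false ∷ S)) (+ 0) _ _)

  wedge-lin : ∀ {n} c v (x y : Fock n) S → wedge v (λ T → c * x T + y T) S ≡ c * wedge v x S + wedge v y S
  wedge-lin c v x y []          = zero-fock c
  wedge-lin c v x y (false ∷ S) = wedge-lin c (v ∘ suc) _ _ S
  wedge-lin c v x y (true ∷ S)  =
    trans (cong (λ t → v 0 * (c * x (false ∷ S) + y (false ∷ S)) - t) (wedge-lin c (v ∘ suc) _ _ S))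
      (lin-fock c (v 0) (x (false ∷ S)) (y (false ∷ S)) _ _)

  wedge-0 : ∀ {n} v (x : Fock n) → (∀ S → x S ≡ + 0) → ∀ S → wedge v x S ≡ + 0
  wedge-0 v x x≡0 []          = refl
  wedge-0 v x x≡0 (false ∷ S) = wedge-0 (v ∘ suc) _ (x≡0 ∘ (false ∷_)) S
  wedge-0 v x x≡0 (true ∷ S)
    rewrite wedge-0 (v ∘ suc) _ (x≡0 ∘ (true ∷_)) S | x≡0 (false ∷ S) = cong (λ t → t - + 0) (ℤP.*-zeroʳ (v 0))

  wedge-0ˢ : ∀ {n} v (x : Fock n) → v ≈ˢ 0ˢ → ∀ S → wedge v x S ≡ + 0
  wedge-0ˢ v x v≡0 []          = refl
  wedge-0ˢ v x v≡0 (false ∷ S) = wedge-0ˢ (v ∘ suc) _ (v≡0 ∘ suc) S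
  wedge-0ˢ v x v≡0 (true ∷ S)
    rewrite wedge-0ˢ (v ∘ suc) (x ∘ (true ∷_)) (v≡0 ∘ suc) S | v≡0 0 = refl

  wedge-· : ∀ {n} c v (x : Fock n) S → wedge v (λ T → c * x T) S ≡ c * wedge v x S
  wedge-· c v x S =
    trans (wedge-congʳ v (λ T → sym (ℤP.+-identityʳ _)) S)
      (trans (wedge-lin c v x (λ _ → + 0) S)
        (trans (cong (λ t → c * wedge v x S + t) (wedge-0 v (λ _ → + 0) (λ _ → refl) S)) (ℤP.+-identityʳ _)))

  wedge-·ˢ : ∀ {n} c v (x : Fock n) S → wedge (c ·ˢ v) x S ≡ c * wedge v x S
  wedge-·ˢ c v x S =
    trans (wedge-cong {v = c ·ˢ v} {w = (c ·ˢ v) +ˢ 0ˢ} (λ i → sym (ℤP.+-identityʳ _)) (λ _ → refl) S)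
      (trans (wedge-linˢ c v 0ˢ x S)
        (trans (cong (λ t → c * wedge v x S + t) (wedge-0ˢ 0ˢ x (λ _ → refl) S)) (ℤP.+-identityʳ _)))

  wedge-true : ∀ {n} v w (x : Fock (suc n)) S →
    wedge v (λ T → wedge w x (true ∷ T)) S
      ≡ w 0 * wedge v (x ∘ (false ∷_)) S - wedge v (wedge (w ∘ suc) (x ∘ (true ∷_))) S
  wedge-true v w x S =
    trans (wedge-lin (w 0) v (x ∘ (false ∷_)) (λ T → - wedge (w ∘ suc) (x ∘ (true ∷_)) T) S)
      (cong (λ t → w 0 * wedge v (x ∘ (false ∷_)) S + t)
        (trans (wedge-congʳ v (λ T → sym (ℤP.-1*i≡-i _)) S)
          (trans (wedge-· (- + 1) v _ S) (ℤP.-1*i≡-i _))))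

  wedge-anti : ∀ {n} v w (x : Fock n) S → wedge v (wedge w x) S ≡ - wedge w (wedge v x) S
  wedge-anti v w x []          = refl
  wedge-anti v w x (false ∷ S) = wedge-anti (v ∘ suc) (w ∘ suc) _ S
  wedge-anti v w x (true ∷ S)
    rewrite wedge-true (v ∘ suc) w x S | wedge-true (w ∘ suc) v x S
          | wedge-anti (v ∘ suc) (w ∘ suc) (x ∘ (true ∷_)) S =
    alg (v 0) (w 0) _ _ _
    where
    alg : ∀ a b p q r → a * p - (b * q - - r) ≡ - (b * q - (a * p - r))
    alg = solve-∀

  self-neg⇒0 : ∀ i → i ≡ - i → i ≡ + 0
  self-neg⇒0 (+ zero) _ = refl
  self-neg⇒0 (+ suc n) ()
  self-neg⇒0 (ℤ.-[1+ n ]) ()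

  wedge-sq : ∀ {n} v (x : Fock n) S → wedge v (wedge v x) S ≡ + 0
  wedge-sq v x S = self-neg⇒0 _ (wedge-anti v v x S)

  vac : ∀ {n} → Fock n
  vac []          = + 1
  vac (false ∷ S) = vac S
  vac (true ∷ S)  = + 0

  ω : ∀ {n} → List Series → Fock n
  ω = foldr wedge vac

  wedge-∈ : ∀ {n} {v vs} → v ∈ vs → ∀ (S : Vec Bool n) → wedge v (ω vs) S ≡ + 0
  wedge-∈ {v = v} {vs = _ ∷ vs} (here refl) S = wedge-sq v (ω vs) S
  wedge-∈ {v = v} {vs = w ∷ vs} (there p) S =
    trans (wedge-anti v w (ω vs) S) (cong -_ (wedge-0 w (wedge v (ω vs)) (wedge-∈ p) S))

  -- Saturated, so that linear relations over ℚ can be used.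
  data Span (G : Series → Set) : Series → Set where
    zer  : Span G 0ˢ
    gen  : ∀ {v} → G v → Span G v
    add  : ∀ {v w} → Span G v → Span G w → Span G (v +ˢ w)
    scl  : ∀ c {v} → Span G v → Span G (c ·ˢ v)
    divd : ∀ c {v} → ¬ (c ≡ + 0) → Span G (c ·ˢ v) → Span G v
    resp : ∀ {v w} → v ≈ˢ w → Span G v → Span G w

  Span-mono : ∀ {G H : Series → Set} → (∀ {v} → G v → Span H v) → ∀ {v} → Span G v → Span H v
  Span-mono f zer           = zer
  Span-mono f (gen g)       = f g
  Span-mono f (add p q)     = add (Span-mono f p) (Span-mono f q)
  Span-mono f (scl c p)     = scl c (Span-mono f p)
  Span-mono f (divd c nz p) = divd c nz (Span-mono f p)
  Span-mono f (resp e p)    = resp e (Span-mono f p)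

  record Linear (F : Series → Series) : Set where
    field
      lin-cong : ∀ {v w} → v ≈ˢ w → F v ≈ˢ F w
      lin-0    : F 0ˢ ≈ˢ 0ˢ
      lin-+    : ∀ v w → F (v +ˢ w) ≈ˢ F v +ˢ F w
      lin-·    : ∀ c v → F (c ·ˢ v) ≈ˢ c ·ˢ F v

  Span-map : ∀ {G H F} → Linear F → (∀ {v} → G v → Span H (F v)) → ∀ {v} → Span G v → Span H (F v)
  Span-map L f zer           = resp (λ i → sym (Linear.lin-0 L i)) zer
  Span-map L f (gen g)       = f g
  Span-map L f (add p q)     = resp (λ i → sym (Linear.lin-+ L _ _ i)) (add (Span-map L f p) (Span-map L f q))
  Span-map L f (scl c p)     = resp (λ i → sym (Linear.lin-· L c _ i)) (scl c (Span-map L f p))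
  Span-map L f (divd c nz p) = divd c nz (resp (Linear.lin-· L c _) (Span-map L f p))
  Span-map L f (resp e p)    = resp (Linear.lin-cong L e) (Span-map L f p)

  -- The series `v` for which `wedge v x` vanishes form a subgroup closed under division, since ℤ
  -- has no zero divisors; checking the generators is therefore enough.
  wedge-Span : ∀ {n G} (x : Fock n) → (∀ {v} → G v → ∀ S → wedge v x S ≡ + 0) →
    ∀ {v} → Span G v → ∀ S → wedge v x S ≡ + 0
  wedge-Span x k zer           S = wedge-0ˢ 0ˢ x (λ _ → refl) S
  wedge-Span x k (gen g)       S = k g S
  wedge-Span x k (add {v} {w} p q) S =
    trans (wedge-cong {w = ((+ 1) ·ˢ v) +ˢ w} (λ i → cong (_+ w i) (sym (ℤP.*-identityˡ (v i)))) (λ _ → refl) S)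
     (trans (wedge-linˢ (+ 1) v w x S)
      (trans (cong₂ (λ s t → + 1 * s + t) (wedge-Span x k p S) (wedge-Span x k q S)) refl))
  wedge-Span x k (scl c {v} p) S =
    trans (wedge-·ˢ c v x S) (trans (cong (c *_) (wedge-Span x k p S)) (ℤP.*-zeroʳ c))
  wedge-Span x k (divd c {v} nz p) S with ℤP.i*j≡0⇒i≡0∨j≡0 c (trans (sym (wedge-·ˢ c v x S)) (wedge-Span x k p S))
  ... | inj₁ c≡0 = ⊥-elim (nz c≡0)
  ... | inj₂ e   = e
  wedge-Span x k (resp e p)    S = trans (wedge-cong (λ i → sym (e i)) (λ _ → refl) S) (wedge-Span x k p S)

-- Particle steps as exterior powers, and the pairing of complementary sets.

module Walks where

  open Exterior
  open import Data.Nat using (ℕ; zero; suc)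
  open import Data.Bool using (Bool; true; false)
  open import Data.Integer using (ℤ; +_; _+_; _-_; _*_; -_)
  open import Data.Integer.Tactic.RingSolver using (solve-∀)
  open import Data.Vec using (Vec; []; _∷_; replicate)
  open ≡-Reasoning

  -- Every particle stays or moves one site to the right, particles excluding each other;
  -- in move⁺ a further particle arrives at site 0 from the left.
  move move⁺ : ∀ {n} → Fock n → Fock n
  move x []           = x []
  move x (false ∷ S)  = move (x ∘ (false ∷_)) S + move⁺ (x ∘ (true ∷_)) S
  move x (true ∷ S)   = move (x ∘ (true ∷_)) S
  move⁺ x []          = + 0
  move⁺ x (false ∷ S) = + 0
  move⁺ x (true ∷ S)  = move (x ∘ (false ∷_)) S + move⁺ (x ∘ (true ∷_)) S

  move-cong  : ∀ {n} {x y : Fock n} → x ≈ y → move x ≈ move y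
  move⁺-cong : ∀ {n} {x y : Fock n} → x ≈ y → move⁺ x ≈ move⁺ y
  move-cong e []           = e []
  move-cong e (false ∷ S)  = cong₂ _+_ (move-cong (e ∘ (false ∷_)) S) (move⁺-cong (e ∘ (true ∷_)) S)
  move-cong e (true ∷ S)   = move-cong (e ∘ (true ∷_)) S
  move⁺-cong e []          = refl
  move⁺-cong e (false ∷ S) = refl
  move⁺-cong e (true ∷ S)  = cong₂ _+_ (move-cong (e ∘ (false ∷_)) S) (move⁺-cong (e ∘ (true ∷_)) S)

  move-lin  : ∀ {n} c d (x y : Fock n) S → move (λ T → c * x T + d * y T) S ≡ c * move x S + d * move y S
  move⁺-lin : ∀ {n} c d (x y : Fock n) S → move⁺ (λ T → c * x T + d * y T) S ≡ c * move⁺ x S + d * move⁺ y S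
  private
    lin-alg : ∀ c d p q r s → (c * p + d * q) + (c * r + d * s) ≡ c * (p + r) + d * (q + s)
    lin-alg = solve-∀
    lin-zero : ∀ c d → + 0 ≡ c * + 0 + d * + 0
    lin-zero = solve-∀
  move-lin c d x y []           = refl
  move-lin c d x y (false ∷ S)  =
    trans (cong₂ _+_ (move-lin c d _ _ S) (move⁺-lin c d _ _ S)) (lin-alg c d _ (move (y ∘ (false ∷_)) S) _ _)
  move-lin c d x y (true ∷ S)   = move-lin c d _ _ S
  move⁺-lin c d x y []          = lin-zero c d
  move⁺-lin c d x y (false ∷ S) = lin-zero c d
  move⁺-lin c d x y (true ∷ S)  =
    trans (cong₂ _+_ (move-lin c d _ _ S) (move⁺-lin c d _ _ S)) (lin-alg c d _ (move (y ∘ (false ∷_)) S) _ _)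

  private
    as-lin : ∀ c p q → c * p - q ≡ c * p + - + 1 * q
    as-lin = solve-∀

  move-sub : ∀ {n} c (x y : Fock n) S → move (λ T → c * x T - y T) S ≡ c * move x S - move y S
  move-sub c x y S = trans (move-cong (λ T → as-lin c (x T) (y T)) S)
    (trans (move-lin c (- + 1) x y S) (sym (as-lin c _ _)))

  move⁺-sub : ∀ {n} c (x y : Fock n) S → move⁺ (λ T → c * x T - y T) S ≡ c * move⁺ x S - move⁺ y S
  move⁺-sub c x y S = trans (move⁺-cong (λ T → as-lin c (x T) (y T)) S)
    (trans (move⁺-lin c (- + 1) x y S) (sym (as-lin c _ _)))

  A : Series → Series
  A v = v +ˢ Z v

  e₀ : Series
  e₀ = 1ˢ

  wedge-e₀-true : ∀ {n} (x : Fock (suc n)) S → wedge e₀ x (true ∷ S) ≡ x (false ∷ S)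
  wedge-e₀-true x S =
    trans (cong (λ t → + 1 * x (false ∷ S) - t) (wedge-0ˢ (e₀ ∘ suc) (x ∘ (true ∷_)) (λ _ → refl) S)) (alg _)
    where
    alg : ∀ a → + 1 * a - + 0 ≡ a
    alg = solve-∀

  -- A particle arriving at site 0 stands before all others, so no sign appears, and multiplication
  -- by `e₀` kills the terms in which site 0 is already taken.
  move⁺-wedge : ∀ {n} (x : Fock n) → move⁺ x ≈ wedge e₀ (move x)
  move⁺-wedge x []          = refl
  move⁺-wedge x (false ∷ S) = sym (wedge-0ˢ (e₀ ∘ suc) (move x ∘ (false ∷_)) (λ _ → refl) S)
  move⁺-wedge x (true ∷ S)  = sym (wedge-e₀-true (move x) S)

  wedge-+ : ∀ {n} v (x y : Fock n) S → wedge v (λ T → x T + y T) S ≡ wedge v x S + wedge v y S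
  wedge-+ v x y S =
    trans (wedge-congʳ v (λ T → cong (_+ y T) (sym (ℤP.*-identityˡ (x T)))) S)
      (trans (wedge-lin (+ 1) v x y S) (cong (_+ wedge v y S) (ℤP.*-identityˡ (wedge v x S))))

  -- The constant term of `v` spills into site 1; this boundary term is what `move⁺` accounts for in
  -- `move-wedge`.
  A-tail : ∀ v → A v ∘ suc ≈ˢ (v 0 ·ˢ e₀) +ˢ A (v ∘ suc)
  A-tail v zero    = alg (v 0) (v 1)
    where
    alg : ∀ a b → b + a ≡ a * + 1 + (b + + 0)
    alg = solve-∀
  A-tail v (suc i) = alg (v 0) (v (suc (suc i))) (v (suc i))
    where
    alg : ∀ a b c → b + c ≡ a * + 0 + (b + c)
    alg = solve-∀

  wedge-A-tail : ∀ {n} v (y : Fock n) S →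
    wedge (A v ∘ suc) y S ≡ v 0 * wedge e₀ y S + wedge (A (v ∘ suc)) y S
  wedge-A-tail v y S = trans (wedge-cong (A-tail v) (λ _ → refl) S) (wedge-linˢ (v 0) e₀ (A (v ∘ suc)) y S)

  -- `move` is the exterior power of `A`: expanding a product of factors e(i) + e(i+1) gives every
  -- choice of staying or jumping, collisions vanish as squares, and steps of at most one site keep
  -- the order of the particles, hence the sign.
  move-wedge : ∀ {n} v (x : Fock n) → move (wedge v x) ≈ wedge (A v) (move x)
  move-wedge v x [] = refl
  move-wedge v x (false ∷ S) = begin
    move (wedge (v ∘ suc) x₀) S + move⁺ (λ T → v 0 * x₀ T - wedge (v ∘ suc) x₁ T) S
      ≡⟨ cong₂ _+_ (move-wedge (v ∘ suc) x₀ S) (move⁺-sub (v 0) x₀ (wedge (v ∘ suc) x₁) S) ⟩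
    wedge A′ (move x₀) S + (v 0 * move⁺ x₀ S - move⁺ (wedge (v ∘ suc) x₁) S)
      ≡⟨ cong₂ (λ s t → wedge A′ (move x₀) S + (v 0 * s - t)) (move⁺-wedge x₀ S)
           (trans (move⁺-wedge (wedge (v ∘ suc) x₁) S)
             (trans (wedge-congʳ e₀ (move-wedge (v ∘ suc) x₁) S) (wedge-anti e₀ A′ (move x₁) S))) ⟩
    wedge A′ (move x₀) S + (v 0 * wedge e₀ (move x₀) S - - wedge A′ (wedge e₀ (move x₁)) S)
      ≡⟨ alg _ _ _ (v 0) ⟩
    (v 0 * wedge e₀ (move x₀) S + wedge A′ (move x₀) S)
      + (v 0 * + 0 + wedge A′ (wedge e₀ (move x₁)) S)
      ≡⟨ cong₂ _+_ (wedge-A-tail v (move x₀) S)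
           (trans (wedge-A-tail v (wedge e₀ (move x₁)) S)
             (cong (λ t → v 0 * t + wedge A′ (wedge e₀ (move x₁)) S) (wedge-sq e₀ (move x₁) S))) ⟨
    wedge (A v ∘ suc) (move x₀) S + wedge (A v ∘ suc) (wedge e₀ (move x₁)) S
      ≡⟨ wedge-+ (A v ∘ suc) (move x₀) (wedge e₀ (move x₁)) S ⟨
    wedge (A v ∘ suc) (λ T → move x₀ T + wedge e₀ (move x₁) T) S
      ≡⟨ wedge-congʳ (A v ∘ suc) (λ T → cong (λ t → move x₀ T + t) (sym (move⁺-wedge x₁ T))) S ⟩
    wedge (A v ∘ suc) (λ T → move x₀ T + move⁺ x₁ T) S ∎
    where
    x₀ = x ∘ (false ∷_)
    x₁ = x ∘ (true ∷_)
    A′ = A (v ∘ suc)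
    alg : ∀ p q r c → p + (c * q - - r) ≡ (c * q + p) + (c * + 0 + r)
    alg = solve-∀
  move-wedge v x (true ∷ S) = begin
    move (λ T → v 0 * x₀ T - wedge (v ∘ suc) x₁ T) S
      ≡⟨ move-sub (v 0) x₀ (wedge (v ∘ suc) x₁) S ⟩
    v 0 * move x₀ S - move (wedge (v ∘ suc) x₁) S
      ≡⟨ cong (λ t → v 0 * move x₀ S - t) (move-wedge (v ∘ suc) x₁ S) ⟩
    v 0 * move x₀ S - wedge (A (v ∘ suc)) (move x₁) S
      ≡⟨ alg (v 0) _ _ (wedge e₀ (move x₁) S) ⟩
    (v 0 + + 0) * (move x₀ S + wedge e₀ (move x₁) S)
      - (v 0 * wedge e₀ (move x₁) S + wedge (A (v ∘ suc)) (move x₁) S)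
      ≡⟨ cong₂ (λ s t → (v 0 + + 0) * (move x₀ S + s) - t) (move⁺-wedge x₁ S) (wedge-A-tail v (move x₁) S) ⟨
    (v 0 + + 0) * (move x₀ S + move⁺ x₁ S) - wedge (A v ∘ suc) (move x₁) S ∎
    where
    x₀ = x ∘ (false ∷_)
    x₁ = x ∘ (true ∷_)
    alg : ∀ c p w e → c * p - w ≡ (c + + 0) * (p + e) - (c * e + w)
    alg = solve-∀

  move-vac : ∀ {n} → move {n} vac ≈ vac
  move⁺-zero : ∀ {n} (S : Vec Bool n) → move⁺ (λ _ → + 0) S ≡ + 0
  move-zero : ∀ {n} (S : Vec Bool n) → move (λ _ → + 0) S ≡ + 0
  move⁺-zero []          = refl
  move⁺-zero (false ∷ S) = refl
  move⁺-zero (true ∷ S)  = cong₂ _+_ (move-zero S) (move⁺-zero S)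
  move-zero []           = refl
  move-zero (false ∷ S)  = cong₂ _+_ (move-zero S) (move⁺-zero S)
  move-zero (true ∷ S)   = move-zero S
  move-vac []            = refl
  move-vac (false ∷ S)   = trans (cong₂ _+_ (move-vac S) (move⁺-zero S)) (ℤP.+-identityʳ (vac S))
  move-vac (true ∷ S)    = move-zero S

  -- Both relabel the sites by one, so that a step of one or two sites to the right becomes this
  -- shift followed by a `move` of zero or one site; `insert` also puts the entering particle on the
  -- new site 0.
  insert widen : ∀ {n} → Fock n → Fock (suc n)
  insert x (false ∷ S) = + 0
  insert x (true ∷ S)  = x S
  widen x (false ∷ S) = x S
  widen x (true ∷ S)  = + 0

  insert-wedge : ∀ {n} (x : Fock n) → insert x ≈ wedge e₀ (widen x)
  insert-wedge x (false ∷ S) = sym (wedge-0ˢ (e₀ ∘ suc) x (λ _ → refl) S)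
  insert-wedge x (true ∷ S)  = sym (wedge-e₀-true (widen x) S)

  widen-wedge : ∀ {n} v (x : Fock n) → widen (wedge v x) ≈ wedge (Z v) (widen x)
  widen-wedge v x (false ∷ S) = refl
  widen-wedge v x (true ∷ S)  = sym (trans (ℤP.+-identityˡ _) (cong -_ (wedge-0 v (λ _ → + 0) (λ _ → refl) S)))

  widen-vac : ∀ {n} → widen {n} vac ≈ vac
  widen-vac (false ∷ S) = refl
  widen-vac (true ∷ S)  = refl

  h : ℕ → Series
  h zero    = A 1ˢ
  h (suc i) = A (Z (h i))

  hs : ℕ → List Series
  hs = applyUpTo h

  insert-cong : ∀ {n} {x y : Fock n} → x ≈ y → insert x ≈ insert y
  insert-cong e (false ∷ S) = refl
  insert-cong e (true ∷ S)  = e S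

  move-widen-ω : ∀ {n} vs → move (widen {n} (ω vs)) ≈ ω (map (λ v → A (Z v)) vs)
  move-widen-ω [] S       = trans (move-cong widen-vac S) (move-vac S)
  move-widen-ω (v ∷ vs) S =
    trans (move-cong (widen-wedge v (ω vs)) S)
      (trans (move-wedge (Z v) (widen (ω vs)) S) (wedge-congʳ (A (Z v)) (move-widen-ω vs) S))

  -- Shift and move together multiply every old factor by u, taking hᵢ to hᵢ₊₁; the entering
  -- particle becomes `A e₀`, which is h₀.
  step-ω : ∀ {n} q → move (insert {n} (ω (hs q))) ≈ ω (hs (suc q))
  step-ω q S = begin
    move (insert (ω (hs q))) S              ≡⟨ move-cong (insert-wedge (ω (hs q))) S ⟩
    move (wedge e₀ (widen (ω (hs q)))) S    ≡⟨ move-wedge e₀ (widen (ω (hs q))) S ⟩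
    wedge (A e₀) (move (widen (ω (hs q)))) S ≡⟨ wedge-congʳ (A e₀) (move-widen-ω (hs q)) S ⟩
    wedge (A e₀) (ω (map (λ v → A (Z v)) (hs q))) S
      ≡⟨ cong (λ vs → wedge (A e₀) (ω vs) S) (LP.map-applyUpTo h (λ v → A (Z v)) q) ⟩
    ω (hs (suc q)) S ∎

  -- The sum of x S * y (∁ S) over all S; it is 0 if the numbers of sites differ.
  pair : ∀ {m n} → Fock m → Fock n → ℤ
  pair {zero}  {zero}  x y = x [] * y []
  pair {zero}  {suc n} x y = + 0
  pair {suc m} {zero}  x y = + 0
  pair {suc m} {suc n} x y =
    pair (x ∘ (false ∷_)) (y ∘ (true ∷_)) + pair (x ∘ (true ∷_)) (y ∘ (false ∷_))

  pair-cong : ∀ {m n} {x x′ : Fock m} {y y′ : Fock n} → x ≈ x′ → y ≈ y′ → pair x y ≡ pair x′ y′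
  pair-cong {zero}  {zero}  p q = cong₂ _*_ (p []) (q [])
  pair-cong {zero}  {suc n} p q = refl
  pair-cong {suc m} {zero}  p q = refl
  pair-cong {suc m} {suc n} p q = cong₂ _+_ (pair-cong (p ∘ (false ∷_)) (q ∘ (true ∷_)))
    (pair-cong (p ∘ (true ∷_)) (q ∘ (false ∷_)))

  pair-linˡ : ∀ {m n} c d (x x′ : Fock m) (y : Fock n) →
    pair (λ T → c * x T + d * x′ T) y ≡ c * pair x y + d * pair x′ y
  pair-linˡ {zero}  {zero}  c d x x′ y = alg c d (x []) (x′ []) (y [])
    where
    alg : ∀ c d x x′ y → (c * x + d * x′) * y ≡ c * (x * y) + d * (x′ * y)
    alg = solve-∀
  pair-linˡ {zero}  {suc n} c d x x′ y = lin-zero c d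
  pair-linˡ {suc m} {zero}  c d x x′ y = lin-zero c d
  pair-linˡ {suc m} {suc n} c d x x′ y =
    trans (cong₂ _+_ (pair-linˡ c d (x ∘ (false ∷_)) (x′ ∘ (false ∷_)) _)
                     (pair-linˡ c d (x ∘ (true ∷_)) (x′ ∘ (true ∷_)) _))
      (lin-alg c d _ (pair (x′ ∘ (false ∷_)) _) _ _)

  pair-linʳ : ∀ {m n} c d (x : Fock m) (y y′ : Fock n) →
    pair x (λ T → c * y T + d * y′ T) ≡ c * pair x y + d * pair x y′
  pair-linʳ {zero}  {zero}  c d x y y′ = alg c d (x []) (y []) (y′ [])
    where
    alg : ∀ c d x y y′ → x * (c * y + d * y′) ≡ c * (x * y) + d * (x * y′)
    alg = solve-∀
  pair-linʳ {zero}  {suc n} c d x y y′ = lin-zero c d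
  pair-linʳ {suc m} {zero}  c d x y y′ = lin-zero c d
  pair-linʳ {suc m} {suc n} c d x y y′ =
    trans (cong₂ _+_ (pair-linʳ c d (x ∘ (false ∷_)) (y ∘ (true ∷_)) (y′ ∘ (true ∷_)))
                     (pair-linʳ c d (x ∘ (true ∷_)) (y ∘ (false ∷_)) (y′ ∘ (false ∷_))))
      (lin-alg c d _ (pair (x ∘ (false ∷_)) (y′ ∘ (true ∷_))) _ _)

  -- The substitution z ↦ -z.
  bar : Series → Series
  bar v zero    = v 0
  bar v (suc i) = - bar (v ∘ suc) i

  wedge-neg : ∀ {n} v (x : Fock n) S → wedge (λ i → - v i) x S ≡ - wedge v x S
  wedge-neg v x S = trans (wedge-cong {w = (- + 1) ·ˢ v} (λ i → sym (ℤP.-1*i≡-i (v i))) (λ _ → refl) S)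
    (trans (wedge-·ˢ (- + 1) v x S) (ℤP.-1*i≡-i _))

  -- Inserting site i costs one sign per occupied site before it on the one side, and one per vacant
  -- site before it on the other. Together these are all i sites before it, which leaves (-1)^i, the
  -- effect of z ↦ -z.
  pair-wedge : ∀ {n} v (x y : Fock n) → pair (wedge v x) y ≡ pair x (wedge (bar v) y)
  pair-wedge {zero}  v x y = sym (ℤP.*-zeroʳ (x []))
  pair-wedge {suc n} v x y = begin
    pair (wedge v′ x₀) y₁ + pair (λ T → v 0 * x₀ T - wedge v′ x₁ T) y₀
      ≡⟨ cong₂ _+_ (pair-wedge v′ x₀ y₁)
           (trans (pair-cong (λ T → as-lin (v 0) (x₀ T) _) (λ _ → refl))
             (trans (pair-linˡ (v 0) (- + 1) x₀ (wedge v′ x₁) y₀)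
               (cong (λ t → v 0 * pair x₀ y₀ + - + 1 * t) (pair-wedge v′ x₁ y₀)))) ⟩
    pair x₀ (wedge (bar v′) y₁) + (v 0 * pair x₀ y₀ + - + 1 * pair x₁ (wedge (bar v′) y₀))
      ≡⟨ alg (v 0) _ _ _ ⟩
    (v 0 * pair x₀ y₀ + + 1 * pair x₀ (wedge (bar v′) y₁))
      + (- + 1 * pair x₁ (wedge (bar v′) y₀) + + 0 * pair x₁ y₀)
      ≡⟨ cong₂ _+_ (pair-linʳ (v 0) (+ 1) x₀ y₀ (wedge (bar v′) y₁))
           (pair-linʳ (- + 1) (+ 0) x₁ (wedge (bar v′) y₀) y₀) ⟨
    pair x₀ (λ T → v 0 * y₀ T + + 1 * wedge (bar v′) y₁ T)
      + pair x₁ (λ T → - + 1 * wedge (bar v′) y₀ T + + 0 * y₀ T)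
      ≡⟨ cong₂ _+_
           (pair-cong {x = x₀} (λ _ → refl) (λ T → trans (alg₁ (v 0 * y₀ T) (wedge (bar v′) y₁ T))
             (cong (λ t → v 0 * y₀ T - t) (sym (wedge-neg (bar v′) y₁ T)))))
           (pair-cong {x = x₁} (λ _ → refl) (λ T → trans (alg₂ (wedge (bar v′) y₀ T) (y₀ T)) (sym (wedge-neg
               (bar v′) y₀ T)))) ⟩
    pair x₀ (λ T → v 0 * y₀ T - wedge (bar v ∘ suc) y₁ T) + pair x₁ (wedge (bar v ∘ suc) y₀) ∎
    where
    x₀ = x ∘ (false ∷_)
    x₁ = x ∘ (true ∷_)
    y₀ = y ∘ (false ∷_)
    y₁ = y ∘ (true ∷_)
    v′ = v ∘ suc
    alg : ∀ c p q r → p + (c * q + - + 1 * r) ≡ (c * q + + 1 * p) + (- + 1 * r + + 0)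
    alg = solve-∀
    alg₁ : ∀ p q → p + + 1 * q ≡ p - - q
    alg₁ = solve-∀
    alg₂ : ∀ p q → - + 1 * p + + 0 * q ≡ - p
    alg₂ = solve-∀

  top : ∀ {n} → Fock n → ℤ
  top {n} x = x (replicate n true)

  pair-vac : ∀ {n} (y : Fock n) → pair {n} {n} vac y ≡ top y
  pair-zero : ∀ {n} (y : Fock n) → pair {n} {n} (λ _ → + 0) y ≡ + 0
  pair-zero {zero}  y = refl
  pair-zero {suc n} y = cong₂ _+_ (pair-zero (y ∘ (true ∷_))) (pair-zero (y ∘ (false ∷_)))
  pair-vac {zero}  y = ℤP.*-identityˡ (y [])
  pair-vac {suc n} y =
    trans (cong₂ _+_ (pair-vac (y ∘ (true ∷_))) (pair-zero (y ∘ (false ∷_)))) (ℤP.+-identityʳ (top y))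

  -- The adjoints act in the opposite order, so the factor with the largest index is outermost.
  wedges : ∀ {n} → (ℕ → Series) → ℕ → Fock n → Fock n
  wedges f zero    y = y
  wedges f (suc k) y = wedge (bar (f k)) (wedges f k y)

  wedges-shift : ∀ {n} f k (y : Fock n) → wedges (f ∘ suc) k (wedge (bar (f 0)) y) ≡ wedges f (suc k) y
  wedges-shift f zero    y = refl
  wedges-shift f (suc k) y = cong (wedge (bar (f (suc k)))) (wedges-shift f k y)

  pair-ω : ∀ {n} f k (y : Fock n) → pair {n} {n} (ω (applyUpTo f k)) y ≡ top (wedges f k y)
  pair-ω f zero    y = pair-vac y
  pair-ω {n} f (suc k) y = begin
    pair {n} {n} (wedge (f 0) (ω (applyUpTo (f ∘ suc) k))) y ≡⟨ pair-wedge (f 0) (ω (applyUpTo (f ∘ suc) k)) y ⟩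
    pair {n} {n} (ω (applyUpTo (f ∘ suc) k)) (wedge (bar (f 0)) y) ≡⟨ pair-ω (f ∘ suc) k (wedge (bar (f 0)) y) ⟩
    top (wedges (f ∘ suc) k (wedge (bar (f 0)) y))         ≡⟨ cong top (wedges-shift f k y) ⟩
    top (wedges f (suc k) y) ∎

-- Reducing the conjugate factors to powers of u.

module Elimination where

  open Exterior
  open Walks
  open import Data.Nat as ℕ using (ℕ; zero; suc)
  open import Data.Bool using (Bool)
  open import Data.Integer using (ℤ; +_; _+_; _-_; _*_; -_)
  open import Data.Integer.Tactic.RingSolver using (solve-∀)
  open import Data.Vec using (Vec; []; _∷_)
  open ≡-Reasoning

  Z-linear : Linear Z
  Linear.lin-cong Z-linear e zero    = refl
  Linear.lin-cong Z-linear e (suc i) = e i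
  Linear.lin-0 Z-linear zero         = refl
  Linear.lin-0 Z-linear (suc i)      = refl
  Linear.lin-+ Z-linear v w zero     = refl
  Linear.lin-+ Z-linear v w (suc i)  = refl
  Linear.lin-· Z-linear c v zero     = sym (ℤP.*-zeroʳ c)
  Linear.lin-· Z-linear c v (suc i)  = refl

  mulu : Series → Series
  mulu v = A (Z v)

  mulu-linear : Linear mulu
  Linear.lin-cong mulu-linear e i = cong₂ _+_ (Z.lin-cong e i) (Z.lin-cong (Z.lin-cong e) i)
    where module Z = Linear Z-linear
  Linear.lin-0 mulu-linear zero          = refl
  Linear.lin-0 mulu-linear (suc zero)    = refl
  Linear.lin-0 mulu-linear (suc (suc i)) = refl
  Linear.lin-+ mulu-linear v w i =
    trans (cong₂ _+_ (Z.lin-+ v w i) (trans (Z.lin-cong (Z.lin-+ v w) i) (Z.lin-+ (Z v) (Z w) i)))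
      (alg (Z v i) (Z w i) (Z (Z v) i) (Z (Z w) i))
    where
    module Z = Linear Z-linear
    alg : ∀ p q r s → (p + q) + (r + s) ≡ (p + r) + (q + s)
    alg = solve-∀
  Linear.lin-· mulu-linear c v i =
    trans (cong₂ _+_ (Z.lin-· c v i) (trans (Z.lin-cong (Z.lin-· c v) i) (Z.lin-· c (Z v) i)))
      (sym (ℤP.*-distribˡ-+ c (Z v i) (Z (Z v) i)))
    where module Z = Linear Z-linear

  Z-A : ∀ v → Z (A v) ≈ˢ A (Z v)
  Z-A v = Linear.lin-+ Z-linear v (Z v)

  U : ℕ → Series
  U zero    = 1ˢ
  U (suc j) = mulu (U j)

  h≈AU : ∀ j → h j ≈ˢ A (U j)
  h≈AU zero    i = refl
  h≈AU (suc j) i = cong₂ _+_ (e i) (Linear.lin-cong Z-linear e i)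
    where
    e : Z (h j) ≈ˢ U (suc j)
    e i = trans (Linear.lin-cong Z-linear (h≈AU j) i) (Z-A (U j) i)

  Zh≈U : ∀ j → Z (h j) ≈ˢ U (suc j)
  Zh≈U j i = trans (Linear.lin-cong Z-linear (h≈AU j) i) (Z-A (U j) i)

  ZU≈h-U : ∀ j → Z (U j) ≈ˢ h j -ˢ U j
  ZU≈h-U j i = trans (alg (U j i) (Z (U j) i)) (cong (_- U j i) (sym (h≈AU j i)))
    where
    alg : ∀ a b → b ≡ (a + b) - a
    alg = solve-∀

  -- Multiplied by z, the span consists of the p(u) + z q(u) with p(0) = 0, deg p ≤ m and deg q < k.
  data G (k m : ℕ) : Series → Set where
    gu : ∀ {j} → j ℕ.< k → G k m (U j)
    gh : ∀ {i} → i ℕ.< m → G k m (h i)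

  Sp : ℕ → ℕ → Series → Set
  Sp k m = Span (G k m)

  sub : ∀ {P v w} → Span P v → Span P w → Span P (v -ˢ w)
  sub {v = v} {w} p q = resp (λ i → cong (λ t → v i + t) (ℤP.-1*i≡-i (w i))) (add p (scl (- + 1) q))

  Sp-mono : ∀ {k m k′ m′ v} → k ℕ.≤ k′ → m ℕ.≤ m′ → Sp k m v → Sp k′ m′ v
  Sp-mono p q = Span-mono λ where
    (gu j<k) → gen (gu (ℕP.<-≤-trans j<k p))
    (gh i<m) → gen (gh (ℕP.<-≤-trans i<m q))

  Sp-u : ∀ {k m v} → Sp k m v → Sp (suc k) (suc m) (mulu v)
  Sp-u = Span-map mulu-linear λ where
    (gu j<k) → gen (gu (ℕ.s≤s j<k))
    (gh i<m) → gen (gh (ℕ.s≤s i<m))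

  -- Since z² = u - z, one has z uⁱ = hᵢ - uⁱ and z hᵢ = uⁱ⁺¹. So only the range of the powers of u
  -- grows.
  Sp-Z : ∀ {j v} → Sp j j v → Sp (suc j) j (Z v)
  Sp-Z = Span-map Z-linear λ where
    (gu {i} i<j) → resp (λ l → sym (ZU≈h-U i l)) (sub (gen (gh i<j)) (gen (gu (ℕP.m<n⇒m<1+n i<j))))
    (gh {i} i<j) → resp (λ l → sym (Zh≈U i l)) (gen (gu (ℕ.s≤s i<j)))

  bar-cong : ∀ {v w} → v ≈ˢ w → bar v ≈ˢ bar w
  bar-cong e zero    = e 0
  bar-cong e (suc i) = cong -_ (bar-cong (e ∘ suc) i)

  bar-+ : ∀ v w → bar (v +ˢ w) ≈ˢ bar v +ˢ bar w
  bar-+ v w zero    = refl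
  bar-+ v w (suc i) = trans (cong -_ (bar-+ (v ∘ suc) (w ∘ suc) i)) (ℤP.neg-distrib-+ (bar (v ∘ suc) i) _)

  bar-Z : ∀ v i → bar (Z v) i ≡ - Z (bar v) i
  bar-Z v zero    = refl
  bar-Z v (suc i) = refl

  bar-mulu : ∀ v i → bar (mulu v) i ≡ Z (Z (bar v)) i - Z (bar v) i
  bar-mulu v i = begin
    bar (Z v +ˢ Z (Z v)) i               ≡⟨ bar-+ (Z v) (Z (Z v)) i ⟩
    bar (Z v) i + bar (Z (Z v)) i        ≡⟨ cong₂ _+_ (bar-Z v i) (bar-Z (Z v) i) ⟩
    - Z (bar v) i - Z (bar (Z v)) i      ≡⟨ cong (λ t → - Z (bar v) i - t) (neg i) ⟩
    - Z (bar v) i - - Z (Z (bar v)) i    ≡⟨ alg (Z (bar v) i) (Z (Z (bar v)) i) ⟩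
    Z (Z (bar v)) i - Z (bar v) i ∎
    where
    neg : ∀ i → Z (bar (Z v)) i ≡ - Z (Z (bar v)) i
    neg zero    = refl
    neg (suc i) = bar-Z v i
    alg : ∀ a b → - a - - b ≡ b - a
    alg = solve-∀

  cst : ℕ → ℤ
  cst j = + 2 * + suc j

  err : ℕ → Series
  err j = bar (h j) -ˢ (cst j ·ˢ U j -ˢ h j)

  -- The recursion multiplies by u(-z) = u - 2z. Since z uʲ = hⱼ - uʲ and z hⱼ = uʲ⁺¹, the form c uʲ
  -- - hⱼ becomes (c + 2) uʲ⁺¹ - hⱼ₊₁ - 2c (hⱼ - uʲ): the constant rises by 2 in each step, starting
  -- from 1 - z = 2 - (1 + z).
  err-Sp : ∀ j → Sp j j (err j)
  err-Sp zero    = resp e zer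
    where
    e : 0ˢ ≈ˢ err 0
    e zero                = refl
    e (suc zero)          = refl
    e (suc (suc i))       = sym (alg (bar (λ _ → + 0) i) (bz i))
      where
      bz : ∀ i → bar (λ _ → + 0) i ≡ + 0
      bz zero    = refl
      bz (suc i) = cong -_ (bz i)
      alg : ∀ a → a ≡ + 0 → - - a - (+ 2 * + 1 * + 0 - (+ 0 + + 0)) ≡ + 0
      alg _ refl = refl
  err-Sp (suc j) = resp e
    (sub (sub (Sp-u (err-Sp j)) (scl (+ 2) (Sp-mono ℕP.≤-refl (ℕP.n≤1+n j) (Sp-Z (err-Sp j)))))
         (scl (+ 2 * cst j) (sub (gen (gh ℕP.≤-refl)) (gen (gu ℕP.≤-refl)))))
    where
    module Z = Linear Z-linear
    b = bar (h j)
    Zerr : ∀ i → Z (err j) i ≡ Z b i - (cst j * Z (U j) i - Z (h j) i)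
    Zerr zero    = sym (alg (cst j))
      where
      alg : ∀ c → + 0 - (c * + 0 - + 0) ≡ + 0
      alg = solve-∀
    Zerr (suc i) = refl
    ZZerr : ∀ i → Z (Z (err j)) i ≡ Z (Z b) i - (cst j * Z (Z (U j)) i - Z (Z (h j)) i)
    ZZerr zero    = sym (alg (cst j))
      where
      alg : ∀ c → + 0 - (c * + 0 - + 0) ≡ + 0
      alg = solve-∀
    ZZerr (suc i) = Zerr i
    alg : ∀ c zb zzb zu zzu zzh u →
      (((zb - (c * zu - (zu + zzu))) + (zzb - (c * zzu - zzh))) - + 2 * (zb - (c * zu - (zu + zzu))))
        - + 2 * c * ((u + zu) - u)
      ≡ (zzb - zb) - ((c + + 2) * (zu + zzu) - ((zu + zzu) + zzh))
    alg = solve-∀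
    cst-suc : ∀ n → + 2 * + suc n + + 2 ≡ + 2 * + suc (suc n)
    cst-suc n = trans (cong (_+ + 2) (cong (+ 2 *_) (ℤP.pos-+ 1 n)))
      (trans (alg′ (+ n)) (cong (+ 2 *_) (sym (ℤP.pos-+ 2 n))))
      where
      alg′ : ∀ n → + 2 * (+ 1 + n) + + 2 ≡ + 2 * (+ 2 + n)
      alg′ = solve-∀
    e : ((mulu (err j) -ˢ + 2 ·ˢ Z (err j)) -ˢ (+ 2 * cst j) ·ˢ (h j -ˢ U j)) ≈ˢ err (suc j)
    e i = begin
      ((Z (err j) i + Z (Z (err j)) i) - + 2 * Z (err j) i) - + 2 * cst j * (h j i - U j i)
        ≡⟨ cong₂ (λ s t → ((s + t) - + 2 * s) - + 2 * cst j * (h j i - U j i)) (Zerr′ i) (ZZerr i) ⟩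
      ((s₁ + s₂) - + 2 * s₁) - + 2 * cst j * (h j i - U j i)
        ≡⟨ cong (λ t → ((s₁ + s₂) - + 2 * s₁) - + 2 * cst j * (t - U j i)) (h≈AU j i) ⟩
      ((s₁ + s₂) - + 2 * s₁) - + 2 * cst j * ((U j i + Z (U j) i) - U j i)
        ≡⟨ alg (cst j) (Z b i) (Z (Z b) i) (Z (U j) i) (Z (Z (U j)) i) (Z (Z (h j)) i) (U j i) ⟩
      (Z (Z b) i - Z b i) - ((cst j + + 2) * U (suc j) i - (U (suc j) i + Z (Z (h j)) i))
        ≡⟨ cong₂ _-_ (sym (bar-mulu (h j) i))
             (cong₂ (λ c t → c * U (suc j) i - (t + Z (Z (h j)) i)) (cst-suc j) (sym (Zh≈U j i))) ⟩
      err (suc j) i ∎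
      where
      s₁ = Z b i - (cst j * Z (U j) i - (Z (U j) i + Z (Z (U j)) i))
      s₂ = Z (Z b) i - (cst j * Z (Z (U j)) i - Z (Z (h j)) i)
      Zerr′ : ∀ i → Z (err j) i ≡ Z b i - (cst j * Z (U j) i - (Z (U j) i + Z (Z (U j)) i))
      Zerr′ i = trans (Zerr i) (cong (λ t → Z b i - (cst j * Z (U j) i - t)) (Zh≈U j i))

  -- In decreasing order, so that multiplying on the left by the next power of u yields the next
  -- list by definition.
  us : ℕ → List Series
  us zero    = []
  us (suc k) = U k ∷ us k

  ws : ℕ → ℕ → List Series
  ws k m = us k ++ hs m

  ∈-us : ∀ {j} k → j ℕ.< k → U j ∈ us k
  ∈-us {j} (suc k) (ℕ.s≤s j≤k) with j ℕP.≟ k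
  ... | yes refl = here refl
  ... | no j≢k   = there (∈-us k (ℕP.≤∧≢⇒< j≤k j≢k))

  G⇒∈ : ∀ {k m v} → G k m v → v ∈ ws k m
  G⇒∈ {k} (gu j<k) = ∈-++⁺ˡ (∈-us k j<k)
  G⇒∈ {k} (gh i<m) = ∈-++⁺ʳ (us k) (∈-applyUpTo⁺ h i<m)

  csts : ℕ → ℤ
  csts zero    = + 1
  csts (suc k) = csts k * cst k

  -- By `err-Sp` the new factor h̄ₖ is `cst k` times uᵏ minus hₖ, up to a combination of factors
  -- already present; k < m makes hₖ one of these as well, so only the power of u survives.
  wedges-ω : ∀ {n} k m → k ℕ.≤ m → wedges h k (ω (hs m)) ≈ λ (S : Vec Bool n) → csts k * ω (ws k m) S
  wedges-ω zero    m k≤m S = sym (ℤP.*-identityˡ _)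
  wedges-ω (suc k) m k<m S = begin
    wedge b (wedges h k (ω (hs m))) S
      ≡⟨ wedge-congʳ b (wedges-ω k m (ℕP.<⇒≤ k<m)) S ⟩
    wedge b (λ T → csts k * ω (ws k m) T) S ≡⟨ wedge-· (csts k) b (ω (ws k m)) S ⟩
    csts k * wedge b (ω (ws k m)) S         ≡⟨ cong (csts k *_) pivot ⟩
    csts k * (cst k * ω (ws (suc k) m) S)   ≡⟨ ℤP.*-assoc (csts k) (cst k) (ω (ws (suc k) m) S) ⟨
    csts (suc k) * ω (ws (suc k) m) S ∎
    where
    b = bar (h k)
    rest : Sp k m (err k -ˢ h k)
    rest = sub (Sp-mono ℕP.≤-refl (ℕP.<⇒≤ k<m) (err-Sp k)) (gen (gh k<m))
    eq : b ≈ˢ cst k ·ˢ U k +ˢ (err k -ˢ h k)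
    eq i = alg (b i) (cst k * U k i) (h k i)
      where
      alg : ∀ b c h → b ≡ c + ((b - (c - h)) - h)
      alg = solve-∀
    pivot : wedge b (ω (ws k m)) S ≡ cst k * ω (ws (suc k) m) S
    pivot = begin
      wedge b (ω (ws k m)) S ≡⟨ wedge-cong eq (λ _ → refl) S ⟩
      wedge (cst k ·ˢ U k +ˢ (err k -ˢ h k)) (ω (ws k m)) S
        ≡⟨ wedge-linˢ (cst k) (U k) (err k -ˢ h k) (ω (ws k m)) S ⟩
      cst k * wedge (U k) (ω (ws k m)) S + wedge (err k -ˢ h k) (ω (ws k m)) S
        ≡⟨ cong (λ t → cst k * wedge (U k) (ω (ws k m)) S + t)
             (wedge-Span (ω (ws k m)) (λ g → wedge-∈ (G⇒∈ g)) rest S) ⟩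
      cst k * wedge (U k) (ω (ws k m)) S + + 0 ≡⟨ ℤP.+-identityʳ _ ⟩
      cst k * ω (ws (suc k) m) S ∎

-- Padé remainders through the recurrence of Bessel polynomials.

module Remainders where

  open Exterior
  open Walks
  open Elimination
  open import Data.Nat as ℕ using (ℕ; zero; suc; pred; _!)
  open import Data.Integer using (ℤ; +_; _+_; _-_; _*_; -_)
  open import Data.Integer.Tactic.RingSolver using (solve-∀)
  open ≡-Reasoning

  sgn : ℕ → ℤ
  sgn zero    = + 1
  sgn (suc n) = - sgn n

  sgn-sq : ∀ n → sgn n * sgn n ≡ + 1
  sgn-sq zero    = refl
  sgn-sq (suc n) = trans (alg (sgn n)) (sgn-sq n)
    where
    alg : ∀ a → - a * - a ≡ a * a
    alg = solve-∀

  -- Doubling by recursion, so that `bin` and `shift` can consume the two successors by computation.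
  dbl : ℕ → ℕ
  dbl zero    = zero
  dbl (suc i) = suc (suc (dbl i))

  pos-dbl : ∀ i → + dbl i ≡ + 2 * + i
  pos-dbl zero    = refl
  pos-dbl (suc i) = trans (ℤP.pos-+ 2 (dbl i)) (trans (cong (λ t → + 2 + t) (pos-dbl i))
    (trans (alg (+ i)) (cong (+ 2 *_) (sym (ℤP.pos-+ 1 i)))))
    where
    alg : ∀ a → + 2 + + 2 * a ≡ + 2 * (+ 1 + a)
    alg = solve-∀

  bin : ℕ → ℕ → ℤ
  bin _       zero    = + 1
  bin zero    (suc b) = + 0
  bin (suc n) (suc b) = bin n b + bin n (suc b)

  bin-absorb : ∀ n b → + suc b * bin (suc n) (suc b) ≡ + suc n * bin n b
  bin-absorb zero    zero    = refl
  bin-absorb zero    (suc b) = ℤP.*-zeroʳ (+ suc (suc b))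
  bin-absorb (suc n) zero    = begin
    + 1 * (+ 1 + (+ 1 + bin n 1))  ≡⟨ alg (bin n 1) ⟩
    + 1 + + 1 * (+ 1 + bin n 1)    ≡⟨ cong (λ t → + 1 + t) (bin-absorb n zero) ⟩
    + 1 + + suc n * + 1            ≡⟨ alg₁ (+ suc n) ⟩
    (+ 1 + + suc n) * + 1 ∎
    where
    alg : ∀ b → + 1 * (+ 1 + (+ 1 + b)) ≡ + 1 + + 1 * (+ 1 + b)
    alg = solve-∀
    alg₁ : ∀ s → + 1 + s * + 1 ≡ (+ 1 + s) * + 1
    alg₁ = solve-∀
  bin-absorb (suc n) (suc b) = begin
    (+ 1 + + suc b) * (bin (suc n) (suc b) + bin (suc n) (suc (suc b)))
      ≡⟨ alg (+ suc b) (bin (suc n) (suc b)) (bin (suc n) (suc (suc b))) ⟩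
    bin (suc n) (suc b) + (+ suc b * bin (suc n) (suc b) + (+ 1 + + suc b) * bin (suc n) (suc (suc b)))
      ≡⟨ cong₂ (λ s t → bin (suc n) (suc b) + (s + t)) (bin-absorb n b) (bin-absorb n (suc b)) ⟩
    bin (suc n) (suc b) + (+ suc n * bin n b + + suc n * bin n (suc b))
      ≡⟨ alg₁ (+ suc n) (bin n b) (bin n (suc b)) ⟩
    (+ 1 + + suc n) * (bin n b + bin n (suc b)) ∎
    where
    alg : ∀ s x y → (+ 1 + s) * (x + y) ≡ x + (s * x + (+ 1 + s) * y)
    alg = solve-∀
    alg₁ : ∀ s x y → (x + y) + (s * x + s * y) ≡ (+ 1 + s) * (x + y)
    alg₁ = solve-∀

  bin-lower : ∀ n b → + suc b * bin n (suc b) ≡ (+ n - + b) * bin n b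
  bin-lower n b = begin
    + suc b * bin n (suc b)                                ≡⟨ alg (+ suc b) (bin n b) (bin n (suc b)) ⟩
    + suc b * (bin n b + bin n (suc b)) - + suc b * bin n b ≡⟨ cong (_- + suc b * bin n b) (bin-absorb n b) ⟩
    + suc n * bin n b - + suc b * bin n b                   ≡⟨ cong₂ (λ s t →
        s * bin n b - t * bin n b) (ℤP.pos-+ 1 n) (ℤP.pos-+ 1 b) ⟩
    (+ 1 + + n) * bin n b - (+ 1 + + b) * bin n b           ≡⟨ alg₁ (+ n) (+ b) (bin n b) ⟩
    (+ n - + b) * bin n b ∎
    where
    alg : ∀ s x y → s * y ≡ s * (x + y) - s * x
    alg = solve-∀
    alg₁ : ∀ n b x → (+ 1 + n) * x - (+ 1 + b) * x ≡ (n - b) * x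
    alg₁ = solve-∀

  -- E i = (2i)!/i!
  E : ℕ → ℤ
  E zero    = + 1
  E (suc i) = (+ 4 * + i + + 2) * E i

  -- C e i = (e-1+i)!/(i! (e-1-i)!) for e ≥ 1
  C : ℕ → ℕ → ℤ
  C e i = bin (pred (e ℕ.+ i)) (dbl i) * E i

  private
    bin-step : ∀ e i → let N = e ℕ.+ i in
      + suc (dbl i) * bin N (suc (dbl i)) ≡ (+ e - + i) * bin N (dbl i)
    bin-step e i = trans (bin-lower (e ℕ.+ i) (dbl i))
      (cong (_* bin (e ℕ.+ i) (dbl i))
        (trans (cong₂ _-_ (ℤP.pos-+ e i) (pos-dbl i)) (alg (+ e) (+ i))))
      where
      alg : ∀ e i → (e + i) - + 2 * i ≡ e - i
      alg = solve-∀

    pos-sdbl : ∀ i → + suc (dbl i) ≡ + 1 + + 2 * + i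
    pos-sdbl i = trans (ℤP.pos-+ 1 (dbl i)) (cong (λ t → + 1 + t) (pos-dbl i))

  -- The sum of C e i xⁱ over i is the Bessel polynomial y(e-1) evaluated at 2x, and this is the
  -- recurrence y(e+1)(x) = (2e+1) x y(e)(x) + y(e-1)(x), where y(-1) = 1.
  C-rec : ∀ e i → C (suc (suc e)) (suc i) ≡ C e (suc i) + (+ 4 * + e + + 2) * C (suc e) i
  C-rec e i rewrite ℕP.+-suc e i = begin
    ((b + b₁) + (b₁ + b₂)) * ((+ 4 * + i + + 2) * E i)
      ≡⟨ alg (+ i) b b₁ b₂ (E i) ⟩
    b₂ * ((+ 4 * + i + + 2) * E i) + ((+ 4 * + i + + 2) * b + + 4 * ((+ 1 + + 2 * + i) * b₁)) * E i
      ≡⟨ cong (λ t → b₂ * ((+ 4 * + i + + 2) * E i) + ((+ 4 * + i + + 2) * b + + 4 * t) * E i)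
           (trans (cong (_* b₁) (sym (pos-sdbl i))) (bin-step e i)) ⟩
    b₂ * ((+ 4 * + i + + 2) * E i) + ((+ 4 * + i + + 2) * b + + 4 * ((+ e - + i) * b)) * E i
      ≡⟨ alg₁ (+ i) (+ e) b b₂ (E i) ⟩
    b₂ * ((+ 4 * + i + + 2) * E i) + (+ 4 * + e + + 2) * (b * E i) ∎
    where
    b = bin (e ℕ.+ i) (dbl i)
    b₁ = bin (e ℕ.+ i) (suc (dbl i))
    b₂ = bin (e ℕ.+ i) (suc (suc (dbl i)))
    alg : ∀ i b b₁ b₂ E → ((b + b₁) + (b₁ + b₂)) * ((+ 4 * i + + 2) * E)
      ≡ b₂ * ((+ 4 * i + + 2) * E) + ((+ 4 * i + + 2) * b + + 4 * ((+ 1 + + 2 * i) * b₁)) * E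
    alg = solve-∀
    alg₁ : ∀ i e b b₂ E → b₂ * ((+ 4 * i + + 2) * E) + ((+ 4 * i + + 2) * b + + 4 * ((e - i) * b)) * E
      ≡ b₂ * ((+ 4 * i + + 2) * E) + (+ 4 * e + + 2) * (b * E)
    alg₁ = solve-∀

  pos-! : ∀ n → + (suc n !) ≡ + suc n * + (n !)
  pos-! n = ℤP.pos-* (suc n) (n !)

  -- On the right stands a coefficient of hₑ = z^e (1+z)^(e+1) after the scaling `D`. So the scaled
  -- hₑ is a multiple of a shifted Bessel polynomial, which starts the induction on k in `lower-R`.
  C-closed : ∀ e i → + (suc e !) * C (suc (suc e)) i ≡ + (suc (e ℕ.+ i) !) * bin (suc e) i
  C-closed e zero rewrite ℕP.+-identityʳ e = refl
  -- With M = e + 1 + i, consecutive terms have the ratio (M+1)(e+1-i)/(i+1) on both sides; the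
  -- denominator is cleared first.
  C-closed e (suc i) rewrite ℕP.+-suc e i = ℤP.*-cancelˡ-≡ (+ suc i) _ _ (begin
    + suc i * (m! * (b₂ * ((+ 4 * + i + + 2) * E i)))
      ≡⟨ cong (_* (m! * (b₂ * ((+ 4 * + i + + 2) * E i)))) (ℤP.pos-+ 1 i) ⟩
    (+ 1 + + i) * (m! * (b₂ * ((+ 4 * + i + + 2) * E i)))
      ≡⟨ alg (+ i) m! b₂ (E i) ⟩
    m! * ((+ 1 + + 2 * + i) * ((+ 2 + + 2 * + i) * b₂)) * E i
      ≡⟨ cong (λ t → m! * t * E i) twice ⟩
    m! * (+ suc M * ((+ suc e - + i) * b)) * E i
      ≡⟨ alg₁ m! (+ suc M) (+ suc e - + i) b (E i) ⟩
    + suc M * (+ suc e - + i) * (m! * (b * E i))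
      ≡⟨ cong (+ suc M * (+ suc e - + i) *_) (C-closed e i) ⟩
    + suc M * (+ suc e - + i) * (+ (suc (e ℕ.+ i) !) * bin (suc e) i)
      ≡⟨ alg₂ (+ suc M) (+ suc e - + i) (+ (suc (e ℕ.+ i) !)) (bin (suc e) i) ⟩
    + suc M * + (M !) * ((+ suc e - + i) * bin (suc e) i)
      ≡⟨ cong₂ _*_ (sym (pos-! M)) (sym (bin-lower (suc e) i)) ⟩
    + (suc M !) * (+ suc i * bin (suc e) (suc i))
      ≡⟨ alg₃ (+ (suc M !)) (+ suc i) (bin (suc e) (suc i)) ⟩
    + suc i * (+ (suc M !) * bin (suc e) (suc i)) ∎)
    where
    M = suc (e ℕ.+ i)
    m! = + (suc e !)
    b = bin M (dbl i)
    b₁ = bin M (suc (dbl i))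
    b₂ = bin (suc M) (suc (suc (dbl i)))
    pos-ssdbl : + suc (suc (dbl i)) ≡ + 2 + + 2 * + i
    pos-ssdbl = trans (ℤP.pos-+ 2 (dbl i)) (cong (λ t → + 2 + t) (pos-dbl i))
    twice : (+ 1 + + 2 * + i) * ((+ 2 + + 2 * + i) * b₂) ≡ + suc M * ((+ suc e - + i) * b)
    twice = begin
      (+ 1 + + 2 * + i) * ((+ 2 + + 2 * + i) * b₂)
        ≡⟨ cong (λ t → (+ 1 + + 2 * + i) * (t * b₂)) (sym pos-ssdbl) ⟩
      (+ 1 + + 2 * + i) * (+ suc (suc (dbl i)) * b₂)
        ≡⟨ cong ((+ 1 + + 2 * + i) *_) (bin-absorb M (suc (dbl i))) ⟩
      (+ 1 + + 2 * + i) * (+ suc M * b₁)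
        ≡⟨ alg₄ (+ 1 + + 2 * + i) (+ suc M) b₁ ⟩
      + suc M * ((+ 1 + + 2 * + i) * b₁)
        ≡⟨ cong (λ t → + suc M * (t * b₁)) (sym (pos-sdbl i)) ⟩
      + suc M * (+ suc (dbl i) * b₁)
        ≡⟨ cong (+ suc M *_) (bin-step (suc e) i) ⟩
      + suc M * ((+ suc e - + i) * b) ∎
      where
      alg₄ : ∀ a b c → a * (b * c) ≡ b * (a * c)
      alg₄ = solve-∀
    alg : ∀ i m b E → (+ 1 + i) * (m * (b * ((+ 4 * i + + 2) * E)))
      ≡ m * ((+ 1 + + 2 * i) * ((+ 2 + + 2 * i) * b)) * E
    alg = solve-∀
    alg₁ : ∀ m s t b E → m * (s * (t * b)) * E ≡ s * t * (m * (b * E))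
    alg₁ = solve-∀
    alg₂ : ∀ s t f b → s * t * (f * b) ≡ s * f * (t * b)
    alg₂ = solve-∀
    alg₃ : ∀ a b c → a * (b * c) ≡ b * (a * c)
    alg₃ = solve-∀

  shift : ℕ → Series → Series
  shift zero    v = v
  shift (suc n) v = Z (shift n v)

  shift-linear : ∀ n → Linear (shift n)
  Linear.lin-cong (shift-linear zero) e = e
  Linear.lin-0 (shift-linear zero) i = refl
  Linear.lin-+ (shift-linear zero) v w i = refl
  Linear.lin-· (shift-linear zero) c v i = refl
  Linear.lin-cong (shift-linear (suc n)) e = Linear.lin-cong Z-linear (Linear.lin-cong (shift-linear n) e)
  Linear.lin-0 (shift-linear (suc n)) i =
    trans (Linear.lin-cong Z-linear (Linear.lin-0 (shift-linear n)) i) (Linear.lin-0 Z-linear i)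
  Linear.lin-+ (shift-linear (suc n)) v w i =
    trans (Linear.lin-cong Z-linear (Linear.lin-+ (shift-linear n) v w) i) (Linear.lin-+ Z-linear _ _ i)
  Linear.lin-· (shift-linear (suc n)) c v i =
    trans (Linear.lin-cong Z-linear (Linear.lin-· (shift-linear n) c v) i) (Linear.lin-· Z-linear c _ i)

  shift-Z : ∀ n v → shift n (Z v) ≈ˢ Z (shift n v)
  shift-Z zero    v i = refl
  shift-Z (suc n) v   = Linear.lin-cong Z-linear (shift-Z n v)

  A-cong : ∀ {v w} → v ≈ˢ w → A v ≈ˢ A w
  A-cong e i = cong₂ _+_ (e i) (Linear.lin-cong Z-linear e i)

  A-shift : ∀ n v → A (shift n v) ≈ˢ shift n (A v)
  A-shift n v i = sym (trans (Linear.lin-+ (shift-linear n) v (Z v) i)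
    (cong (λ t → shift n v i + t) (shift-Z n v i)))

  A-bin : ∀ n → A (bin n) ≈ˢ bin (suc n)
  A-bin n zero    = refl
  A-bin n (suc i) = ℤP.+-comm (bin n (suc i)) (bin n i)

  h-bin : ∀ e → h e ≈ˢ shift e (bin (suc e))
  h-bin zero i = trans (A-cong one i) (A-bin 0 i)
    where
    one : 1ˢ ≈ˢ bin 0
    one zero    = refl
    one (suc i) = refl
  h-bin (suc e) i = begin
    A (Z (h e)) i                       ≡⟨ A-cong (Linear.lin-cong Z-linear (h-bin e)) i ⟩
    A (shift (suc e) (bin (suc e))) i   ≡⟨ A-shift (suc e) (bin (suc e)) i ⟩
    shift (suc e) (A (bin (suc e))) i   ≡⟨ Linear.lin-cong (shift-linear (suc e)) (A-bin (suc e)) i ⟩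
    shift (suc e) (bin (suc (suc e))) i ∎

  -- Coordinate e is scaled by (e+1)!, which makes the Padé remainders integral and satisfy a
  -- recurrence with a single coefficient.
  diag : (ℕ → ℤ) → Series → Series
  diag f v i = f i * v i

  fact : ℕ → ℤ
  fact i = + (suc i !)

  D : Series → Series
  D = diag fact

  D-linear : Linear D
  Linear.lin-cong D-linear e i = cong (fact i *_) (e i)
  Linear.lin-0 D-linear i      = ℤP.*-zeroʳ (fact i)
  Linear.lin-+ D-linear v w i  = ℤP.*-distribˡ-+ (fact i) (v i) (w i)
  Linear.lin-· D-linear c v i  = alg (fact i) c (v i)
    where
    alg : ∀ a b c → a * (b * c) ≡ b * (a * c)
    alg = solve-∀

  diag-shift : ∀ n f v → diag f (shift n v) ≈ˢ shift n (diag (λ i → f (n ℕ.+ i)) v)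
  diag-shift zero    f v i       = refl
  diag-shift (suc n) f v zero    = ℤP.*-zeroʳ (f 0)
  diag-shift (suc n) f v (suc i) = diag-shift n (f ∘ suc) v i

  -- The alternating sign makes the coefficient 4e + 2 in `T-rec` positive, and with it the pivots.
  T : ℕ → Series
  T e i = sgn e * C e i

  -- Meant for m = k + e: the order 2k + e is then k + m, the number of factors in `ws k m`.
  R : ℕ → ℕ → Series
  R k e = shift (dbl k ℕ.+ e) (T e)

  T-rec : ∀ e → (+ 4 * + e + + 2) ·ˢ Z (T (suc e)) ≈ˢ T e -ˢ T (suc (suc e))
  T-rec e zero    = alg (sgn e) (+ 4 * + e + + 2)
    where
    alg : ∀ s c → c * + 0 ≡ s * + 1 - - - s * + 1
    alg = solve-∀
  T-rec e (suc i) = sym (trans (cong (λ t → sgn e * C e (suc i) - - - sgn e * t) (C-rec e i))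
    (alg (sgn e) (C e (suc i)) (+ 4 * + e + + 2) (C (suc e) i)))
    where
    alg : ∀ s c f d → s * c - - - s * (c + f * d) ≡ f * (- s * d)
    alg = solve-∀

  shift-+ : ∀ m n v → shift (m ℕ.+ n) v ≡ shift m (shift n v)
  shift-+ zero    n v = refl
  shift-+ (suc m) n v = cong Z (shift-+ m n v)

  shift-T-rec : ∀ N e → (+ 4 * + e + + 2) ·ˢ shift (suc N) (T (suc e)) ≈ˢ shift N (T e) -ˢ shift N (T (suc (suc e)))
  shift-T-rec N e i = begin
    c * Z (shift N (T (suc e))) i        ≡⟨ cong (c *_) (sym (shift-Z N (T (suc e)) i)) ⟩
    c * shift N (Z (T (suc e))) i        ≡⟨ sym (L.lin-· c (Z (T (suc e))) i) ⟩
    shift N (c ·ˢ Z (T (suc e))) i       ≡⟨ L.lin-cong (T-rec e) i ⟩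
    shift N (T e -ˢ T (suc (suc e))) i   ≡⟨ L.lin-cong (λ j → cong (λ t →
        T e j + t) (sym (ℤP.-1*i≡-i (T (suc (suc e)) j)))) i ⟩
    shift N (T e +ˢ - + 1 ·ˢ T (suc (suc e))) i ≡⟨ L.lin-+ (T e) (- + 1 ·ˢ T (suc (suc e))) i ⟩
    shift N (T e) i + shift N (- + 1 ·ˢ T (suc (suc e))) i
      ≡⟨ cong (λ t → shift N (T e) i + t) (trans (L.lin-· (- + 1) (T (suc (suc e))) i) (ℤP.-1*i≡-i _)) ⟩
    shift N (T e) i - shift N (T (suc (suc e))) i ∎
    where
    module L = Linear (shift-linear N)
    c = + 4 * + e + + 2

  data DG (k m : ℕ) : Series → Set where
    dg : ∀ {v} → G k m v → DG k m (D v)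

  DSp : ℕ → ℕ → Series → Set
  DSp k m = Span (DG k m)

  D-Sp : ∀ {k m v} → Sp k m v → DSp k m (D v)
  D-Sp = Span-map D-linear (λ g → gen (dg g))

  DSp-mono : ∀ {k m k′ m′ v} → k ℕ.≤ k′ → m ℕ.≤ m′ → DSp k m v → DSp k′ m′ v
  DSp-mono p q = Span-mono λ where
    (dg (gu j<k)) → gen (dg (gu (ℕP.<-≤-trans j<k p)))
    (dg (gh i<m)) → gen (dg (gh (ℕP.<-≤-trans i<m q)))

  zp : ℕ → Series
  zp n = shift n 1ˢ

  -- From u z^i = z^(i+1) + z^(i+2): the powers of z and the sequence 1, h₀, u, h₁, ... differ by a
  -- unitriangular change of basis, found alternately for even and odd exponents.
  zp-even : ∀ k → Sp k k (zp (dbl k) -ˢ U k)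
  zp-odd  : ∀ k → Sp (suc k) k (zp (suc (dbl k)) -ˢ h k)
  private
    mulu-sub : ∀ v w → mulu (v -ˢ w) ≈ˢ mulu v -ˢ mulu w
    mulu-sub v w i = begin
      mulu (v -ˢ w) i             ≡⟨ L.lin-cong (λ j → cong (λ t → v j + t) (sym (ℤP.-1*i≡-i (w j)))) i ⟩
      mulu (v +ˢ - + 1 ·ˢ w) i    ≡⟨ L.lin-+ v (- + 1 ·ˢ w) i ⟩
      mulu v i + mulu (- + 1 ·ˢ w) i ≡⟨ cong (λ t → mulu v i + t) (trans (L.lin-· (- + 1) w i) (ℤP.-1*i≡-i _)) ⟩
      mulu v i - mulu w i ∎
      where module L = Linear mulu-linear
  zp-even zero    = resp (λ i → sym (ℤP.+-inverseʳ (1ˢ i))) zer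
  zp-even (suc k) = resp e (sub (Sp-u (zp-even k))
    (add (Sp-mono ℕP.≤-refl (ℕP.n≤1+n k) (zp-odd k)) (gen (gh ℕP.≤-refl))))
    where
    alg : ∀ a b c d → ((a + b) - c) - ((a - d) + d) ≡ b - c
    alg = solve-∀
    e : (mulu (zp (dbl k) -ˢ U k) -ˢ ((zp (suc (dbl k)) -ˢ h k) +ˢ h k)) ≈ˢ zp (dbl (suc k)) -ˢ U (suc k)
    e i = trans (cong (λ t → t - ((zp (suc (dbl k)) i - h k i) + h k i)) (mulu-sub (zp (dbl k)) (U k) i))
      (alg (zp (suc (dbl k)) i) (zp (dbl (suc k)) i) (U (suc k) i) (h k i))
  zp-odd zero    = resp e (scl (- + 1) (gen (gu {j = 0} ℕP.≤-refl)))
    where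
    e : - + 1 ·ˢ U 0 ≈ˢ zp 1 -ˢ h 0
    e zero          = refl
    e (suc zero)    = refl
    e (suc (suc i)) = refl
  zp-odd (suc k) = resp e (sub (Sp-u (zp-odd k))
    (add (Sp-mono (ℕP.n≤1+n (suc k)) ℕP.≤-refl (zp-even (suc k))) (gen (gu ℕP.≤-refl))))
    where
    alg : ∀ a b c d → ((a + b) - c) - ((a - d) + d) ≡ b - c
    alg = solve-∀
    e : (mulu (zp (suc (dbl k)) -ˢ h k) -ˢ ((zp (dbl (suc k)) -ˢ U (suc k)) +ˢ U (suc k)))
          ≈ˢ zp (suc (dbl (suc k))) -ˢ h (suc k)
    e i = trans (cong (λ t → t - ((zp (dbl (suc k)) i - U (suc k) i) + U (suc k) i)) (mulu-sub (zp (suc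
        (dbl k))) (h k) i))
      (alg (zp (dbl (suc k)) i) (zp (suc (dbl (suc k))) i) (h (suc k) i) (U (suc k) i))

  -- This is (2e)!/e!, arising as the product of the recurrence coefficients 4i + 2 over i < e.
  μ : ℕ → ℕ
  μ zero    = 1
  μ (suc e) = (4 ℕ.* e ℕ.+ 2) ℕ.* μ e

  -- (2k+1)! is the scaling at site 2k, the only one that `R k 0` meets; `μ e` collects e
  -- applications of `T-rec`.
  pivot : ℕ → ℕ → ℤ
  pivot k e = + (suc (dbl k) ! ℕ.* μ e)

  μ≢0 : ∀ e → μ e ≢ 0
  μ≢0 (suc e) eq with ℕP.m*n≡0⇒m≡0∨n≡0 (4 ℕ.* e ℕ.+ 2) eq
  ... | inj₁ p with ℕP.m+n≡0⇒n≡0 (4 ℕ.* e) p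
  ...   | ()
  μ≢0 (suc e) eq | inj₂ p = μ≢0 e p

  pivot≢0 : ∀ k e → pivot k e ≢ + 0
  pivot≢0 k e eq with ℕP.m*n≡0⇒m≡0∨n≡0 (suc (dbl k) !) (ℤP.+-injective eq)
  ... | inj₁ p = ℕP.<⇒≢ (ℕP.1≤n! (suc (dbl k))) (sym p)
  ... | inj₂ p = μ≢0 e p

  pivot-suc : ∀ k e → pivot k (suc e) ≡ pivot k e * (+ 4 * + e + + 2)
  pivot-suc k e = begin
    + (f ℕ.* (c ℕ.* μ e))   ≡⟨ ℤP.pos-* f (c ℕ.* μ e) ⟩
    + f * + (c ℕ.* μ e)     ≡⟨ cong (+ f *_) (ℤP.pos-* c (μ e)) ⟩
    + f * (+ c * + μ e)     ≡⟨ alg (+ f) (+ c) (+ μ e) ⟩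
    + f * + μ e * + c       ≡⟨ cong₂ _*_ (sym (ℤP.pos-* f (μ e))) (trans (ℤP.pos-+ (4 ℕ.* e) 2) (cong (_+ + 2)
        (ℤP.pos-* 4 e))) ⟩
    pivot k e * (+ 4 * + e + + 2) ∎
    where
    f = suc (dbl k) !
    c = 4 ℕ.* e ℕ.+ 2
    alg : ∀ f c m → f * (c * m) ≡ f * m * c
    alg = solve-∀

  C-0 : ∀ i → C 0 (suc i) ≡ + 0
  C-0 i = cong (_* E (suc i)) (bin-0 i (suc (dbl i)) (s≤dbl i))
    where
    s≤dbl : ∀ i → i ℕ.≤ suc (dbl i)
    s≤dbl zero    = ℕ.z≤n
    s≤dbl (suc i) = ℕ.s≤s (ℕP.m≤n⇒m≤1+n (s≤dbl i))
    bin-0 : ∀ n b → n ℕ.≤ b → bin n (suc b) ≡ + 0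
    bin-0 zero    b       _         = refl
    bin-0 (suc n) (suc b) (ℕ.s≤s p) = cong₂ _+_ (bin-0 n b p) (bin-0 n (suc b) (ℕP.m≤n⇒m≤1+n p))

  T-0 : T 0 ≈ˢ 1ˢ
  T-0 zero    = refl
  T-0 (suc i) = trans (cong (+ 1 *_) (C-0 i)) refl

  -- Induction on e replaces `T e` by `T (suc e)` through `T-rec`. The difference involves
  -- `T (suc (suc e))`, which lies in the span by `lower-R`; that lemma in turn descends in k. For e
  -- = 0 the claim is that z^(2k) is congruent to uᵏ.
  remainder   : ∀ k e → DSp k (k ℕ.+ e) (pivot k e ·ˢ R k e -ˢ D (U k))
  -- For k = 0 the lower neighbour is itself a multiple of the generator D (h e).
  lower-R : ∀ k e → DSp k (k ℕ.+ suc e) (shift (dbl k ℕ.+ e) (T (suc (suc e))))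
  remainder k zero = resp eq (D-Sp (Sp-mono ℕP.≤-refl (ℕP.m≤m+n k 0) (zp-even k)))
    where
    alg : ∀ f a b → f * (a - b) ≡ f * a - f * b
    alg = solve-∀
    diag-zp : ∀ n (f : ℕ → ℤ) i → f i * zp n i ≡ f n * zp n i
    diag-zp zero    f zero    = refl
    diag-zp zero    f (suc i) = trans (ℤP.*-zeroʳ (f (suc i))) (sym (ℤP.*-zeroʳ (f 0)))
    diag-zp (suc n) f zero    = trans (ℤP.*-zeroʳ (f 0)) (sym (ℤP.*-zeroʳ (f (suc n))))
    diag-zp (suc n) f (suc i) = diag-zp n (f ∘ suc) i
    eq : D (zp (dbl k) -ˢ U k) ≈ˢ pivot k 0 ·ˢ R k 0 -ˢ D (U k)
    eq i = trans (alg (fact i) (zp (dbl k) i) (U k i)) (cong (_- D (U k) i) (begin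
      fact i * zp (dbl k) i       ≡⟨ diag-zp (dbl k) fact i ⟩
      fact (dbl k) * zp (dbl k) i
        ≡⟨ cong₂ (λ f n → + f * n) (sym (ℕP.*-identityʳ (suc (dbl k) !)))
             (trans (sym (Linear.lin-cong (shift-linear (dbl k)) T-0 i))
               (cong (λ n → shift n (T 0) i) (sym (ℕP.+-identityʳ (dbl k))))) ⟩
      pivot k 0 * R k 0 i ∎))
  remainder k (suc e) = resp eq (sub (DSp-mono ℕP.≤-refl (ℕP.+-monoʳ-≤ k (ℕP.n≤1+n e)) (remainder k e))
    (scl (pivot k e) (lower-R k e)))
    where
    N = dbl k ℕ.+ e
    alg : ∀ p a b d → (p * a - d) - p * b ≡ p * (a - b) - d
    alg = solve-∀
    eq : ((pivot k e ·ˢ R k e -ˢ D (U k)) -ˢ pivot k e ·ˢ shift N (T (suc (suc e))))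
           ≈ˢ pivot k (suc e) ·ˢ R k (suc e) -ˢ D (U k)
    eq i = begin
      (pivot k e * shift N (T e) i - D (U k) i) - pivot k e * shift N (T (suc (suc e))) i
        ≡⟨ alg (pivot k e) (shift N (T e) i) (shift N (T (suc (suc e))) i) (D (U k) i) ⟩
      pivot k e * (shift N (T e) i - shift N (T (suc (suc e))) i) - D (U k) i
        ≡⟨ cong (λ t → pivot k e * t - D (U k) i) (sym (shift-T-rec N e i)) ⟩
      pivot k e * ((+ 4 * + e + + 2) * shift (suc N) (T (suc e)) i) - D (U k) i
        ≡⟨ cong (_- D (U k) i) (sym (ℤP.*-assoc (pivot k e) (+ 4 * + e + + 2) (shift (suc N) (T (suc e)) i))) ⟩
      pivot k e * (+ 4 * + e + + 2) * shift (suc N) (T (suc e)) i - D (U k) i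
        ≡⟨ cong₂ (λ p n → p * shift n (T (suc e)) i - D (U k) i) (sym (pivot-suc k e)) (sym (ℕP.+-suc (dbl k) e)) ⟩
      pivot k (suc e) * R k (suc e) i - D (U k) i ∎
  lower-R zero e = divd (+ (suc e !)) (λ eq → ℕP.<⇒≢ (ℕP.1≤n! (suc e)) (sym (ℤP.+-injective eq)))
    (resp eq (scl (sgn e) (gen (dg (gh ℕP.≤-refl)))))
    where
    alg : ∀ a s c → a * (s * c) ≡ s * (a * c)
    alg = solve-∀
    L = shift-linear e
    eq : sgn e ·ˢ D (h e) ≈ˢ (+ (suc e !)) ·ˢ shift e (T (suc (suc e)))
    eq i = begin
      sgn e * (fact i * h e i)                  ≡⟨ cong (λ t → sgn e * (fact i * t)) (h-bin e i) ⟩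
      sgn e * diag fact (shift e (bin (suc e))) i ≡⟨ cong (sgn e *_) (diag-shift e fact (bin (suc e)) i) ⟩
      sgn e * shift e (diag (λ i → fact (e ℕ.+ i)) (bin (suc e))) i
        ≡⟨ sym (Linear.lin-· L (sgn e) _ i) ⟩
      shift e (sgn e ·ˢ diag (λ i → fact (e ℕ.+ i)) (bin (suc e))) i
        ≡⟨ Linear.lin-cong L (λ j → trans (cong (sgn e *_) (sym (C-closed e j)))
             (trans (sym (alg (+ (suc e !)) (sgn e) (C (suc (suc e)) j)))
               (cong (λ s → + (suc e !) * (s * C (suc (suc e)) j)) (sym (ℤP.neg-involutive (sgn e)))))) i ⟩
      shift e ((+ (suc e !)) ·ˢ T (suc (suc e))) i ≡⟨ Linear.lin-· L (+ (suc e !)) (T (suc (suc e))) i ⟩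
      + (suc e !) * shift e (T (suc (suc e))) i ∎
  -- As 2(k+1) + e = 2k + (e+2), this series is `R k (suc (suc e))`. The remainder for k expresses a
  -- multiple of it by `U k` and earlier generators, and saturation allows the division.
  lower-R (suc k) e = divd (pivot k (suc (suc e))) (pivot≢0 k (suc (suc e)))
    (resp eq (add (DSp-mono (ℕP.n≤1+n k) (ℕP.≤-reflexive (ℕP.+-suc k (suc e))) (remainder k (suc (suc e))))
                  (gen (dg (gu ℕP.≤-refl)))))
    where
    alg : ∀ a b → (a - b) + b ≡ a
    alg = solve-∀
    eq : (pivot k (suc (suc e)) ·ˢ R k (suc (suc e)) -ˢ D (U k)) +ˢ D (U k)
           ≈ˢ pivot k (suc (suc e)) ·ˢ shift (dbl (suc k) ℕ.+ e) (T (suc (suc e)))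
    eq i = trans (alg (pivot k (suc (suc e)) * R k (suc (suc e)) i) (D (U k) i))
      (cong (λ n → pivot k (suc (suc e)) * shift n (T (suc (suc e))) i)
        (trans (ℕP.+-suc (dbl k) (suc e)) (cong suc (ℕP.+-suc (dbl k) e))))

-- Evaluating the determinant by removing one power of u at a time.

module Evaluation where

  open Exterior
  open Walks
  open Elimination
  open Remainders
  open import Defs using (prod1)
  open import Data.Nat as ℕ using (ℕ; zero; suc; _!)
  open import Data.Bool using (Bool; true; false)
  open import Data.Integer as ℤ using (ℤ; +_; _+_; _-_; _*_; -_)
  open import Data.Integer.Tactic.RingSolver using (solve-∀)
  open import Data.Vec using (Vec; []; _∷_; replicate; _∷ʳ_)
  open ≡-Reasoning

  ones : ∀ n → Vec Bool n
  ones n = replicate n true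

  -- A series of order N meets only the last of N + 1 sites, and its particle has to pass the N
  -- others, which gives the sign.
  wedge-shift-top : ∀ N v (x : Fock (suc N)) →
    wedge (shift N v) x (ones (suc N)) ≡ sgn N * (v 0 * x (ones N ∷ʳ false))
  wedge-shift-top zero v x = alg (v 0) (x (false ∷ []))
    where
    alg : ∀ a b → a * b - + 0 ≡ + 1 * (a * b)
    alg = solve-∀
  wedge-shift-top (suc N) v x = begin
    + 0 * x (false ∷ ones (suc N)) - wedge (shift N v) (x ∘ (true ∷_)) (ones (suc N))
      ≡⟨ cong (λ t → + 0 * x (false ∷ ones (suc N)) - t) (wedge-shift-top N v (x ∘ (true ∷_))) ⟩
    + 0 * x (false ∷ ones (suc N)) - sgn N * (v 0 * x (ones (suc N) ∷ʳ false))
      ≡⟨ alg (sgn N) (v 0 * x (ones (suc N) ∷ʳ false)) (x (false ∷ ones (suc N))) ⟩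
    - sgn N * (v 0 * x (ones (suc N) ∷ʳ false)) ∎
    where
    alg : ∀ a b c → + 0 * c - a * b ≡ - a * b
    alg = solve-∀

  wedge-trunc : ∀ {n} v (x : Fock (suc n)) S →
    wedge v x (S ∷ʳ false) ≡ wedge v (λ (S : Vec Bool n) → x (S ∷ʳ false)) S
  wedge-trunc v x []          = refl
  wedge-trunc v x (false ∷ S) = wedge-trunc (v ∘ suc) (x ∘ (false ∷_)) S
  wedge-trunc v x (true ∷ S)  = cong (λ t → v 0 * x (false ∷ (S ∷ʳ false)) - t) (wedge-trunc (v ∘ suc) (x ∘
      (true ∷_)) S)

  ω-trunc : ∀ {n} vs (S : Vec Bool n) → ω vs (S ∷ʳ false) ≡ ω vs S
  ω-trunc [] []          = refl
  ω-trunc [] (false ∷ S) = ω-trunc [] S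
  ω-trunc [] (true ∷ S)  = refl
  ω-trunc (v ∷ vs) S     = trans (wedge-trunc v (ω vs) S) (wedge-congʳ v (ω-trunc vs) S)

  weight : ∀ {n} → (ℕ → ℤ) → Vec Bool n → ℤ
  weight f []          = + 1
  weight f (false ∷ S) = weight (f ∘ suc) S
  weight f (true ∷ S)  = f 0 * weight (f ∘ suc) S

  wedge-diag : ∀ {n} f v (x : Fock n) S →
    wedge (diag f v) (λ S → weight f S * x S) S ≡ weight f S * wedge v x S
  wedge-diag f v x []          = refl
  wedge-diag f v x (false ∷ S) = wedge-diag (f ∘ suc) (v ∘ suc) (x ∘ (false ∷_)) S
  wedge-diag f v x (true ∷ S)  = begin
    f 0 * v 0 * (w * x (false ∷ S)) - wedge (diag f v ∘ suc) (λ S → f 0 * weight (f ∘ suc) S * x (true ∷ S)) S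
      ≡⟨ cong (λ t → f 0 * v 0 * (w * x (false ∷ S)) - t)
          (trans (wedge-congʳ (diag f v ∘ suc) (λ T → ℤP.*-assoc (f 0) (weight (f ∘ suc) T) (x (true ∷ T))) S)
          (trans (wedge-· (f 0) (diag f v ∘ suc) _ S)
                 (cong (f 0 *_) (wedge-diag (f ∘ suc) (v ∘ suc) (x ∘ (true ∷_)) S)))) ⟩
    f 0 * v 0 * (w * x (false ∷ S)) - f 0 * (w * wedge (v ∘ suc) (x ∘ (true ∷_)) S)
      ≡⟨ alg (f 0) (v 0) w (x (false ∷ S)) (wedge (v ∘ suc) (x ∘ (true ∷_)) S) ⟩
    f 0 * w * (v 0 * x (false ∷ S) - wedge (v ∘ suc) (x ∘ (true ∷_)) S) ∎
    where
    w = weight (f ∘ suc) S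
    alg : ∀ f v w x y → f * v * (w * x) - f * (w * y) ≡ f * w * (v * x - y)
    alg = solve-∀

  ω-diag : ∀ {n} f vs (S : Vec Bool n) → ω (map (diag f) vs) S ≡ weight f S * ω vs S
  ω-diag f [] []          = refl
  ω-diag f [] (false ∷ S) = ω-diag (f ∘ suc) [] S
  ω-diag f [] (true ∷ S)  = sym (ℤP.*-zeroʳ (weight f (true ∷ S)))
  ω-diag f (v ∷ vs) S     = trans (wedge-congʳ (diag f v) (ω-diag f vs) S) (wedge-diag f v (ω vs) S)

  facts : ℕ → ℤ
  facts n = weight fact (ones n)

  weight-snoc : ∀ f n → weight f (ones (suc n)) ≡ weight f (ones n) * f n
  weight-snoc f zero    = trans (ℤP.*-identityʳ (f 0)) (sym (ℤP.*-identityˡ (f 0)))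
  weight-snoc f (suc n) = trans (cong (f 0 *_) (weight-snoc (f ∘ suc) n)) (sym (ℤP.*-assoc (f 0) _ _))

  -- On a full set of sites no particle can move, so each step keeps the top coefficient. This is
  -- the determinant for k = 0.
  top-hs : ∀ m → top {m} (ω (hs m)) ≡ + 1
  top-hs zero    = refl
  top-hs (suc m) = trans (sym (step-ω m (ones (suc m)))) (trans (move-top (suc m) (insert (ω (hs m)))) (top-hs m))
    where
    move-top : ∀ n (x : Fock n) → move x (ones n) ≡ x (ones n)
    move-top zero    x = refl
    move-top (suc n) x = move-top n (x ∘ (true ∷_))

  K : ℕ → ℕ → ℤ
  K k m = top {k ℕ.+ m} (ω (ws k m))

  KD : ℕ → ℕ → ℤ
  KD k m = top {k ℕ.+ m} (ω (map D (ws k m)))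

  KD-K : ∀ k m → KD k m ≡ facts (k ℕ.+ m) * K k m
  KD-K k m = ω-diag fact (ws k m) (ones (k ℕ.+ m))

  -- Modulo the factors present, `D (U k)` may be replaced by a multiple of `R k e`, whose order is
  -- exactly the number n of these factors. It fills the last site and leaves the smaller
  -- determinant; the signs (-1)^n and (-1)^e cancel because n = 2k + e.
  KD-suc : ∀ k e → let m = k ℕ.+ e in KD (suc k) m ≡ pivot k e * KD k m
  KD-suc k e = begin
    wedge (D (U k)) x S              ≡⟨ split ⟩
    pivot k e * wedge (R k e) x S    ≡⟨ cong (pivot k e *_) lead ⟩
    pivot k e * KD k m ∎
    where
    m = k ℕ.+ e
    n = k ℕ.+ m
    S = ones (suc n)
    x : ∀ {n} → Fock n
    x = ω (map D (ws k m))
    rest = pivot k e ·ˢ R k e -ˢ D (U k)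
    kills : ∀ {v} → DG k m v → ∀ S → wedge v (x {suc n}) S ≡ + 0
    kills (dg g) = wedge-∈ (∈-map⁺ D (G⇒∈ g))
    alg : ∀ a b → a ≡ b + (- + 1 * (b - a))
    alg = solve-∀
    split : wedge (D (U k)) x S ≡ pivot k e * wedge (R k e) x S
    split = begin
      wedge (D (U k)) x S
        ≡⟨ wedge-cong {w = pivot k e ·ˢ R k e +ˢ - + 1 ·ˢ rest} {x = x} {y = x} (λ i →
            alg (D (U k) i) (pivot k e * R k e i)) (λ _ → refl) S ⟩
      wedge (pivot k e ·ˢ R k e +ˢ - + 1 ·ˢ rest) x S ≡⟨ wedge-linˢ (pivot k e) (R k e) (- + 1 ·ˢ rest) x S ⟩
      pivot k e * wedge (R k e) x S + wedge (- + 1 ·ˢ rest) x S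
        ≡⟨ cong (λ t → pivot k e * wedge (R k e) x S + t)
             (wedge-Span x kills (scl (- + 1) (remainder k e)) S) ⟩
      pivot k e * wedge (R k e) x S + + 0 ≡⟨ ℤP.+-identityʳ _ ⟩
      pivot k e * wedge (R k e) x S ∎
    dbl≡ : ∀ k → dbl k ≡ k ℕ.+ k
    dbl≡ zero    = refl
    dbl≡ (suc k) = cong suc (trans (cong suc (dbl≡ k)) (sym (ℕP.+-suc k k)))
    n≡ : dbl k ℕ.+ e ≡ n
    n≡ = trans (cong (ℕ._+ e) (dbl≡ k)) (ℕP.+-assoc k k e)
    sgn-+ : ∀ a b → sgn (a ℕ.+ b) ≡ sgn a * sgn b
    sgn-+ zero    b = sym (ℤP.*-identityˡ (sgn b))
    sgn-+ (suc a) b = trans (cong -_ (sgn-+ a b)) (ℤP.neg-distribˡ-* (sgn a) (sgn b))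
    sgn-n : sgn n * sgn e ≡ + 1
    sgn-n = begin
      sgn n * sgn e               ≡⟨ cong (λ t → sgn t * sgn e) (sym (ℕP.+-assoc k k e)) ⟩
      sgn (k ℕ.+ k ℕ.+ e) * sgn e ≡⟨ cong (_* sgn e) (trans (sgn-+ (k ℕ.+ k) e) (cong (_* sgn e) (trans
          (sgn-+ k k) (sgn-sq k)))) ⟩
      + 1 * sgn e * sgn e         ≡⟨ cong (_* sgn e) (ℤP.*-identityˡ (sgn e)) ⟩
      sgn e * sgn e               ≡⟨ sgn-sq e ⟩
      + 1 ∎
    alg₁ : ∀ s t y → s * (t * + 1 * y) ≡ (s * t) * y
    alg₁ = solve-∀
    lead : wedge (R k e) x S ≡ KD k m
    lead = begin
      wedge (shift (dbl k ℕ.+ e) (T e)) x S   ≡⟨ cong (λ N → wedge (shift N (T e)) x S) n≡ ⟩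
      wedge (shift n (T e)) x S               ≡⟨ wedge-shift-top n (T e) x ⟩
      sgn n * (sgn e * + 1 * x (ones n ∷ʳ false)) ≡⟨ alg₁ (sgn n) (sgn e) (x (ones n ∷ʳ false)) ⟩
      sgn n * sgn e * x (ones n ∷ʳ false)     ≡⟨ cong₂ _*_ sgn-n (ω-trunc (map D (ws k m)) (ones n)) ⟩
      + 1 * KD k m                            ≡⟨ ℤP.*-identityˡ (KD k m) ⟩
      KD k m ∎

  -- The k steps of `KD-suc` lead down to `facts m`. The scaling of k + m sites exceeds `facts m` by
  -- (m+1)! ... (m+k)!, which is the product on the left; `facts m` is then cancelled.
  count-formula : ∀ k m → k ℕ.≤ m →
    pair {k ℕ.+ m} {k ℕ.+ m} (ω (hs k)) (ω (hs m)) * + prod1 k (λ j → (m ℕ.+ j) !)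
      ≡ + prod1 k (λ j → dbl j ! ℕ.* μ (suc m ℕ.∸ j))
  count-formula k m k≤m = begin
    pair {k ℕ.+ m} {k ℕ.+ m} (ω (hs k)) (ω (hs m)) * + prod1 k (λ j → (m ℕ.+ j) !)
      ≡⟨ cong (_* + prod1 k (λ j → (m ℕ.+ j) !)) (trans (pair-ω h k (ω (hs m))) (wedges-ω k m k≤m (ones (k ℕ.+ m)))) ⟩
    csts k * K k m * + prod1 k (λ j → (m ℕ.+ j) !)
      ≡⟨ go k k≤m ⟩
    + prod1 k (λ j → dbl j ! ℕ.* μ (suc m ℕ.∸ j)) ∎
    where
    facts-+ : ∀ k → facts (k ℕ.+ m) ≡ facts m * + prod1 k (λ j → (m ℕ.+ j) !)
    facts-+ zero    = sym (ℤP.*-identityʳ (facts m))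
    facts-+ (suc k) = begin
      facts (suc (k ℕ.+ m))              ≡⟨ weight-snoc fact (k ℕ.+ m) ⟩
      facts (k ℕ.+ m) * fact (k ℕ.+ m)   ≡⟨ cong₂ _*_ (facts-+ k) (cong (λ t →
          + (t !)) (trans (cong suc (ℕP.+-comm k m)) (sym (ℕP.+-suc m k)))) ⟩
      facts m * + P * + ((m ℕ.+ suc k) !) ≡⟨ ℤP.*-assoc (facts m) (+ P) _ ⟩
      facts m * (+ P * + ((m ℕ.+ suc k) !)) ≡⟨ cong (facts m *_) (sym (ℤP.pos-* P _)) ⟩
      facts m * + (P ℕ.* (m ℕ.+ suc k) !) ∎
      where P = prod1 k (λ j → (m ℕ.+ j) !)
    facts-nz : ∀ n → ℤ.NonZero (facts n)
    facts-nz n = ℤ.≢-nonZero (nz fact (λ i eq → ℕP.<⇒≢ (ℕP.1≤n! (suc i)) (sym (ℤP.+-injective eq))) n)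
      where
      open import Data.Sum using (inj₁; inj₂)
      nz : ∀ f → (∀ i → f i ≢ + 0) → ∀ n → weight f (ones n) ≢ + 0
      nz f f≢0 (suc n) eq with ℤP.i*j≡0⇒i≡0∨j≡0 (f 0) eq
      ... | inj₁ p = f≢0 0 p
      ... | inj₂ p = nz (f ∘ suc) (f≢0 ∘ suc) n p
    cst-! : ∀ k → + (dbl (suc k) !) ≡ cst k * + (suc (dbl k) !)
    cst-! k = trans (ℤP.pos-* (suc (suc (dbl k))) (suc (dbl k) !)) (cong (_* + (suc (dbl k) !)) (pos-dbl (suc k)))
    scaled : ∀ k → k ℕ.≤ m → csts k * KD k m ≡ + prod1 k (λ j → dbl j ! ℕ.* μ (suc m ℕ.∸ j)) * facts m
    scaled zero    _   = trans (cong (+ 1 *_) (trans (KD-K 0 m) (trans (cong (facts m *_) (top-hs m))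
        (ℤP.*-identityʳ (facts m))))) refl
    scaled (suc k) k<m = begin
      csts k * cst k * KD (suc k) m
        ≡⟨ cong (csts k * cst k *_) (subst (λ m′ → KD (suc k) m′ ≡ pivot k (m ℕ.∸ k) * KD k m′) (ℕP.m+[n∸m]≡n
            (ℕP.<⇒≤ k<m)) (KD-suc k (m ℕ.∸ k))) ⟩
      csts k * cst k * (pivot k (m ℕ.∸ k) * KD k m)
        ≡⟨ cong (λ t → csts k * cst k * (t * KD k m)) (ℤP.pos-* (suc (dbl k) !) (μ (m ℕ.∸ k))) ⟩
      csts k * cst k * (+ (suc (dbl k) !) * + μ (m ℕ.∸ k) * KD k m)
        ≡⟨ alg (csts k) (cst k) (+ (suc (dbl k) !)) (+ μ (m ℕ.∸ k)) (KD k m) ⟩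
      csts k * KD k m * (cst k * + (suc (dbl k) !) * + μ (m ℕ.∸ k))
        ≡⟨ cong₂ (λ s t → s * (t * + μ (m ℕ.∸ k))) (scaled k (ℕP.<⇒≤ k<m)) (sym (cst-! k)) ⟩
      + P * facts m * (+ (dbl (suc k) !) * + μ (m ℕ.∸ k))
        ≡⟨ cong (+ P * facts m *_) (sym (ℤP.pos-* (dbl (suc k) !) (μ (m ℕ.∸ k)))) ⟩
      + P * facts m * + (dbl (suc k) ! ℕ.* μ (m ℕ.∸ k))
        ≡⟨ alg₁ (+ P) (facts m) (+ (dbl (suc k) ! ℕ.* μ (m ℕ.∸ k))) ⟩
      + P * + (dbl (suc k) ! ℕ.* μ (m ℕ.∸ k)) * facts m
        ≡⟨ cong (_* facts m) (sym (ℤP.pos-* P _)) ⟩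
      + (P ℕ.* (dbl (suc k) ! ℕ.* μ (m ℕ.∸ k))) * facts m ∎
      where
      P = prod1 k (λ j → dbl j ! ℕ.* μ (suc m ℕ.∸ j))
      alg : ∀ a b f g d → a * b * (f * g * d) ≡ a * d * (b * f * g)
      alg = solve-∀
      alg₁ : ∀ a b c → a * b * c ≡ a * c * b
      alg₁ = solve-∀
    go : ∀ k → k ℕ.≤ m → csts k * K k m * + prod1 k (λ j → (m ℕ.+ j) !) ≡ + prod1 k (λ j →
        dbl j ! ℕ.* μ (suc m ℕ.∸ j))
    go k k≤m = ℤP.*-cancelʳ-≡ _ _ (facts m) {{facts-nz m}} (begin
      csts k * K k m * + P * facts m  ≡⟨ alg (csts k) (K k m) (+ P) (facts m) ⟩
      csts k * (facts m * + P * K k m) ≡⟨ cong (λ t → csts k * (t * K k m)) (sym (facts-+ k)) ⟩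
      csts k * (facts (k ℕ.+ m) * K k m) ≡⟨ cong (csts k *_) (sym (KD-K k m)) ⟩
      csts k * KD k m                  ≡⟨ scaled k k≤m ⟩
      + prod1 k (λ j → dbl j ! ℕ.* μ (suc m ℕ.∸ j)) * facts m ∎)
      where
      P = prod1 k (λ j → (m ℕ.+ j) !)
      alg : ∀ c k p f → c * k * p * f ≡ c * (f * p * k)
      alg = solve-∀

-- Choice tables for the two halves, their number, and their local description.

module Configurations where

  open Exterior
  open Walks
  open import Data.Nat using (ℕ; zero; suc; _+_; _<_; s≤s; z≤n)
  open import Data.Bool using (Bool; true; false; not; _∧_; T; T?; if_then_else_)
  open import Data.Integer as ℤ using (ℤ; +_)
  open import Data.Unit using (⊤; tt)
  open import Data.Vec using (Vec; []; _∷_; replicate)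
  open ≡-Reasoning

  -- The three tiles that may contain a given pair of cells.
  data Ch : Set where
    out in0 in1 : Ch

  -- rows T c lists the possible choices for a row of pairs, each with the set of sites then taken:
  -- a pair p with entry true goes inwards, to site p (in0) or p + 1 (in1), the others go outwards;
  -- c says whether site 0 is already taken.
  rows : ∀ {n} → Vec Bool n → Bool → List (Vec Ch n × Vec Bool n)
  put : ∀ {n} → Ch → Bool → Vec Ch n × Vec Bool n → Vec Ch (suc n) × Vec Bool (suc n)
  put c b (cs , S) = c ∷ cs , b ∷ S
  rows []          false = ([] , []) ∷ []
  rows []          true  = []
  rows (false ∷ T) c     = map (put out c) (rows T false)
  rows (true ∷ T)  false = map (put in0 true) (rows T false) ++ map (put in1 false) (rows T true)
  rows (true ∷ T)  true  = map (put in1 true) (rows T true)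

  -- Level q has q + 1 + B pairs, one more than row 3q has cells; the innermost level is stored
  -- last.
  Config : ℕ → ℕ → Set
  Config zero    B = ⊤
  Config (suc L) B = Config L B × Vec Ch (suc (L + B))

  Item : ℕ → ℕ → Set
  Item L B = Config L B × Vec Bool (L + B)

  attach : ∀ {L B} → Config L B → Vec Ch (suc (L + B)) × Vec Bool (suc (L + B)) →
    Item (suc L) B
  attach c (r , S) = (c , r) , S

  extend : ∀ {L B} → Item L B → List (Item (suc L) B)
  extend (c , S) = map (attach c) (rows (true ∷ S) false)

  half : ∀ L B → List (Item L B)
  half zero    B = (tt , replicate B false) ∷ []
  half (suc L) B = concatMap extend (half L B)

  compl : ∀ {a b} → Vec Bool a → Vec Bool b → Bool
  compl []          []          = true
  compl []          (_ ∷ _)     = false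
  compl (_ ∷ _)     []          = false
  compl (true ∷ S)  (true ∷ T)  = false
  compl (true ∷ S)  (false ∷ T) = compl S T
  compl (false ∷ S) (true ∷ T)  = compl S T
  compl (false ∷ S) (false ∷ T) = false

  Full : ℕ → ℕ → Set
  Full k m = Item k m × Item m k

  partners : ∀ {k m} → Item k m → List (Full k m)
  partners {k} {m} x = map (x ,_) (filter (λ y → T? (compl (proj₂ x) (proj₂ y))) (half m k))

  configs : ∀ k m → List (Full k m)
  configs k m = concatMap partners (half k m)

  δ : ∀ {n} → Vec Bool n → Fock n
  δ []          []          = + 1
  δ (true ∷ T)  (true ∷ S)  = δ T S
  δ (true ∷ T)  (false ∷ S) = + 0
  δ (false ∷ T) (true ∷ S)  = + 0
  δ (false ∷ T) (false ∷ S) = δ T S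

  cnt : ∀ {X : Set} {n} → List (X × Vec Bool n) → Fock n
  cnt []       S = + 0
  cnt (x ∷ xs) S = δ (proj₂ x) S ℤ.+ cnt xs S

  cnt-++ : ∀ {X : Set} {n} (xs ys : List (X × Vec Bool n)) S → cnt (xs ++ ys) S ≡ cnt xs S ℤ.+ cnt ys S
  cnt-++ []       ys S = sym (ℤP.+-identityˡ _)
  cnt-++ (x ∷ xs) ys S = trans (cong (λ t → δ (proj₂ x) S ℤ.+ t) (cnt-++ xs ys S)) (sym (ℤP.+-assoc (δ
      (proj₂ x) S) _ _))

  cnt-map : ∀ {X Y : Set} {n} (f : X × Vec Bool n → Y × Vec Bool n) → (∀ x → proj₂ (f x) ≡ proj₂ x) →
    ∀ xs S → cnt (map f xs) S ≡ cnt xs S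
  cnt-map f e []       S = refl
  cnt-map f e (x ∷ xs) S = cong₂ ℤ._+_ (cong (λ t → δ t S) (e x)) (cnt-map f e xs S)

  cnt-put-true : ∀ {n} c xs (S : Vec Bool n) → cnt (map (put c true) xs) (true ∷ S) ≡ cnt xs S
  cnt-put-true c []       S = refl
  cnt-put-true c (x ∷ xs) S = cong (λ t → δ (proj₂ x) S ℤ.+ t) (cnt-put-true c xs S)

  cnt-put-false : ∀ {n} c xs (S : Vec Bool n) → cnt (map (put c false) xs) (false ∷ S) ≡ cnt xs S
  cnt-put-false c []       S = refl
  cnt-put-false c (x ∷ xs) S = cong (λ t → δ (proj₂ x) S ℤ.+ t) (cnt-put-false c xs S)

  cnt-put-tf : ∀ {n} c xs (S : Vec Bool n) → cnt (map (put c true) xs) (false ∷ S) ≡ + 0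
  cnt-put-tf c []       S = refl
  cnt-put-tf c (x ∷ xs) S = trans (ℤP.+-identityˡ _) (cnt-put-tf c xs S)

  cnt-put-ft : ∀ {n} c xs (S : Vec Bool n) → cnt (map (put c false) xs) (true ∷ S) ≡ + 0
  cnt-put-ft c []       S = refl
  cnt-put-ft c (x ∷ xs) S = trans (ℤP.+-identityˡ _) (cnt-put-ft c xs S)

  -- The flag of `rows` is the particle in transit that separates `move⁺` from `move`, so both
  -- distinguish the same cases at each site.
  cnt-rows  : ∀ {n} (T : Vec Bool n) S → cnt (rows T false) S ≡ move (δ T) S
  cnt-rows⁺ : ∀ {n} (T : Vec Bool n) S → cnt (rows T true) S ≡ move⁺ (δ T) S
  cnt-rows []          []          = refl
  cnt-rows (false ∷ T) (false ∷ S) = trans (cnt-put-false out (rows T false) S)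
    (trans (cnt-rows T S) (trans (sym (ℤP.+-identityʳ _)) (cong (λ t → move (δ T) S ℤ.+ t) (sym (move⁺-zero S)))))
  cnt-rows (false ∷ T) (true ∷ S)  = trans (cnt-put-ft out (rows T false) S) (sym (move-zero S))
  cnt-rows (true ∷ T)  (false ∷ S) = trans (cnt-++ (map (put in0 true) (rows T false)) _ (false ∷ S))
    (cong₂ ℤ._+_ (trans (cnt-put-tf in0 (rows T false) S) (sym (move-zero S)))
                 (trans (cnt-put-false in1 (rows T true) S) (cnt-rows⁺ T S)))
  cnt-rows (true ∷ T)  (true ∷ S)  = trans (cnt-++ (map (put in0 true) (rows T false)) _ (true ∷ S))
    (trans (cong₂ ℤ._+_ (trans (cnt-put-true in0 (rows T false) S) (cnt-rows T S)) (cnt-put-ft in1 (rows T true) S))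
      (ℤP.+-identityʳ _))
  cnt-rows⁺ []          []          = refl
  cnt-rows⁺ (false ∷ T) (false ∷ S) = cnt-put-tf out (rows T false) S
  cnt-rows⁺ (false ∷ T) (true ∷ S)  = trans (cnt-put-true out (rows T false) S)
    (trans (cnt-rows T S) (trans (sym (ℤP.+-identityʳ _)) (cong (λ t → move (δ T) S ℤ.+ t) (sym (move⁺-zero S)))))
  cnt-rows⁺ (true ∷ T)  (false ∷ S) = cnt-put-tf in1 (rows T true) S
  cnt-rows⁺ (true ∷ T)  (true ∷ S)  = trans (cnt-put-true in1 (rows T true) S)
    (trans (cnt-rows⁺ T S) (trans (sym (ℤP.+-identityˡ _)) (cong (λ t → t ℤ.+ move⁺ (δ T) S) (sym (move-zero S)))))

  move-+ : ∀ {n} (x y : Fock n) S → move (λ T → x T ℤ.+ y T) S ≡ move x S ℤ.+ move y S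
  move-+ x y S = trans (move-cong (λ T → sym (cong₂ ℤ._+_ (ℤP.*-identityˡ (x T)) (ℤP.*-identityˡ (y T)))) S)
    (trans (move-lin (+ 1) (+ 1) x y S) (cong₂ ℤ._+_ (ℤP.*-identityˡ (move x S)) (ℤP.*-identityˡ (move y S))))

  cnt-extend : ∀ {L B} (xs : List (Item L B)) S →
    cnt (concatMap extend xs) S ≡ move (insert (cnt xs)) S
  cnt-extend [] S = sym (trans (move-cong (λ { (false ∷ S) → refl ; (true ∷ S) → refl }) S) (move-zero S))
  cnt-extend (x ∷ xs) S = begin
    cnt (extend x ++ concatMap extend xs) S          ≡⟨ cnt-++ (extend x) (concatMap extend xs) S ⟩
    cnt (extend x) S ℤ.+ cnt (concatMap extend xs) S
      ≡⟨ cong₂ ℤ._+_ (trans (cnt-map (attach (proj₁ x)) (λ _ → refl) (rows (true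
          ∷ proj₂ x) false) S) (cnt-rows (true ∷ proj₂ x) S))
                     (cnt-extend xs S) ⟩
    move (δ (true ∷ proj₂ x)) S ℤ.+ move (insert (cnt xs)) S
      ≡⟨ move-+ (δ (true ∷ proj₂ x)) (insert (cnt xs)) S ⟨
    move (λ T → δ (true ∷ proj₂ x) T ℤ.+ insert (cnt xs) T) S
      ≡⟨ move-cong (λ { (false ∷ S) → refl ; (true ∷ S) → refl }) S ⟩
    move (insert (cnt (x ∷ xs))) S ∎

  cnt-half : ∀ L B → cnt (half L B) ≈ ω (hs L)
  cnt-half zero B S    = trans (ℤP.+-identityʳ _) (δ-vac S)
    where
    δ-vac : ∀ {n} (S : Vec Bool n) → δ (replicate n false) S ≡ vac S
    δ-vac []          = refl
    δ-vac (false ∷ S) = δ-vac S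
    δ-vac (true ∷ S)  = refl
  cnt-half (suc L) B S =
    trans (cnt-extend (half L B) S) (trans (move-cong (insert-cong (cnt-half L B)) S) (step-ω L S))

  pair-δ : ∀ {a b} (S : Vec Bool a) (T : Vec Bool b) → pair (δ S) (δ T) ≡ (if compl S T then + 1 else + 0)
  pair-δ-0ˡ : ∀ {a b} (y : Fock b) → pair {a} {b} (λ _ → + 0) y ≡ + 0
  pair-δ-0ˡ {zero}  {zero}  y = refl
  pair-δ-0ˡ {zero}  {suc b} y = refl
  pair-δ-0ˡ {suc a} {zero}  y = refl
  pair-δ-0ˡ {suc a} {suc b} y = cong₂ ℤ._+_ (pair-δ-0ˡ {a} {b} (y ∘ (true ∷_))) (pair-δ-0ˡ {a} {b} (y ∘ (false ∷_)))
  pair-δ-0ʳ : ∀ {a b} (x : Fock a) → pair {a} {b} x (λ _ → + 0) ≡ + 0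
  pair-δ-0ʳ {zero}  {zero}  x = ℤP.*-zeroʳ (x [])
  pair-δ-0ʳ {zero}  {suc b} x = refl
  pair-δ-0ʳ {suc a} {zero}  x = refl
  pair-δ-0ʳ {suc a} {suc b} x = cong₂ ℤ._+_ (pair-δ-0ʳ {a} {b} (x ∘ (false ∷_))) (pair-δ-0ʳ {a} {b} (x ∘ (true ∷_)))
  pair-δ []          []          = refl
  pair-δ []          (_ ∷ _)     = refl
  pair-δ (_ ∷ _)     []          = refl
  pair-δ {suc a} {suc b} (true ∷ S)  (true ∷ T)  = cong₂ ℤ._+_ (pair-δ-0ˡ {a} {b} (δ T)) (pair-δ-0ʳ {a} {b} (δ S))
  pair-δ {suc a} {suc b} (true ∷ S)  (false ∷ T) = trans (cong₂ ℤ._+_ (pair-δ-0ˡ {a} {b} (λ _ →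
      + 0)) (pair-δ S T)) (ℤP.+-identityˡ _)
  pair-δ {suc a} {suc b} (false ∷ S) (true ∷ T)  = trans (cong₂ ℤ._+_ (pair-δ S T) (pair-δ-0ˡ {a} {b} (λ _ →
      + 0))) (ℤP.+-identityʳ _)
  pair-δ {suc a} {suc b} (false ∷ S) (false ∷ T) = cong₂ ℤ._+_ (pair-δ-0ʳ {a} {b} (δ S)) (pair-δ-0ˡ {a} {b} (δ T))

  pair-+ˡ : ∀ {a b} (x x′ : Fock a) (y : Fock b) → pair (λ T → x T ℤ.+ x′ T) y ≡ pair x y ℤ.+ pair x′ y
  pair-+ˡ x x′ y = trans (pair-cong {y = y} (λ T → sym (cong₂ ℤ._+_ (ℤP.*-identityˡ (x T)) (ℤP.*-identityˡ
      (x′ T)))) (λ _ → refl))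
    (trans (pair-linˡ (+ 1) (+ 1) x x′ y) (cong₂ ℤ._+_ (ℤP.*-identityˡ (pair x y)) (ℤP.*-identityˡ (pair x′ y))))

  pair-+ʳ : ∀ {a b} (x : Fock a) (y y′ : Fock b) → pair x (λ T → y T ℤ.+ y′ T) ≡ pair x y ℤ.+ pair x y′
  pair-+ʳ x y y′ = trans (pair-cong {x = x} (λ _ → refl) (λ T →
      sym (cong₂ ℤ._+_ (ℤP.*-identityˡ (y T)) (ℤP.*-identityˡ (y′ T)))))
    (trans (pair-linʳ (+ 1) (+ 1) x y y′) (cong₂ ℤ._+_ (ℤP.*-identityˡ (pair x y)) (ℤP.*-identityˡ (pair x y′))))

  length-partners : ∀ {X : Set} {a b} (S : Vec Bool a) (ys : List (X × Vec Bool b)) →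
    + length (filter (λ y → T? (compl S (proj₂ y))) ys) ≡ pair (δ S) (cnt ys)
  length-partners {a = a} {b} S [] = sym (pair-δ-0ʳ {a} {b} (δ S))
  length-partners S (y ∷ ys) with compl S (proj₂ y) | pair-δ S (proj₂ y)
  ... | true  | e = trans (cong (λ t → + 1 ℤ.+ t) (length-partners S ys))
    (sym (trans (pair-+ʳ (δ S) (δ (proj₂ y)) (cnt ys)) (cong (λ t → t ℤ.+ pair (δ S) (cnt ys)) e)))
  ... | false | e = trans (length-partners S ys)
    (sym (trans (pair-+ʳ (δ S) (δ (proj₂ y)) (cnt ys)) (trans (cong (λ t →
        t ℤ.+ pair (δ S) (cnt ys)) e) (ℤP.+-identityˡ _))))

  length-configs : ∀ k m → + length (configs k m) ≡ pair {k + m} {k + m} (ω (hs k)) (ω (hs m))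
  length-configs k m = begin
    + length (configs k m)                           ≡⟨ go (half k m) ⟩
    pair (cnt (half k m)) (cnt (half m k))           ≡⟨ pair-cong (cnt-half k m) (cnt-half m k) ⟩
    pair {k + m} {m + k} (ω (hs k)) (ω (hs m))       ≡⟨ cong (λ n →
        pair {k + m} {n} (ω (hs k)) (ω (hs m))) (ℕP.+-comm m k) ⟩
    pair {k + m} {k + m} (ω (hs k)) (ω (hs m)) ∎
    where
    go : ∀ xs → + length (concatMap partners xs) ≡ pair (cnt xs) (cnt (half m k))
    go []       = sym (pair-δ-0ˡ {k + m} {m + k} (cnt (half m k)))
    go (x ∷ xs) = begin
      + length (partners x ++ concatMap partners xs) ≡⟨ cong +_ (LP.length-++ (partners x)) ⟩
      + (length (partners x) + length (concatMap partners xs)) ≡⟨ ℤP.pos-+ (length (partners x)) _ ⟩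
      + length (partners x) ℤ.+ + length (concatMap partners xs)
        ≡⟨ cong₂ ℤ._+_ (trans (cong +_ (LP.length-map (x ,_) (filter (λ y →
            T? (compl (proj₂ x) (proj₂ y))) (half m k))))
                              (length-partners (proj₂ x) (half m k))) (go xs) ⟩
      pair (δ (proj₂ x)) (cnt (half m k)) ℤ.+ pair (cnt xs) (cnt (half m k))
        ≡⟨ pair-+ˡ (δ (proj₂ x)) (cnt xs) (cnt (half m k)) ⟨
      pair (cnt (x ∷ xs)) (cnt (half m k)) ∎

  concatMap-AllPairs : ∀ {X Y : Set} {P : X → X → Set} {Q : Y → Y → Set} (f : X → List Y) →
    (∀ x → AllPairs Q (f x)) → (∀ {x y} → P x y → ∀ {u v} → u ∈ f x → v ∈ f y → Q u v) →
    ∀ {xs} → AllPairs P xs → AllPairs Q (concatMap f xs)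
  concatMap-AllPairs f inner between []                    = []
  concatMap-AllPairs f inner between (_∷_ {x} {xs} px pxs) =
    APP.++⁺ (inner x) (concatMap-AllPairs f inner between pxs)
      (All.tabulate λ u∈ → All.tabulate λ v∈ → go u∈ (find (∈-concatMap⁻ f {xs = xs} v∈)))
    where
    go : ∀ {u v} → u ∈ f x → (∃ λ y → y ∈ xs × v ∈ f y) → _
    go u∈ (y , y∈ , v∈) = between (All.lookup px y∈) u∈ v∈

  -- Only the choices are compared, since they determine the tiling; the occupied sites are carried
  -- along for gluing the halves.
  Distinct : ∀ {X Y : Set} → List (X × Y) → Set
  Distinct = AllPairs (λ x y → proj₁ x ≢ proj₁ y)

  put-distinct : ∀ {n} c b {xs : List (Vec Ch n × Vec Bool n)} → Distinct xs → Distinct (map (put c b) xs)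
  put-distinct c b d = APP.map⁺ (AllPairs.map (λ { x≢y refl → x≢y refl }) d)

  rows-distinct : ∀ {n} (T : Vec Bool n) c → Distinct (rows T c)
  rows-distinct []          false = [] ∷ []
  rows-distinct []          true  = []
  rows-distinct (false ∷ T) c     = put-distinct out c (rows-distinct T false)
  rows-distinct (true ∷ T)  true  = put-distinct in1 true (rows-distinct T true)
  rows-distinct (true ∷ T)  false =
    APP.++⁺ (put-distinct in0 true (rows-distinct T false)) (put-distinct in1 false (rows-distinct T true))
      (All.tabulate λ u∈ → All.tabulate λ v∈ → diff u∈ v∈)
    where
    diff : ∀ {u v} → u ∈ map (put in0 true) (rows T false) → v ∈ map (put in1 false) (rows T true) → proj₁ u ≢ proj₁ v
    diff u∈ v∈ with ∈-map⁻ (put in0 true) u∈ | ∈-map⁻ (put in1 false) v∈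
    ... | _ , _ , refl | _ , _ , refl = λ ()

  half-distinct : ∀ L B → Distinct (half L B)
  half-distinct zero    B = [] ∷ []
  half-distinct (suc L) B = concatMap-AllPairs extend
    (λ x → APP.map⁺ (AllPairs.map (λ { x≢y refl → x≢y refl }) (rows-distinct (true ∷ proj₂ x) false)))
    (λ {x} {y} → distinct {x} {y}) (half-distinct L B)
    where
    distinct : ∀ {x y : Item L B} → proj₁ x ≢ proj₁ y → ∀ {u v : Item (suc L) B} → u ∈ extend x →
        v ∈ extend y → proj₁ u ≢ proj₁ v
    distinct {x} {y} x≢y u∈ v∈ with ∈-map⁻ (attach {L} {B} (proj₁ x)) u∈ | ∈-map⁻ (attach {L} {B} (proj₁ y)) v∈
    ... | _ , _ , refl | _ , _ , refl = λ { refl → x≢y refl }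

  codes : ∀ {k m} → Full k m → Config k m × Config m k
  codes ((c , _) , (d , _)) = c , d

  configs-distinct : ∀ k m → AllPairs (λ x y → codes x ≢ codes y) (configs k m)
  configs-distinct k m = concatMap-AllPairs partners
    (λ x → APP.map⁺ (AllPairs.map (λ { x≢y refl → x≢y refl }) (APP.filter⁺ _ (half-distinct m k))))
    distinct (half-distinct k m)
    where
    distinct : ∀ {x y : Item k m} → proj₁ x ≢ proj₁ y → ∀ {u v : Full k m} → u ∈ partners x → v ∈ partners y →
        codes u ≢ codes v
    distinct {x} {y} x≢y u∈ v∈ with ∈-map⁻ (x ,_) u∈ | ∈-map⁻ (y ,_) v∈
    ... | _ , _ , refl | _ , _ , refl = λ { refl → x≢y refl }

  at : ∀ {X : Set} {n} → X → Vec X n → ℕ → X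
  at d []       _       = d
  at d (x ∷ xs) zero    = x
  at d (x ∷ xs) (suc i) = at d xs i

  tab : ∀ {X : Set} n → (ℕ → X) → Vec X n
  tab zero    f = []
  tab (suc n) f = f 0 ∷ tab n (f ∘ suc)

  at-tab : ∀ {X : Set} (d : X) n f {i} → i < n → at d (tab n f) i ≡ f i
  at-tab d (suc n) f {zero}  _       = refl
  at-tab d (suc n) f {suc i} (s≤s p) = at-tab d n (f ∘ suc) p

  tab-cong : ∀ {X : Set} n {f g : ℕ → X} → (∀ {i} → i < n → f i ≡ g i) → tab n f ≡ tab n g
  tab-cong zero    e = refl
  tab-cong (suc n) e = cong₂ _∷_ (e (s≤s z≤n)) (tab-cong n (e ∘ s≤s))

  tab-at : ∀ {X : Set} (d : X) {n} (v : Vec X n) → tab n (at d v) ≡ v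
  tab-at d []      = refl
  tab-at d (x ∷ v) = cong (x ∷_) (tab-at d v)

  isin1 : Ch → Bool
  isin1 in1 = true
  isin1 in0 = false
  isin1 out = false

  -- The indices say whether the left neighbour was sent to this site, whether the pair goes
  -- inwards, which choice it makes, and whether the site is taken afterwards. `stay` needs the site
  -- free; `leave` and `go` pass on what arrived from the left.
  data Transfer : Bool → Bool → Ch → Bool → Set where
    leave : ∀ {c} → Transfer c false out c
    stay  : Transfer false true in0 true
    go    : ∀ {c} → Transfer c true in1 c

  carry : Bool → (ℕ → Ch) → ℕ → Bool
  carry c f zero    = c
  carry c f (suc p) = isin1 (f p)

  -- The last equation says that nothing is carried to site n, beyond the end of the row.
  Scan : ℕ → Bool → (ℕ → Bool) → (ℕ → Ch) → (ℕ → Bool) → Set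
  Scan n c t f s = (∀ {p} → p < n → Transfer (carry c f p) (t p) (f p) (s p)) × carry c f n ≡ false

  Scan-tail : ∀ {n c t f s} → Scan (suc n) c t f s → Scan n (isin1 (f 0)) (t ∘ suc) (f ∘ suc) (s ∘ suc)
  Scan-tail {n} {c} {t} {f} {s} (cell , last) = cell′ , last′ n last
    where
    cell′ : ∀ {p} → p < n → Transfer (carry (isin1 (f 0)) (f ∘ suc) p) (t (suc p)) (f (suc p)) (s (suc p))
    cell′ {zero}  p<n = cell (s≤s p<n)
    cell′ {suc p} p<n = cell (s≤s p<n)
    last′ : ∀ n → carry c f (suc n) ≡ false → carry (isin1 (f 0)) (f ∘ suc) n ≡ false
    last′ zero    e = e
    last′ (suc n) e = e

  rows-complete : ∀ n {c t f s} → Scan n c t f s → (tab n f , tab n s) ∈ rows (tab n t) c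
  rows-complete zero (_ , refl) = here refl
  rows-complete (suc n) {c} {t} {f} {s} sc with t 0 | f 0 | s 0 | proj₁ sc (s≤s z≤n) | rows-complete n (Scan-tail sc)
  ... | .false | .out | .c | leave | ih = ∈-map⁺ (put out c) ih
  ... | .true  | .in0 | .true | stay | ih = ∈-++⁺ˡ (∈-map⁺ (put in0 true) ih)
  rows-complete (suc n) {false} sc | .true | .in1 | .false | go | ih =
    ∈-++⁺ʳ _ (∈-map⁺ (put in1 false) ih)
  rows-complete (suc n) {true} sc | .true | .in1 | .true | go | ih = ∈-map⁺ (put in1 true) ih

  Scan-cons : ∀ {n c b x y} {t : Vec Bool n} {f s} → Transfer c b x y →
    Scan n (isin1 x) (at false t) (at out f) (at false s) →
    Scan (suc n) c (at false (b ∷ t)) (at {n = suc n} out (x ∷ f)) (at {n = suc n} false (y ∷ s))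
  Scan-cons {n} {c} {b} {x} {y} {t} {f} {s} z (cell , last) = cell′ , last′ n last
    where
    cell′ : ∀ {p} → p < suc n → Transfer (carry c (at out (x ∷ f)) p) (at false (b ∷ t) p) (at out (x
        ∷ f) p) (at false (y ∷ s) p)
    cell′ {zero}        _         = z
    cell′ {suc zero}    (s≤s p<n) = cell p<n
    cell′ {suc (suc p)} (s≤s p<n) = cell p<n
    last′ : ∀ i → carry (isin1 x) (at out f) i ≡ false → carry c (at out (x ∷ f)) (suc i) ≡ false
    last′ zero    e = e
    last′ (suc i) e = e

  rows-sound : ∀ {n} (T : Vec Bool n) c {r S} → (r , S) ∈ rows T c → Scan n c (at false T) (at out r) (at false S)
  rows-sound []          false (here refl) = (λ ()) , refl
  rows-sound (false ∷ T) c     r∈ with ∈-map⁻ (put out c) r∈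
  ... | _ , r∈′ , refl = Scan-cons leave (rows-sound T false r∈′)
  rows-sound (true ∷ T)  true  r∈ with ∈-map⁻ (put in1 true) r∈
  ... | _ , r∈′ , refl = Scan-cons go (rows-sound T true r∈′)
  rows-sound (true ∷ T)  false r∈ with ∈-++⁻ (map (put in0 true) (rows T false)) r∈
  ... | inj₁ r∈ˡ with ∈-map⁻ (put in0 true) r∈ˡ
  ...   | _ , r∈′ , refl = Scan-cons stay (rows-sound T false r∈′)
  rows-sound (true ∷ T)  false r∈ | inj₂ r∈ʳ with ∈-map⁻ (put in1 false) r∈ʳ
  ...   | _ , r∈′ , refl = Scan-cons go (rows-sound T true r∈′)

  -- Pair p goes outwards exactly when site p - 1 was left free. Pair 0 has no such site and always
  -- goes inwards: it is the entering particle.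
  prev : (ℕ → Bool) → ℕ → Bool
  prev s zero    = true
  prev s (suc p) = s p

  record Half (L B : ℕ) (f : ℕ → ℕ → Ch) (s : ℕ → ℕ → Bool) : Set where
    field
      init : ∀ {j} → j < B → s 0 j ≡ false
      scan : ∀ {q} → q < L → Scan (suc (q + B)) false (prev (s q)) (f q) (s (suc q))

  tabC : ∀ L B → (ℕ → ℕ → Ch) → Config L B
  tabC zero    B f = tt
  tabC (suc L) B f = tabC L B f , tab (suc (L + B)) (f L)

  get : ∀ {L B} → Config L B → ℕ → ℕ → Ch
  get {zero}  c       q p = out
  get {suc L} (c , r) q p with q ℕP.≟ L
  ... | yes _ = at out r p
  ... | no  _ = get c q p

  get-tabC : ∀ L B f {q p} → q < L → p < suc (q + B) → get (tabC L B f) q p ≡ f q p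
  get-tabC (suc L) B f {q} {p} q<L p< with q ℕP.≟ L
  ... | yes refl = at-tab out (suc (L + B)) (f L) p<
  ... | no q≢L   = get-tabC L B f (ℕP.≤∧≢⇒< (ℕP.≤-pred q<L) q≢L) p<

  get-top : ∀ {L B} (c : Config (suc L) B) p → get c L p ≡ at out (proj₂ c) p
  get-top {L} c p with L ℕP.≟ L
  ... | yes _  = refl
  ... | no L≢L = ⊥-elim (L≢L refl)

  get-below : ∀ {L B} (c : Config (suc L) B) {q} p → q < L → get c q p ≡ get (proj₁ c) q p
  get-below {L} c {q} p q<L with q ℕP.≟ L
  ... | yes refl = ⊥-elim (ℕP.<-irrefl refl q<L)
  ... | no  _    = refl

  get-ext : ∀ {L B} (c d : Config L B) → (∀ {q p} → q < L → p < suc (q + B) → get c q p ≡ get d q p) → c ≡ d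
  get-ext {zero}  c d e = refl
  get-ext {suc L} {B} (c , r) (d , r′) e = cong₂ _,_
    (get-ext c d λ {q} {p} q<L p< →
      trans (sym (get-below (c , r) p q<L)) (trans (e (ℕP.m<n⇒m<1+n q<L) p<) (get-below (d , r′) p q<L)))
    (trans (sym (tab-at out r)) (trans (tab-cong (suc (L + B)) λ {p} p< →
      trans (sym (get-top (c , r) p)) (trans (e ℕP.≤-refl p<) (get-top (d , r′) p))) (tab-at out r′)))

  Scan-cong : ∀ {n c t t′ f f′ s s′} → (∀ p → t p ≡ t′ p) → (∀ p → f p ≡ f′ p) → (∀ p → s p ≡ s′ p) →
    Scan n c t f s → Scan n c t′ f′ s′
  Scan-cong {n} {c} {f = f} {f′} et ef es (cell , last) =
    (λ {p} p<n → cast (carry≡ p) (et p) (ef p) (es p) (cell p<n)) , trans (sym (carry≡ n)) last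
    where
    cast : ∀ {a a′ b b′ x x′ y y′} → a ≡ a′ → b ≡ b′ → x ≡ x′ → y ≡ y′ → Transfer a b x y → Transfer a′ b′ x′ y′
    cast refl refl refl refl z = z
    carry≡ : ∀ p → carry c f p ≡ carry c f′ p
    carry≡ zero    = refl
    carry≡ (suc p) = cong isin1 (ef p)

  half-complete : ∀ L B {f s} → Half L B f s → (tabC L B f , tab (L + B) (s L)) ∈ half L B
  half-complete zero B {f} {s} H = here (cong (tt ,_) (trans (tab-cong B (Half.init H)) (tab-const B)))
    where
    tab-const : ∀ n → tab n (λ _ → false) ≡ replicate n false
    tab-const zero    = refl
    tab-const (suc n) = cong (false ∷_) (tab-const n)
  half-complete (suc L) B {f} {s} H = ∈-concatMap⁺ extend (Any.map (λ { refl →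
      ∈-map⁺ (attach (tabC L B f)) row }) (half-complete L B lower))
    where
    row : (tab (suc (L + B)) (f L) , tab (suc (L + B)) (s (suc L))) ∈ rows (true ∷ tab (L + B) (s L)) false
    row = rows-complete (suc (L + B)) (Half.scan H ℕP.≤-refl)
    lower : Half L B f s
    lower = record { init = Half.init H ; scan = λ q<L → Half.scan H (ℕP.m<n⇒m<1+n q<L) }

  half-sound : ∀ L B {c S} → (c , S) ∈ half L B →
    Σ (ℕ → ℕ → Bool) λ s → Half L B (get c) s × (∀ j → s L j ≡ at false S j)
  half-sound zero B (here refl) = (λ _ → at false (replicate B false)) , record { init = init B ; scan = λ
      () } , λ _ → refl
    where
    init : ∀ n {j} → j < n → at false (replicate n false) j ≡ false
    init (suc n) {zero}  _       = refl
    init (suc n) {suc j} (s≤s p) = init n p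
  half-sound (suc L) B c∈ with find (∈-concatMap⁻ extend {xs = half L B} c∈)
  ... | (c , S) , cS∈ , ext with ∈-map⁻ (attach c) ext | half-sound L B cS∈
  ...   | (r , S′) , r∈ , refl | s , H , sL = s′ , record { init = init ; scan = scan } , s′-top
    where
    s′ : ℕ → ℕ → Bool
    s′ q j with q ℕP.≟ suc L
    ... | yes _ = at false S′ j
    ... | no  _ = s q j
    s′-top : ∀ j → s′ (suc L) j ≡ at false S′ j
    s′-top j with suc L ℕP.≟ suc L
    ... | yes _ = refl
    ... | no ¬p = ⊥-elim (¬p refl)
    s′-low : ∀ {q} j → q < suc L → s′ q j ≡ s q j
    s′-low {q} j q< with q ℕP.≟ suc L
    ... | yes refl = ⊥-elim (ℕP.<-irrefl refl q<)
    ... | no  _    = refl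
    init : ∀ {j} → j < B → s′ 0 j ≡ false
    init {j} j<B = trans (s′-low j (s≤s z≤n)) (Half.init H j<B)
    scan : ∀ {q} → q < suc L → Scan (suc (q + B)) false (prev (s′ q)) (get (c , r) q) (s′ (suc q))
    scan {q} q< with q ℕP.≟ L in eq
    ... | yes refl = Scan-cong (λ { zero → refl ; (suc p) → trans (sym (sL p)) (sym (s′-low p q<)) })
                       (λ _ → refl) (λ p → sym (s′-top p)) (rows-sound (true ∷ S) false r∈)
    ... | no q≢L   = Scan-cong (λ { zero → refl ; (suc p) → sym (s′-low p q<) })
                       (λ _ → refl) (λ p → sym (s′-low p (s≤s q<L))) (Half.scan H q<L)
      where
      q<L = ℕP.≤∧≢⇒< (ℕP.≤-pred q<) q≢L

  compl-tab : ∀ n {s t : ℕ → Bool} → (∀ {j} → j < n → s j ≡ not (t j)) → T (compl (tab n s) (tab n t))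
  compl-tab zero    e = tt
  compl-tab (suc n) {s} {t} e with s 0 | t 0 | e (s≤s z≤n)
  ... | true  | false | _ = compl-tab n (e ∘ s≤s)
  ... | false | true  | _ = compl-tab n (e ∘ s≤s)

  compl-at : ∀ {a b} (S : Vec Bool a) (S′ : Vec Bool b) → T (compl S S′) →
    ∀ {j} → j < a → at false S j ≡ not (at false S′ j)
  compl-at (true ∷ S)  (false ∷ S′) c {zero}  _       = refl
  compl-at (false ∷ S) (true ∷ S′)  c {zero}  _       = refl
  compl-at (true ∷ S)  (false ∷ S′) c {suc j} (s≤s p) = compl-at S S′ c p
  compl-at (false ∷ S) (true ∷ S′)  c {suc j} (s≤s p) = compl-at S S′ c p

  Glued : ∀ k m (f g : ℕ → ℕ → Ch) → Set
  Glued k m f g = Σ (ℕ → ℕ → Bool) λ s → Σ (ℕ → ℕ → Bool) λ t →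
    Half k m f s × Half m k g t × (∀ {j} → j < k + m → s k j ≡ not (t m j))

  configs-complete : ∀ k m {f g} → Glued k m f g →
    Σ (Full k m) λ x → x ∈ configs k m × codes x ≡ (tabC k m f , tabC m k g)
  configs-complete k m {f} {g} (s , t , H , H′ , e) = x ,
    ∈-concatMap⁺ partners (Any.map (λ { refl →
      ∈-map⁺ (_ ,_) (∈-filter⁺ (λ y → T? (compl (tab (k + m) (s k)) (proj₂ y)))
          (half-complete m k H′) compl′) }) (half-complete k m H)) ,
    refl
    where
    x = (tabC k m f , tab (k + m) (s k)) , (tabC m k g , tab (m + k) (t m))
    compl′ : T (compl (tab (k + m) (s k)) (tab (m + k) (t m)))
    compl′ = subst (λ n → T (compl (tab (k + m) (s k)) (tab n (t m)))) (ℕP.+-comm k m) (compl-tab (k + m) e)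

  configs-sound : ∀ k m {x} → x ∈ configs k m → Glued k m (get (proj₁ (codes x))) (get (proj₂ (codes x)))
  configs-sound k m x∈ with find (∈-concatMap⁻ partners {xs = half k m} x∈)
  ... | (c , S) , cS∈ , p with ∈-map⁻ ((c , S) ,_) p
  ...   | (d , S′) , q , refl with ∈-filter⁻ (λ y → T? (compl S (proj₂ y))) {xs = half m k} q
  ...     | dS∈ , ok with half-sound k m cS∈ | half-sound m k dS∈
  ...       | s , H , es | t , H′ , et =
    s , t , H , H′ , λ {j} j< → trans (es j) (trans (compl-at S S′ ok j<) (cong not (sym (et j))))

-- Tilings of one half: the forced pairs, and the converse construction.

module HalfBenzel where

  open Configurations using (Ch; out; in0; in1; isin1; carry; prev; Transfer; leave; stay; go; Half)
  open import Data.Nat using (ℕ; zero; suc; pred; _+_; _≤_; _<_; z≤n; s≤s; _<?_)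
  open import Data.Nat.Properties
  open import Data.Bool using (Bool; true; false; _∨_)

  -- Three literal successors per step let (in)equalities between multiples of three be settled by
  -- pattern matching.
  tri : ℕ → ℕ
  tri zero    = zero
  tri (suc n) = suc (suc (suc (tri n)))

  tri-+ : ∀ a b → tri (a + b) ≡ tri a + tri b
  tri-+ zero    b = refl
  tri-+ (suc a) b = cong (suc ∘ suc ∘ suc) (tri-+ a b)

  tri-mono : ∀ {a b} → a ≤ b → tri a ≤ tri b
  tri-mono z≤n     = z≤n
  tri-mono (s≤s p) = s≤s (s≤s (s≤s (tri-mono p)))

  tri-cancel : ∀ {a b} → tri a ≤ suc (suc (tri b)) → a ≤ b
  tri-cancel {zero}              p = z≤n
  tri-cancel {suc a} {zero}      (s≤s (s≤s ()))
  tri-cancel {suc a} {suc b}     (s≤s (s≤s (s≤s p))) = s≤s (tri-cancel p)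

  tri-inj : ∀ {a b} → tri a ≡ tri b → a ≡ b
  tri-inj {a} {b} e = ≤-antisym (tri-cancel (≤-trans (≤-reflexive e) (m≤n+m _ 2)))
    (tri-cancel (≤-trans (≤-reflexive (sym e)) (m≤n+m _ 2)))

  tri≢1 : ∀ a b → tri a ≢ suc (tri b)
  tri≢1 zero    b       ()
  tri≢1 (suc a) zero    ()
  tri≢1 (suc a) (suc b) e = tri≢1 a b (suc-injective (suc-injective (suc-injective e)))

  tri≢2 : ∀ a b → tri a ≢ suc (suc (tri b))
  tri≢2 zero    b       ()
  tri≢2 (suc a) zero    ()
  tri≢2 (suc a) (suc b) e = tri≢2 a b (suc-injective (suc-injective (suc-injective e)))

  div3 : ∀ L r → r < tri L → Σ ℕ λ q → q < L × (r ≡ tri q ⊎ r ≡ suc (tri q) ⊎ r ≡ suc (suc (tri q)))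
  div3 (suc L) zero                r<                = 0 , s≤s z≤n , inj₁ refl
  div3 (suc L) (suc zero)          r<                = 0 , s≤s z≤n , inj₂ (inj₁ refl)
  div3 (suc L) (suc (suc zero))    r<                = 0 , s≤s z≤n , inj₂ (inj₂ refl)
  div3 (suc L) (suc (suc (suc r))) (s≤s (s≤s (s≤s r<))) with div3 L r r<
  ... | q , q<L , inj₁ refl        = suc q , s≤s q<L , inj₁ refl
  ... | q , q<L , inj₂ (inj₁ refl) = suc q , s≤s q<L , inj₂ (inj₁ refl)
  ... | q , q<L , inj₂ (inj₂ refl) = suc q , s≤s q<L , inj₂ (inj₂ refl)

  in0≢out : in0 ≢ out
  in0≢out ()

  in1≢out : in1 ≢ out
  in1≢out ()

  false≢true : false ≢ true
  false≢true ()

  data Sh : Set where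
    RR UU DD : Sh

  -- A tile by its shape, the row of its outermost cell and the index of that cell.
  NT : Set
  NT = Sh × ℕ × ℕ

  data Off : Set where
    o0 o1 o2 : Off

  rowOf : Off → ℕ
  rowOf o0 = 0
  rowOf o1 = 1
  rowOf o2 = 2

  off : Sh → Off → ℕ
  off DD _  = 0
  off _  o0 = 0
  off _  o1 = 1
  off RR o2 = 1
  off UU o2 = 2

  record Cov (t : NT) (a b : ℕ) : Set where
    constructor cov
    field
      offset : Off
      row≡   : a ≡ rowOf offset + proj₁ (proj₂ t)
      index≡ : b ≡ off (proj₁ t) offset + proj₂ (proj₂ t)

  -- The cells of a benzel, seen from the half with L levels whose outermost row has B cells: row r
  -- consists of the cells with these indices y.
  record In (B L r y : ℕ) : Set where
    constructor mkIn
    field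
      lo  : r ≤ suc (tri y)
      hi  : suc (tri y) ≤ tri B + (r + r)
      lo′ : r + r ≤ suc (tri y) + tri L
      hi′ : suc (tri y) ≤ tri B + tri L + r
      top : r ≤ tri B + tri L

  -- Up to the central row 3L a row is bounded only by the two sides adjacent to the outermost one;
  -- the other bounds follow by adding r ≤ 3L.
  In-low : ∀ {B L r y} → r ≤ tri L → r ≤ suc (tri y) → suc (tri y) ≤ tri B + (r + r) → In B L r y
  In-low {B} {L} {r} {y} r≤ lo hi = mkIn lo hi (+-mono-≤ lo r≤)
    (≤-trans hi (≤-trans (+-monoʳ-≤ (tri B) (+-monoˡ-≤ r r≤)) (≤-reflexive (sym (+-assoc (tri B) (tri L) r)))))
    (≤-trans r≤ (m≤n+m (tri L) (tri B)))

  tri-B2q : ∀ B q → tri B + (tri q + tri q) ≡ tri (q + (q + B))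
  tri-B2q B q = trans (+-comm (tri B) _) (trans (+-assoc (tri q) (tri q) (tri B))
    (trans (cong (tri q +_) (sym (tri-+ q B))) (sym (tri-+ q (q + B)))))

  private
    s+s : ∀ x → suc x + suc x ≡ suc (suc (x + x))
    s+s x = cong suc (+-suc x x)

    shift1 : ∀ B x → tri B + (suc x + suc x) ≡ suc (suc (tri B + (x + x)))
    shift1 B x = trans (cong (tri B +_) (s+s x)) (trans (+-suc (tri B) _) (cong suc (+-suc (tri B) _)))

    split≤ : ∀ {q y} → q ≤ y → Σ ℕ λ j → y ≡ q + j
    split≤ {q} {y} p = y Data.Nat.∸ q , sym (m+[n∸m]≡n p)

  -- Rounding bounds in thirds: rows 3q, 3q+1 and 3q+2 start at index q, q and q+1 and have q+B,
  -- q+B+1 and q+B+1 cells. The surplus pair is the entering particle.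
  In-sg⁻ : ∀ {B L q y} → In B L (tri q) y → Σ ℕ λ j → y ≡ q + j × j < q + B
  In-sg⁻ {B} {L} {q} {y} i with split≤ (tri-cancel (m≤n⇒m≤1+n (In.lo i)))
  ... | j , refl = j , refl , +-cancelˡ-< q j (q + B) (≰⇒> λ le →
    <-irrefl refl (≤-trans (In.hi i) (≤-trans (≤-reflexive (tri-B2q B q)) (tri-mono le))))

  In-p1⁻ : ∀ {B L q y} → In B L (suc (tri q)) y → Σ ℕ λ p → y ≡ q + p × p < suc (q + B)
  In-p1⁻ {B} {L} {q} {y} i with split≤ (tri-cancel (≤-trans (≤-pred (In.lo i)) (m≤n+m (tri y) 2)))
  ... | p , refl = p , refl , s≤s (+-cancelˡ-≤ q p (q + B) (tri-cancel
    (≤-trans (≤-pred (≤-trans (In.hi i) (≤-reflexive (trans (shift1 B (tri q)) (cong (suc ∘ suc) (tri-B2q B q))))))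
      (n≤1+n _))))

  In-p2⁻ : ∀ {B L q y} → In B L (suc (suc (tri q))) y → Σ ℕ λ p → y ≡ suc (q + p) × p < suc (q + B)
  In-p2⁻ {B} {L} {q} {zero}  (mkIn (s≤s ()) _ _ _ _)
  In-p2⁻ {B} {L} {q} {suc y} i with split≤ {q} {y} (tri-cancel (≤-trans (≤-pred (≤-pred (In.lo i))) ≤-refl))
  ... | p , refl = p , refl , s≤s (+-cancelˡ-≤ q p (q + B) (tri-cancel
    (≤-trans (≤-pred (≤-pred (≤-pred (≤-pred (≤-trans (In.hi i)
       (≤-reflexive (trans (shift1 B (suc (tri q))) (cong (suc ∘ suc) (trans (shift1 B (tri q)) (cong
           (suc ∘ suc) (tri-B2q B q)))))))))))
      (m≤n+m _ 2))))

  In-sg : ∀ {B L q j} → q ≤ L → j < q + B → In B L (tri q) (q + j)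
  In-sg {B} {L} {q} {j} q≤L j< = In-low (tri-mono q≤L) (m≤n⇒m≤1+n (tri-mono (m≤m+n q j)))
    (≤-trans (s≤s (m≤n⇒m≤1+n (n≤1+n _))) (≤-trans (tri-mono (+-monoʳ-< q j<)) (≤-reflexive (sym (tri-B2q B q)))))

  In-p1 : ∀ {B L q p} → q < L → p < suc (q + B) → In B L (suc (tri q)) (q + p)
  In-p1 {B} {L} {q} {p} q<L (s≤s p≤) = In-low (≤-trans (s≤s (m≤n+m (tri q) 2)) (tri-mono q<L)) (s≤s (tri-mono
      (m≤m+n q p)))
    (≤-trans (s≤s (≤-trans (tri-mono (+-monoʳ-≤ q p≤)) (n≤1+n _)))
      (≤-reflexive (sym (trans (shift1 B (tri q)) (cong (suc ∘ suc) (tri-B2q B q))))))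

  In-p2 : ∀ {B L q p} → q < L → p < suc (q + B) → In B L (suc (suc (tri q))) (suc (q + p))
  In-p2 {B} {L} {q} {p} q<L (s≤s p≤) = In-low (≤-trans (n≤1+n _) (tri-mono q<L))
    (s≤s (s≤s (≤-trans (tri-mono (m≤m+n q p)) (m≤n+m _ 2))))
    (≤-trans (s≤s (s≤s (s≤s (s≤s (tri-mono (+-monoʳ-≤ q p≤))))))
      (≤-reflexive (sym (trans (shift1 B (suc (tri q))) (cong (suc ∘ suc) (trans (shift1 B (tri q)) (cong
          (suc ∘ suc) (tri-B2q B q))))))))

  -- The tile of pair (q , p), i.e. of the cells with index p in rows 3q+1 and 3q+2.
  -- For out this is meaningful only if p > 0.
  tl : ℕ → ℕ → Ch → NT
  tl q p in0 = RR , suc (tri q) , q + p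
  tl q p in1 = UU , suc (tri q) , q + p
  tl q p out = UU , tri q , pred (q + p)

  row-≥ : ∀ {t a b} → Cov t a b → proj₁ (proj₂ t) ≤ a
  row-≥ (cov o refl _) = m≤n+m _ (rowOf o)

  row-≤ : ∀ {t a b} → Cov t a b → a ≤ 2 + proj₁ (proj₂ t)
  row-≤ (cov o refl _) = +-monoˡ-≤ _ (rowOf≤ o)
    where
    rowOf≤ : ∀ o → rowOf o ≤ 2
    rowOf≤ o0 = z≤n
    rowOf≤ o1 = s≤s z≤n
    rowOf≤ o2 = ≤-refl

  row-gap : ∀ {t a b a′ b′} → Cov t a b → Cov t a′ b′ → a ≤ 2 + a′
  row-gap c c′ = ≤-trans (row-≤ c) (s≤s (s≤s (row-≥ c′)))

  rowOf-inj : ∀ {o o′} → rowOf o ≡ rowOf o′ → o ≡ o′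
  rowOf-inj {o0} {o0} _ = refl
  rowOf-inj {o1} {o1} _ = refl
  rowOf-inj {o2} {o2} _ = refl

  one-per-row : ∀ {t a b b′} → Cov t a b → Cov t a b′ → b ≡ b′
  one-per-row {_ , r , _} (cov o e refl) (cov o′ e′ refl)
    with rowOf-inj {o} {o′} (+-cancelʳ-≡ r (rowOf o) (rowOf o′) (trans (sym e) e′))
  ... | refl = refl

  isin0 : Ch → Bool
  isin0 in0 = true
  isin0 in1 = false
  isin0 out = false

  record IsNT (B L : ℕ) (P : NT → Set) : Set where
    field
      inside : ∀ {t a b} → P t → Cov t a b → In B L a b
      cover  : ∀ {a b} → In B L a b → Σ NT λ t → P t × Cov t a b
      uniq   : ∀ {t t′ a b} → P t → P t′ → Cov t a b → Cov t′ a b → t ≡ t′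

  module Forced {B L P} (τ : IsNT B L P) where
    open IsNT τ

    -- Induction on q, then on p: the mate of the leftmost cell of row 3q+1 can only be its right
    -- neighbour, since no cell of row 3q-1 is available and mates of smaller p are already used.
    mate : ∀ q p → q < L → p < suc (q + B) → ∀ {t} → P t → Cov t (suc (tri q)) (q + p) →
      Cov t (suc (suc (tri q))) (suc (q + p))

    -- By `mate`, a tile meeting row 3q+2 also meets row 3q+1, and a tile has only three rows.
    no-row-below : ∀ q {t a b} → q < L → P t → Cov t (suc (suc (tri q))) a → ¬ Cov t (suc (tri (suc q))) b
    no-row-below q q<L Pt c c′ with In-p2⁻ (inside Pt c)
    ... | p , refl , p< with cover (In-p1 q<L p<)
    ...   | t′ , Pt′ , d with uniq Pt Pt′ c (mate q p q<L p< Pt′ d)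
    ...     | refl = <-irrefl refl (row-gap c′ d)

    -- The left neighbour in row 3q+2 is already the mate of the preceding cell of row 3q+1, or for
    -- p = 0 lies outside the region.
    left-mate : ∀ q p → q < L → p < suc (q + B) → ∀ {t} → P t → Cov t (suc (tri q)) (q + p) →
      ¬ Cov t (suc (suc (tri q))) (q + p)
    left-mate q zero    q<L p< Pt c c′ with In-p2⁻ (inside Pt c′)
    ... | p′ , e , _ = <-irrefl e (s≤s (≤-trans (≤-reflexive (+-identityʳ q)) (m≤m+n q p′)))
    left-mate q (suc p) q<L (s≤s p<) {t} Pt c c′ with cover (In-p1 q<L (m<n⇒m<1+n p<))
    ... | t′ , Pt′ , d with uniq Pt Pt′ (subst (Cov t (suc (suc (tri q)))) (+-suc q p) c′) (mate q p q<L
        (m<n⇒m<1+n p<) Pt′ d)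
    ...   | refl = 1+n≢n (sym (+-cancelˡ-≡ q p (suc p) (one-per-row d c)))

    mate q p q<L p< {s , r , y} Pt (cov o0 refl e) with s
    ... | RR = cov o1 refl (cong suc e)
    ... | UU = cov o1 refl (cong suc e)
    ... | DD = ⊥-elim (left-mate q p q<L p< Pt (cov o0 refl e) (cov o1 refl e))
    mate q p q<L p< {s , r , y} Pt (cov o1 refl e) with s
    ... | RR = ⊥-elim (left-mate q p q<L p< Pt (cov o1 refl e) (cov o2 refl e))
    ... | UU = cov o2 refl (cong suc e)
    ... | DD = ⊥-elim (left-mate q p q<L p< Pt (cov o1 refl e) (cov o2 refl e))
    mate zero    p q<L p< Pt (cov o2 () e)
    mate (suc q) p q<L p< {s , r , y} Pt c@(cov o2 eq e) =
      ⊥-elim (no-row-below q (<-trans (n<1+n q) q<L) Pt (cov o0 (suc-injective (suc-injective eq)) (b0 s)) c)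
      where
      b0 : ∀ s → y ≡ off s o0 + y
      b0 RR = refl
      b0 UU = refl
      b0 DD = refl

    -- Once the pair is fixed, a tile is determined by its third cell. The shape `DD` is excluded,
    -- so the pairs of one half use right stones and a single kind of bone.
    classify : ∀ q p → q < L → p < suc (q + B) → ∀ {t} → P t → Cov t (suc (tri q)) (q + p) →
      Σ Ch λ c → t ≡ tl q p c
    classify q p q<L p< {s , r , y} Pt (cov o0 refl e) with s
    ... | RR = in0 , cong (λ y → RR , suc (tri q) , y) (sym e)
    ... | UU = in1 , cong (λ y → UU , suc (tri q) , y) (sym e)
    ... | DD = ⊥-elim (left-mate q p q<L p< Pt (cov o0 refl e) (cov o1 refl e))
    classify q p q<L p< {s , r , y} Pt (cov o1 refl e) with s
    ... | RR = ⊥-elim (left-mate q p q<L p< Pt (cov o1 refl e) (cov o2 refl e))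
    ... | UU = out , cong (λ y → UU , tri q , y) (sym (cong pred e))
    ... | DD = ⊥-elim (left-mate q p q<L p< Pt (cov o1 refl e) (cov o2 refl e))
    classify zero    p q<L p< Pt (cov o2 () e)
    classify (suc q) p q<L p< {s , r , y} Pt c@(cov o2 eq e) =
      ⊥-elim (no-row-below q (<-trans (n<1+n q) q<L) Pt (cov o0 (suc-injective (suc-injective eq)) (b0 s)) c)
      where
      b0 : ∀ s → y ≡ off s o0 + y
      b0 RR = refl
      b0 UU = refl
      b0 DD = refl

    choice : ∀ q p → q < L → p < suc (q + B) → Σ Ch λ c → P (tl q p c) × Cov (tl q p c) (suc (tri q)) (q + p)
    choice q p q<L p< with cover (In-p1 q<L p<)
    ... | t , Pt , c with classify q p q<L p< Pt c
    ...   | ch , refl = ch , Pt , c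

    f : ℕ → ℕ → Ch
    f q p with q <? L | p <? suc (q + B)
    ... | yes q<L | yes p< = proj₁ (choice q p q<L p<)
    ... | yes _   | no _   = out
    ... | no _    | _      = out

    P-f : ∀ {q p} → q < L → p < suc (q + B) → P (tl q p (f q p)) × Cov (tl q p (f q p)) (suc (tri q)) (q + p)
    P-f {q} {p} q<L p< with q <? L | p <? suc (q + B)
    ... | yes a  | yes b  = proj₂ (choice q p a b)
    ... | yes _  | no ¬b  = ⊥-elim (¬b p<)
    ... | no ¬a  | _      = ⊥-elim (¬a q<L)

    is-tl : ∀ {q p t} → q < L → p < suc (q + B) → P t → Cov t (suc (tri q)) (q + p) → t ≡ tl q p (f q p)
    is-tl q<L p< Pt c = uniq Pt (proj₁ (P-f q<L p<)) c (proj₂ (P-f q<L p<))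

    is-tl₂ : ∀ {q p t} → q < L → p < suc (q + B) → P t → Cov t (suc (suc (tri q))) (suc (q + p)) → t ≡ tl q p (f q p)
    is-tl₂ {q} {p} q<L p< Pt c =
      uniq Pt (proj₁ (P-f q<L p<)) c (mate q p q<L p< (proj₁ (P-f q<L p<)) (proj₂ (P-f q<L p<)))

    all-tl : ∀ {t} → P t → proj₁ (proj₂ t) < tri L →
      Σ ℕ λ q → Σ ℕ λ p → q < L × p < suc (q + B) × t ≡ tl q p (f q p)
    all-tl {s , r , y} Pt r< with div3 L r r<
    ... | q , q<L , inj₁ refl with In-p1⁻ (inside Pt (cov o1 refl refl))
    ...   | p , e , p< = q , p , q<L , p< , is-tl q<L p< Pt (cov o1 refl (sym e))
    all-tl Pt r< | q , q<L , inj₂ (inj₁ refl) with In-p1⁻ (inside Pt (cov o0 refl refl))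
    ...   | p , e , p< = q , p , q<L , p< , is-tl q<L p< Pt (cov o0 refl (sym e))
    all-tl Pt r< | q , q<L , inj₂ (inj₂ refl) with In-p2⁻ (inside Pt (cov o0 refl refl))
    ...   | p , e , p< = q , p , q<L , p< , is-tl₂ q<L p< Pt (cov o0 refl (sym e))

    s : ℕ → ℕ → Bool
    s zero    j = false
    s (suc q) j = isin0 (f q j) ∨ carry false (f q) j

    cov-in0 : ∀ q p → Cov (tl q p in0) (tri (suc q)) (suc q + p)
    cov-in0 q p = cov o2 refl refl

    cov-in1 : ∀ q p → Cov (tl q p in1) (tri (suc q)) (suc q + suc p)
    cov-in1 q p = cov o2 refl (cong suc (+-suc q p))

    cov-out : ∀ q p → Cov (tl q (suc p) out) (tri q) (q + p)
    cov-out q p = cov o0 refl (sym (cong pred (+-suc q p)))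

    in1-cover : ∀ {q j} → suc q ≤ L → isin1 (f q j) ≡ true → j < suc (q + B) →
      Σ NT λ t → P t × Cov t (tri (suc q)) (suc q + suc j) × Σ ℕ λ q′ → suc q ≡ suc q′ × Σ ℕ λ b →
          Cov t (suc (tri q′)) b
    in1-cover {q} {j} q<L e j< with f q j | P-f {q} {j} q<L j<
    ... | in1 | Pt , c = _ , Pt , cov-in1 q j , q , refl , _ , c

    -- The extra cell in row 3q-2 records that the tile reaches the site from outside; such a tile
    -- cannot extend beyond row 3q.
    s-cover : ∀ {q j} → q ≤ L → s q j ≡ true → j < q + B →
      Σ NT λ t → P t × Cov t (tri q) (q + j) × Σ ℕ λ q′ → q ≡ suc q′ × Σ ℕ λ b → Cov t (suc (tri q′)) b
    s-cover {suc q} {zero} q<L e j< with f q 0 | P-f {q} {0} q<L j<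
    ... | in0 | Pt , c = _ , Pt , cov-in0 q 0 , q , refl , _ , c
    s-cover {suc q} {suc j} q<L e j< with f q (suc j) | P-f {q} {suc j} q<L j<
    ... | in0 | Pt , c = _ , Pt , cov-in0 q (suc j) , q , refl , _ , c
    ... | in1 | _ = in1-cover q<L e (<-trans (n<1+n j) j<)
    ... | out | _ = in1-cover q<L e (<-trans (n<1+n j) j<)

    -- If the cell is the first or middle one of its tile, the tile also meets row 3q+1. If it is
    -- the last, the tile starts in row 3q-2 and belongs to a pair that sends it inwards.
    s-single : ∀ {q j t} → q ≤ L → j < q + B → P t → Cov t (tri q) (q + j) →
      s q j ≡ true ⊎ Σ ℕ (Cov t (suc (tri q)))
    s-single {t = RR , r , y} q≤L j< Pt (cov o0 refl e) = inj₂ (_ , cov o1 refl refl)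
    s-single {t = UU , r , y} q≤L j< Pt (cov o0 refl e) = inj₂ (_ , cov o1 refl refl)
    s-single {t = DD , r , y} q≤L j< Pt (cov o0 refl e) = inj₂ (_ , cov o1 refl refl)
    s-single {t = _ , r , y} q≤L j< Pt (cov o1 eq e) = inj₂ (_ , cov o2 (cong suc eq) refl)
    s-single {suc q} {j} {_ , r , y} q<L j< Pt c@(cov o2 eq e)
      with suc-injective (suc-injective eq)
    ... | refl with In-p1⁻ (inside Pt (cov o0 refl refl))
    ...   | p , ep , p< with is-tl q<L p< Pt (cov o0 refl (sym ep))
    ...     | et = inj₁ (taken (f q p) refl (subst (λ t → Cov t (tri (suc q)) (suc q + j)) et c))
      where
      s-in0 : f q j ≡ in0 → s (suc q) j ≡ true
      s-in0 e rewrite e = refl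
      ∨-true : ∀ b → b ∨ true ≡ true
      ∨-true false = refl
      ∨-true true  = refl
      s-in1 : ∀ {i} → f q i ≡ in1 → j ≡ suc i → s (suc q) j ≡ true
      s-in1 {i} e refl rewrite e = ∨-true (isin0 (f q (suc i)))
      taken : ∀ ch → f q p ≡ ch → Cov (tl q p ch) (tri (suc q)) (suc q + j) → s (suc q) j ≡ true
      taken in0 e c = s-in0 (subst (λ i → f q i ≡ in0) (sym (+-cancelˡ-≡ (suc q) j p (one-per-row c
          (cov-in0 q p)))) e)
      taken in1 e c = s-in1 e (+-cancelˡ-≡ (suc q) j (suc p) (one-per-row c (cov-in1 q p)))
      taken out e c = ⊥-elim (<-irrefl refl (row-≤ c))

    -- An outward tile takes site p - 1 of row 3q, so no tile from outside can have taken it; for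
    -- pair 0 that cell is not in the region.
    out-prev : ∀ {q p} → q < L → p < suc (q + B) → f q p ≡ out → prev (s q) p ≡ false
    out-prev {q} {zero} q<L p< e with f q 0 | P-f {q} {0} q<L p<
    out-prev {q} {zero} q<L p< refl | .out | Pt , c with In-sg⁻ (inside Pt (cov o0 refl refl))
    ... | j , e′ , _ = ⊥-elim (1+n≰n (≤-trans (≤-reflexive (trans (cong suc (sym e′)) (one-per-row
        (cov o1 refl refl) c)))
        (≤-trans (≤-reflexive (+-identityʳ q)) (m≤m+n q j))))
    out-prev {q} {suc p} q<L (s≤s p<) e with f q (suc p) | P-f {q} {suc p} q<L (s≤s p<) | s q p in eq
    out-prev {q} {suc p} q<L (s≤s p<) refl | .out | Pt , c | false = refl
    out-prev {q} {suc p} q<L (s≤s p<) refl | .out | Pt , c | true with s-cover {q} (<⇒≤ q<L) eq p<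
    ... | t , Pt′ , c′ , q′ , refl , b , d with uniq Pt Pt′ (cov-out q p) c′
    ...   | refl = ⊥-elim (<⇒≱ (s≤s (s≤s (n≤1+n _))) (row-≥ d))

    -- If site p - 1 were free, the tile over it would meet row 3q+1 and belong to a pair going
    -- outwards to that site, which can only be pair p.
    not-out-prev : ∀ {q p} → q < L → p < suc (q + B) → f q p ≢ out → prev (s q) p ≡ true
    not-out-prev {q} {zero}  q<L p< ne = refl
    not-out-prev {q} {suc p} q<L (s≤s p<) ne with cover (In-sg {B} {L} {q} {p} (<⇒≤ q<L) p<)
    ... | t , Pt , c with s-single (<⇒≤ q<L) p< Pt c
    ...   | inj₁ e = e
    ...   | inj₂ (y , d) with In-p1⁻ (inside Pt d)
    ...     | p₁ , refl , p₁< with is-tl q<L p₁< Pt d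
    ...       | refl with f q p₁ in eq
    ...         | in0 = ⊥-elim (1+n≰n (row-≥ c))
    ...         | in1 = ⊥-elim (1+n≰n (row-≥ c))
    ...         | out = ⊥-elim (ne (subst (λ i → f q i ≡ out) p₁≡ eq))
      where
      p₁≡ : p₁ ≡ suc p
      p₁≡ = +-cancelˡ-≡ q p₁ (suc p) (trans (one-per-row d (cov o1 refl refl))
        (trans (cong suc (one-per-row (cov o0 refl refl) c)) (sym (+-suc q p))))

    in0-carry : ∀ {q p} → q < L → p < suc (q + B) → f q p ≡ in0 → carry false (f q) p ≡ false
    in0-carry {q} {zero}  q<L p< e = refl
    in0-carry {q} {suc p} q<L p< e
      with f q p | P-f {q} {p} q<L (<-trans (n<1+n p) p<) | f q (suc p) | P-f {q} {suc p} q<L p<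
    in0-carry {q} {suc p} q<L p< refl | in0 | _ | .in0 | _ = refl
    in0-carry {q} {suc p} q<L p< refl | out | _ | .in0 | _ = refl
    in0-carry {q} {suc p} q<L p< refl | in1 | Pt , _ | .in0 | Pt′ , _ with uniq Pt Pt′ (cov-in1 q p)
        (cov-in0 q (suc p))
    ... | ()

    isHalf : Half L B f s
    Half.init isHalf _ = refl
    Half.scan isHalf {q} q<L = cell , last
      where
      cell : ∀ {p} → p < suc (q + B) → Transfer (carry false (f q) p) (prev (s q) p) (f q p) (s (suc q) p)
      cell {p} p< with f q p in eq
      ... | out rewrite out-prev q<L p< eq = leave
      ... | in0 rewrite not-out-prev q<L p< (λ e → in0≢out (trans (sym eq) e)) | in0-carry q<L p< eq = stay
      ... | in1 rewrite not-out-prev q<L p< (λ e → in1≢out (trans (sym eq) e)) = go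
      last : isin1 (f q (q + B)) ≡ false
      last with f q (q + B) | P-f {q} {q + B} q<L ≤-refl
      ... | in0 | _ = refl
      ... | out | _ = refl
      -- Row 3q+3 has q + 1 + B cells, so the site that `in1` assigns to the last pair lies just
      -- outside.
      ... | in1 | Pt , _ with In-sg⁻ {q = suc q} (inside Pt (cov-in1 q (q + B)))
      ...   | j , e , j< = ⊥-elim (<-irrefl (sym (+-cancelˡ-≡ (suc q) (suc (q + B)) j e)) j<)

  module Built {B L f s} (H : Half L B f s) where

    cell-at : ∀ {q p} → q < L → p < suc (q + B) → Transfer (carry false (f q) p) (prev (s q) p) (f q p) (s (suc q) p)
    cell-at q<L = proj₁ (Half.scan H q<L)

    -- The side conditions make rival claims to a cell of a row 3q contradictory: `outer` needs a
    -- free site, `inner0` and `inner1` an occupied one, and the latter two disagree on the carry.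
    data Own (q p : ℕ) : ℕ → ℕ → Set where
      first  : Own q p (suc (tri q)) (q + p)
      second : Own q p (suc (suc (tri q))) (suc (q + p))
      outer  : ∀ {j} → p ≡ suc j → f q p ≡ out → s q j ≡ false → j < q + B → Own q p (tri q) (q + j)
      inner0 : f q p ≡ in0 → carry false (f q) p ≡ false → s (suc q) p ≡ true → p < suc q + B →
          Own q p (tri (suc q)) (suc q + p)
      inner1 : f q p ≡ in1 → s (suc q) (suc p) ≡ true → suc p < suc q + B → Own q p (tri (suc q)) (suc q + suc p)

    private
      in1-s : ∀ {q p} → q < L → suc p < suc (q + B) → f q p ≡ in1 → s (suc q) (suc p) ≡ true
      in1-s {q} {p} q<L p< e with carry false (f q) (suc p) | f q (suc p) | s (suc q) (suc p)
                                | cong isin1 e | prev (s q) (suc p) | cell-at {q} {suc p} q<L p<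
      ... | _ | _ | _ | refl | _ | leave = refl
      ... | _ | _ | _ | refl | _ | go    = refl

      not-last : ∀ {q p} → q < L → p < suc (q + B) → f q p ≡ in1 → suc p < suc (q + B)
      not-last {q} {p} q<L (s≤s p≤) e = s≤s (≤∧≢⇒< p≤ λ { refl →
          false≢true (trans (sym (proj₂ (Half.scan H q<L))) (cong isin1 e)) })

    owns : ∀ {q p a b} → q < L → p < suc (q + B) → Cov (tl q p (f q p)) a b → Own q p a b
    owns {q} {p} q<L p< c with f q p in eq | carry false (f q) p in eqc | prev (s q) p in eqp
                             | s (suc q) p in eqs | cell-at {q} {p} q<L p<
    owns {q} {p} q<L p< (cov o0 refl refl) | .in0 | .false | .true | .true | stay = first
    owns {q} {p} q<L p< (cov o1 refl refl) | .in0 | .false | .true | .true | stay = second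
    owns {q} {p} q<L p< (cov o2 refl refl) | .in0 | .false | .true | .true | stay = inner0 eq eqc eqs p<
    owns {q} {p} q<L p< (cov o0 refl refl) | .in1 | c | .true | .c | go = first
    owns {q} {p} q<L p< (cov o1 refl refl) | .in1 | c | .true | .c | go = second
    owns {q} {p} q<L p< (cov o2 refl refl) | .in1 | c | .true | .c | go =
      subst (Own q p (tri (suc q))) (cong suc (+-suc q p)) (inner1 eq (in1-s q<L (not-last q<L p< eq) eq)
          (not-last q<L p< eq))
    owns {q} {zero}  q<L p< _ | .out | c | .false | .c | leave = ⊥-elim (false≢true (sym eqp))
    owns {q} {suc j} q<L (s≤s p<) (cov o0 refl refl) | .out | c | .false | .c | leave =
      subst (Own q (suc j) (tri q)) (cong pred (sym (+-suc q j))) (outer refl eq eqp p<)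
    owns {q} {suc j} q<L (s≤s p<) (cov o1 refl refl) | .out | c | .false | .c | leave =
      subst (Own q (suc j) (suc (tri q))) (trans (+-suc q j) (cong (suc ∘ pred) (sym (+-suc q j)))) first
    owns {q} {suc j} q<L (s≤s p<) (cov o2 refl refl) | .out | c | .false | .c | leave =
      subst (Own q (suc j) (suc (suc (tri q)))) (cong suc (trans (+-suc q j) (cong (suc ∘ pred) (sym
          (+-suc q j))))) second

    own-In : ∀ {q p a b} → q < L → p < suc (q + B) → Own q p a b → In B L a b
    own-In q<L p< first                = In-p1 q<L p<
    own-In q<L p< second               = In-p2 q<L p<
    own-In q<L p< (outer _ _ _ j<)     = In-sg (<⇒≤ q<L) j<
    own-In q<L p< (inner0 _ _ _ _)       = In-sg q<L p<
    own-In q<L p< (inner1 _ _ p<′)     = In-sg q<L p<′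

    own-row : ∀ {q p a b} → q < L → Own q p a b → a ≤ tri L
    own-row q<L first          = ≤-trans (s≤s (m≤n+m _ 2)) (tri-mono q<L)
    own-row q<L second         = ≤-trans (n≤1+n _) (tri-mono q<L)
    own-row q<L (outer _ _ _ _) = tri-mono (<⇒≤ q<L)
    own-row q<L (inner0 _ _ _ _) = tri-mono q<L
    own-row q<L (inner1 _ _ _) = tri-mono q<L

    own-last : ∀ {q p b} → q < L → Own q p (tri L) b → Σ ℕ λ j → b ≡ L + j × s L j ≡ true × j < L + B
    own-last {q} {p} {b} q<L o = go′ o refl
      where
      go′ : ∀ {a b} → Own q p a b → a ≡ tri L → Σ ℕ λ j → b ≡ L + j × s L j ≡ true × j < L + B
      go′ first e  = ⊥-elim (tri≢1 L q (sym e))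
      go′ second e = ⊥-elim (tri≢2 L q (sym e))
      go′ (outer _ _ _ _) e = ⊥-elim (<-irrefl (tri-inj e) q<L)
      go′ (inner0 _ _ st j<) e with tri-inj {suc q} {L} e
      ... | refl = _ , refl , st , j<
      go′ (inner1 _ st j<) e with tri-inj {suc q} {L} e
      ... | refl = _ , refl , st , j<

    own-unique : ∀ {q p q₁ p₁ a b} → Own q p a b → Own q₁ p₁ a b → q ≡ q₁ × p ≡ p₁
    own-unique o o₁ = go′ o o₁ refl refl
      where
      j≡ : ∀ {q q₁ x y : ℕ} → q ≡ q₁ → q + x ≡ q₁ + y → x ≡ y
      j≡ {q} {_} {x} {y} refl e = +-cancelˡ-≡ q x y e
      go′ : ∀ {q p q₁ p₁ a b a₁ b₁} → Own q p a b → Own q₁ p₁ a₁ b₁ → a ≡ a₁ → b ≡ b₁ → q ≡ q₁ × p ≡ p₁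
      go′ first first ea eb with tri-inj (suc-injective ea)
      ... | refl = refl , j≡ refl eb
      go′ {q} {q₁ = q₁} first second ea eb = ⊥-elim (tri≢1 q q₁ (suc-injective ea))
      go′ {q} {q₁ = q₁} first (outer _ _ _ _) ea eb = ⊥-elim (tri≢1 q₁ q (sym ea))
      go′ {q} {q₁ = q₁} first (inner0 _ _ _ _) ea eb = ⊥-elim (tri≢1 (suc q₁) q (sym ea))
      go′ {q} {q₁ = q₁} first (inner1 _ _ _) ea eb = ⊥-elim (tri≢1 (suc q₁) q (sym ea))
      go′ {q} {q₁ = q₁} second first ea eb = ⊥-elim (tri≢1 q₁ q (sym (suc-injective ea)))
      go′ second second ea eb with tri-inj (suc-injective (suc-injective ea))
      ... | refl = refl , j≡ refl (suc-injective eb)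
      go′ {q} {q₁ = q₁} second (outer _ _ _ _) ea eb = ⊥-elim (tri≢2 q₁ q (sym ea))
      go′ {q} {q₁ = q₁} second (inner0 _ _ _ _) ea eb = ⊥-elim (tri≢2 (suc q₁) q (sym ea))
      go′ {q} {q₁ = q₁} second (inner1 _ _ _) ea eb = ⊥-elim (tri≢2 (suc q₁) q (sym ea))
      go′ {q} {q₁ = q₁} (outer _ _ _ _) first ea eb = ⊥-elim (tri≢1 q q₁ ea)
      go′ {q} {q₁ = q₁} (outer _ _ _ _) second ea eb = ⊥-elim (tri≢2 q q₁ ea)
      go′ (outer refl _ _ _) (outer refl _ _ _) ea eb with tri-inj ea
      ... | refl = refl , cong suc (j≡ refl eb)
      go′ {q} {q₁ = q₁} (outer {j} _ _ sf _) (inner0 _ _ st _) ea eb with tri-inj {q} {suc q₁} ea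
      ... | refl with +-cancelˡ-≡ (suc q₁) _ _ eb
      ...   | refl = ⊥-elim (false≢true (trans (sym sf) st))
      go′ {q} {q₁ = q₁} (outer {j} _ _ sf _) (inner1 _ st _) ea eb with tri-inj {q} {suc q₁} ea
      ... | refl with +-cancelˡ-≡ (suc q₁) _ _ eb
      ...   | refl = ⊥-elim (false≢true (trans (sym sf) st))
      go′ {q} {q₁ = q₁} (inner0 _ _ _ _) first ea eb = ⊥-elim (tri≢1 (suc q) q₁ ea)
      go′ {q} {q₁ = q₁} (inner0 _ _ _ _) second ea eb = ⊥-elim (tri≢2 (suc q) q₁ ea)
      go′ {q} {q₁ = q₁} (inner0 _ _ st _) (outer {j} _ _ sf _) ea eb with tri-inj {suc q} {q₁} ea
      ... | refl with +-cancelˡ-≡ (suc q) _ _ eb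
      ...   | refl = ⊥-elim (false≢true (trans (sym sf) st))
      go′ {q} {q₁ = q₁} (inner0 _ _ _ _) (inner0 _ _ _ _) ea eb with tri-inj {suc q} {suc q₁} ea
      ... | refl = refl , +-cancelˡ-≡ (suc q) _ _ eb
      go′ {q} {q₁ = q₁} (inner0 _ cf _ _) (inner1 e1 _ _) ea eb with tri-inj {suc q} {suc q₁} ea
      ... | refl with +-cancelˡ-≡ (suc q) _ _ eb
      ...   | refl = ⊥-elim (false≢true (trans (sym cf) (cong isin1 e1)))
      go′ {q} {q₁ = q₁} (inner1 _ _ _) first ea eb = ⊥-elim (tri≢1 (suc q) q₁ ea)
      go′ {q} {q₁ = q₁} (inner1 _ _ _) second ea eb = ⊥-elim (tri≢2 (suc q) q₁ ea)
      go′ {q} {q₁ = q₁} (inner1 _ st _) (outer {j} _ _ sf _) ea eb with tri-inj {suc q} {q₁} ea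
      ... | refl with +-cancelˡ-≡ (suc q) _ _ eb
      ...   | refl = ⊥-elim (false≢true (trans (sym sf) st))
      go′ {q} {q₁ = q₁} (inner1 e1 _ _) (inner0 _ cf _ _) ea eb with tri-inj {suc q} {suc q₁} ea
      ... | refl with +-cancelˡ-≡ (suc q) _ _ eb
      ...   | refl = ⊥-elim (false≢true (trans (sym cf) (cong isin1 e1)))
      go′ {q} {q₁ = q₁} (inner1 _ _ _) (inner1 _ _ _) ea eb with tri-inj {suc q} {suc q₁} ea
      ... | refl = refl , suc-injective (+-cancelˡ-≡ (suc q) _ _ eb)

    Covered : ℕ → ℕ → Set
    Covered a b = Σ ℕ λ q → Σ ℕ λ p → q < L × p < suc (q + B) × Cov (tl q p (f q p)) a b

    pair-cov : ∀ {q p} → q < L → p < suc (q + B) →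
      Cov (tl q p (f q p)) (suc (tri q)) (q + p) × Cov (tl q p (f q p)) (suc (suc (tri q))) (suc (q + p))
    pair-cov {q} {p} q<L p< with f q p | carry false (f q) p | prev (s q) p in eqp
                             | s (suc q) p | cell-at {q} {p} q<L p<
    ... | .in0 | .false | .true | .true | stay = cov o0 refl refl , cov o1 refl refl
    ... | .in1 | c | .true | .c | go = cov o0 refl refl , cov o1 refl refl
    pair-cov {q} {zero}  q<L p< | .out | c | .false | .c | leave = ⊥-elim (false≢true (sym eqp))
    pair-cov {q} {suc j} q<L p< | .out | c | .false | .c | leave = cov o1 refl e , cov o2 refl (cong suc e)
      where
      e : q + suc j ≡ suc (pred (q + suc j))
      e = trans (+-suc q j) (cong (suc ∘ pred) (sym (+-suc q j)))

    from-left : ∀ {q j} → q < L → suc j < suc q + B → ∀ c → f q j ≡ c → isin1 c ≡ true →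
      Covered (tri (suc q)) (suc q + suc j)
    from-left {q} {j} q<L j< in1 e _ = q , j , q<L , <-trans (n<1+n j) j< ,
      subst (λ c → Cov (tl q j c) (tri (suc q)) (suc q + suc j)) (sym e) (cov o2 refl (cong suc (+-suc q j)))

    single-true : ∀ {q j} → q ≤ L → j < q + B → s q j ≡ true → Covered (tri q) (q + j)
    single-true {zero}  {j} q≤L j< e = ⊥-elim (false≢true (trans (sym (Half.init H j<)) e))
    single-true {suc q} {j} q<L j< e with f q j in eq | carry false (f q) j in eqc | prev (s q) j
        | s (suc q) j | cell-at {q} {j} q<L j<
    single-true {suc q} {j} q<L j< refl | .in0 | .false | _ | .true | stay =
      q , j , q<L , j< , subst (λ c → Cov (tl q j c) (tri (suc q)) (suc q + j)) (sym eq) (cov o2 refl refl)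
    single-true {suc q} {suc j} q<L j< refl | _ | .true | _ | .true | leave = from-left q<L j< (f q j) refl eqc
    single-true {suc q} {suc j} q<L j< refl | _ | .true | _ | .true | go    = from-left q<L j< (f q j) refl eqc

    -- The free site j is what `prev` shows to pair j + 1, which forces `leave`, hence an outward
    -- tile over the site.
    single-false : ∀ {q j} → q < L → j < q + B → s q j ≡ false → Covered (tri q) (q + j)
    single-false {q} {j} q<L j< e with f q (suc j) in eq | carry false (f q) (suc j) | s q j
        | s (suc q) (suc j) | cell-at {q} {suc j} q<L (s≤s j<)
    single-false {q} {j} q<L j< refl | .out | _ | _ | _ | leave =
      q , suc j , q<L , s≤s j< , subst (λ c → Cov (tl q (suc j) c) (tri q) (q + j)) (sym eq) (cov o0 refl (sym
          (cong pred (+-suc q j))))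

    covered : ∀ {a b} → In B L a b → a < tri L → Covered a b
    covered {a} i a< with div3 L a a<
    ... | q , q<L , inj₁ refl with In-sg⁻ i
    ...   | j , refl , j< with s q j in eq
    ...     | true  = single-true (<⇒≤ q<L) j< eq
    ...     | false = single-false q<L j< eq
    covered i a< | q , q<L , inj₂ (inj₁ refl) with In-p1⁻ i
    ...   | p , refl , p< = q , p , q<L , p< , proj₁ (pair-cov q<L p<)
    covered i a< | q , q<L , inj₂ (inj₂ refl) with In-p2⁻ i
    ...   | p , refl , p< = q , p , q<L , p< , proj₂ (pair-cov q<L p<)

-- The hexagon inequalities in row coordinates.

module Hexagon where

  open import Defs
  open HalfBenzel
  open import Data.Nat as ℕ using (ℕ; zero; suc)
  open import Data.Integer using (ℤ; +_; -[1+_]; _+_; _-_; _*_; -_; _≤_; +≤+)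
  open import Data.Integer.Tactic.RingSolver using (solve-∀)

  -- A cell lies in the benzel iff its centre (X , V) satisfies the six edge inequalities with the
  -- margin of the extreme vertex of the cell.
  record Nice (A B : ℤ) (c : Cell) : Set where
    constructor nice
    X = proj₁ (center c)
    V = proj₂ (center c)
    field
      n1 : + 0 ≤ + 2 * B - X - V - + 2
      n2 : + 0 ≤ A - V - + 1
      n3 : + 0 ≤ + 2 * B - V + X - + 2
      n4 : + 0 ≤ X + V + + 2 * A - + 2
      n5 : + 0 ≤ V + B - + 1
      n6 : + 0 ≤ V - X + + 2 * A - + 2


  module Hex (A B : ℤ) (p q : ℕ) (ep : + 2 * A - B ≡ + suc p) (eq : + 2 * B - A ≡ + suc q) where

    mul : ∀ {F} n {x} → F ≡ + suc n → + 0 ≤ x → + 0 ≤ F * x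
    mul n {x} refl le = subst (_≤ + suc n * x) (ℤP.*-zeroʳ (+ suc n)) (ℤP.*-monoˡ-≤-nonNeg (+ suc n) le)

    div : ∀ {F} n {x} → F ≡ + suc n → + 0 ≤ F * x → + 0 ≤ x
    div n {x} refl le = ℤP.*-cancelˡ-≤-pos (+ 0) x (+ suc n) (subst (_≤ + suc n * x) (sym (ℤP.*-zeroʳ (+ suc n))) le)

    two : ∀ {F n} → F ≡ + suc n → + 2 * F ≡ + suc (n ℕ.+ suc (n ℕ.+ 0))
    two refl = refl

    -- The edges have lengths 2A - B and 2B - A alternately; splitting these positive factors off
    -- each cross product leaves the linear form of the edge.
    e1 : ∀ A B x y → ((+ 2 * B - A) - (A + B)) * (y - (B - A)) - (A - (B - A)) * (x - (A + B))
      ≡ (+ 2 * A - B) * (+ 2 * B - x - y)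
    e1 = solve-∀
    e2 : ∀ A B x y → ((A - + 2 * B) - (+ 2 * B - A)) * (y - A) - (A - A) * (x - (+ 2 * B - A))
      ≡ (+ 2 * (+ 2 * B - A)) * (A - y)
    e2 = solve-∀
    e3 : ∀ A B x y → (- (A + B) - (A - + 2 * B)) * (y - A) - ((B - A) - A) * (x - (A - + 2 * B))
      ≡ (+ 2 * A - B) * (+ 2 * B - y + x)
    e3 = solve-∀
    e4 : ∀ A B x y → ((B - + 2 * A) - - (A + B)) * (y - (B - A)) - (- B - (B - A)) * (x - - (A + B))
      ≡ (+ 2 * B - A) * (x + y + + 2 * A)
    e4 = solve-∀
    e5 : ∀ A B x y → ((+ 2 * A - B) - (B - + 2 * A)) * (y - - B) - (- B - - B) * (x - (B - + 2 * A))
      ≡ (+ 2 * (+ 2 * A - B)) * (y + B)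
    e5 = solve-∀
    e6 : ∀ A B x y → ((A + B) - (+ 2 * A - B)) * (y - - B) - ((B - A) - - B) * (x - (+ 2 * A - B))
      ≡ (+ 2 * B - A) * (y - x + + 2 * A)
    e6 = solve-∀

    l1 : ∀ B X V dx dy → + 2 * B - (X + dx) - (V + dy) ≡ (+ 2 * B - X - V - + 2) + (+ 2 - dx - dy)
    l1 = solve-∀
    l2 : ∀ A V dy → A - (V + dy) ≡ (A - V - + 1) + (+ 1 - dy)
    l2 = solve-∀
    l3 : ∀ B X V dx dy → + 2 * B - (V + dy) + (X + dx) ≡ (+ 2 * B - V + X - + 2) + (+ 2 + dx - dy)
    l3 = solve-∀
    l4 : ∀ A X V dx dy → (X + dx) + (V + dy) + + 2 * A ≡ (X + V + + 2 * A - + 2) + (+ 2 + dx + dy)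
    l4 = solve-∀
    l5 : ∀ B V dy → (V + dy) + B ≡ (V + B - + 1) + (+ 1 + dy)
    l5 = solve-∀
    l6 : ∀ A X V dx dy → (V + dy) - (X + dx) + + 2 * A ≡ (V - X + + 2 * A - + 2) + (+ 2 - dx + dy)
    l6 = solve-∀

    private
      up : ∀ {x y z d} → x ≡ y → y ≡ z + d → + 0 ≤ z → + 0 ≤ d → + 0 ≤ x
      up refl refl p q = ℤP.+-mono-≤ p q

      down : ∀ {x z d} → x ≡ z + d → d ≡ + 0 → + 0 ≤ x → + 0 ≤ z
      down {z = z} refl refl p = subst (+ 0 ≤_) (ℤP.+-identityʳ z) p

    to : ∀ c → inBenzel A B c → Nice A B c
    -- For each edge the vertex nearest to it is selected; there the margin in `Nice` is attained
    -- exactly.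
    to (m , n) ((a1 ∷ _ ∷ _ ∷ _ ∷ _ ∷ a6 ∷ []) ∷ (_ ∷ _ ∷ b3 ∷ b4 ∷ _ ∷ _ ∷ []) ∷ _ ∷ _ ∷
                (_ ∷ _ ∷ _ ∷ _ ∷ c5 ∷ _ ∷ []) ∷ (_ ∷ d2 ∷ _ ∷ _ ∷ _ ∷ _ ∷ []) ∷ []) =
      nice (down (l1 B X V (+ 2) (+ 0)) refl (div p ep (subst (+ 0 ≤_) (e1 A B (X + (+ 2)) (V + (+ 0))) a1)))
           (down (l2 A V (+ 1)) refl (div _ (two eq) (subst (+ 0 ≤_) (e2 A B (X + (+ 1)) (V + (+ 1))) d2)))
           (down (l3 B X V (- + 2) (+ 0)) refl (div p ep (subst (+ 0 ≤_) (e3 A B (X + (- + 2)) (V + (+ 0))) b3)))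
           (down (l4 A X V (- + 2) (+ 0)) refl (div q eq (subst (+ 0 ≤_) (e4 A B (X + (- + 2)) (V + (+ 0))) b4)))
           (down (l5 B V (- + 1)) refl (div _ (two ep) (subst (+ 0 ≤_) (e5 A B (X + (- + 1)) (V + (- + 1))) c5)))
           (down (l6 A X V (+ 2) (+ 0)) refl (div q eq (subst (+ 0 ≤_) (e6 A B (X + (+ 2)) (V + (+ 0))) a6)))
      where
      X = + 2 + + 3 * m
      V = + 2 * n - m

    from : ∀ c → Nice A B c → inBenzel A B c
    from (m , n) N =
      vertex (+ 2) (+ 0) 0≤ 0≤ 0≤ 0≤ 0≤ 0≤ ∷
      vertex (- + 2) (+ 0) 0≤ 0≤ 0≤ 0≤ 0≤ 0≤ ∷
      vertex (- + 1) (+ 1) 0≤ 0≤ 0≤ 0≤ 0≤ 0≤ ∷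
      vertex (+ 1) (- + 1) 0≤ 0≤ 0≤ 0≤ 0≤ 0≤ ∷
      vertex (- + 1) (- + 1) 0≤ 0≤ 0≤ 0≤ 0≤ 0≤ ∷
      vertex (+ 1) (+ 1) 0≤ 0≤ 0≤ 0≤ 0≤ 0≤ ∷ []
      where
      open Nice N
      0≤ : ∀ {n} → + 0 ≤ + n
      0≤ = +≤+ ℕ.z≤n
      vertex : ∀ dx dy → + 0 ≤ + 2 - dx - dy → + 0 ≤ + 1 - dy → + 0 ≤ + 2 + dx - dy →
        + 0 ≤ + 2 + dx + dy → + 0 ≤ + 1 + dy → + 0 ≤ + 2 - dx + dy → inHex A B (X + dx , V + dy)
      vertex dx dy d1 d2 d3 d4 d5 d6 =
        subst (+ 0 ≤_) (sym (e1 A B (X + dx) (V + dy))) (mul p ep (up refl (l1 B X V dx dy) n1 d1)) ∷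
        subst (+ 0 ≤_) (sym (e2 A B (X + dx) (V + dy))) (mul _ (two eq) (up refl (l2 A V dy) n2 d2)) ∷
        subst (+ 0 ≤_) (sym (e3 A B (X + dx) (V + dy))) (mul p ep (up refl (l3 B X V dx dy) n3 d3)) ∷
        subst (+ 0 ≤_) (sym (e4 A B (X + dx) (V + dy))) (mul q eq (up refl (l4 A X V dx dy) n4 d4)) ∷
        subst (+ 0 ≤_) (sym (e5 A B (X + dx) (V + dy))) (mul _ (two ep) (up refl (l5 B V dy) n5 d5)) ∷
        subst (+ 0 ≤_) (sym (e6 A B (X + dx) (V + dy))) (mul q eq (up refl (l6 A X V dx dy) n6 d6)) ∷ []

  -- Complex conjugation fixes X and negates V, which exchanges opposite inequalities together with
  -- the roles of a and b.
  nice-mirror : ∀ {A B} c → Nice A B c → Nice B A (proj₁ c , proj₁ c - proj₂ c)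
  nice-mirror {A} {B} (m , n) N =
    nice (subst (+ 0 ≤_) (q1 A m n) n6) (subst (+ 0 ≤_) (q2 B m n) n5) (subst (+ 0 ≤_) (q3 A m n) n4)
         (subst (+ 0 ≤_) (q4 B m n) n3) (subst (+ 0 ≤_) (q5 A m n) n2) (subst (+ 0 ≤_) (q6 B m n) n1)
    where
    open Nice N
    q1 : ∀ A m n → (+ 2 * n - m) - (+ 2 + + 3 * m) + + 2 * A - + 2 ≡ + 2 * A - (+ 2 + + 3 * m) - (+ 2 *
        (m - n) - m) - + 2
    q1 = solve-∀
    q2 : ∀ B m n → (+ 2 * n - m) + B - + 1 ≡ B - (+ 2 * (m - n) - m) - + 1
    q2 = solve-∀
    q3 : ∀ A m n → (+ 2 + + 3 * m) + (+ 2 * n - m) + + 2 * A - + 2 ≡ + 2 * A - (+ 2 * (m - n) - m) +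
        (+ 2 + + 3 * m) - + 2
    q3 = solve-∀
    q4 : ∀ B m n → + 2 * B - (+ 2 * n - m) + (+ 2 + + 3 * m) - + 2 ≡ (+ 2 + + 3 * m) + (+ 2 *
        (m - n) - m) + + 2 * B - + 2
    q4 = solve-∀
    q5 : ∀ A m n → A - (+ 2 * n - m) - + 1 ≡ (+ 2 * (m - n) - m) + A - + 1
    q5 = solve-∀
    q6 : ∀ B m n → + 2 * B - (+ 2 + + 3 * m) - (+ 2 * n - m) - + 2 ≡ (+ 2 * (m - n) - m) -
        (+ 2 + + 3 * m) + + 2 * B - + 2
    q6 = solve-∀

  -- Cell y of row r of the benzel with a = m+2k+1 and b = 2m+k+1, rows being counted from below;
  -- the index y exceeds the second cell coordinate by m + k.
  ι : ℕ → ℕ → ℕ → ℕ → Cell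
  ι k m r y = + 2 * + y - + k - + r , + y - (+ m + + k)

  pos-tri : ∀ n → + tri n ≡ + 3 * + n
  pos-tri zero    = refl
  pos-tri (suc n) = trans (ℤP.pos-+ 3 (tri n)) (trans (cong (λ t → + 3 + t) (pos-tri n))
    (trans (alg (+ n)) (cong (+ 3 *_) (sym (ℤP.pos-+ 1 n)))))
    where
    alg : ∀ x → + 3 + + 3 * x ≡ + 3 * (+ 1 + x)
    alg = solve-∀

  side-a side-b : ℕ → ℕ → ℤ
  side-a k m = + 1 + + m + + 2 * + k
  side-b k m = + 1 + + 2 * + m + + k

  private
    diff : ∀ {n m x} → x ≡ + 2 * (+ n - + m) → + 0 ≤ x → m ℕ.≤ n
    diff {n} {m} refl p = ℤP.drop‿+≤+ (ℤP.0≤i-j⇒j≤i (ℤP.*-cancelˡ-≤-pos (+ 0) (+ n - + m) (+ 2) p))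

    diff⁻ : ∀ {n m x} → x ≡ + 2 * (+ n - + m) → m ℕ.≤ n → + 0 ≤ x
    diff⁻ {n} {m} refl p = ℤP.*-monoˡ-≤-nonNeg (+ 2) (ℤP.i≤j⇒0≤j-i (+≤+ p))

    diff₁ : ∀ {n m x} → x ≡ + n - + m → + 0 ≤ x → m ℕ.≤ n
    diff₁ {n} {m} refl p = ℤP.drop‿+≤+ (ℤP.0≤i-j⇒j≤i p)

    diff₁⁻ : ∀ {n m x} → x ≡ + n - + m → m ℕ.≤ n → + 0 ≤ x
    diff₁⁻ {n} {m} refl p = ℤP.i≤j⇒0≤j-i (+≤+ p)

    pos₃ : ∀ a b c → + (a ℕ.+ b ℕ.+ c) ≡ + a + + b + + c
    pos₃ a b c = trans (ℤP.pos-+ (a ℕ.+ b) c) (cong (_+ + c) (ℤP.pos-+ a b))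

  module Row (k m r y : ℕ) where
    X V A B : ℤ
    X = proj₁ (center (ι k m r y))
    V = proj₂ (center (ι k m r y))
    A = side-a k m
    B = side-b k m

    -- `t1` to `t6` turn the six slacks into those of `In`. The factor 2 on slanted edges is there
    -- because X + V is even at every cell centre; `t5` shows that r is the height above the lower
    -- side.
    t1 : + 2 * B - X - V - + 2 ≡ + 2 * (+ (tri k ℕ.+ tri m ℕ.+ r) - + suc (tri y))
    t1 = trans (alg (+ k) (+ m) (+ r) (+ y)) (cong (+ 2 *_) (cong₂ _-_
      (sym (trans (pos₃ (tri k) (tri m) r) (cong₂ (λ s t → s + t + + r) (pos-tri k) (pos-tri m))))
      (sym (trans (ℤP.pos-+ 1 (tri y)) (cong (λ t → + 1 + t) (pos-tri y))))))
      where
      alg : ∀ k m r y → + 2 * (+ 1 + + 2 * m + k) - (+ 2 + + 3 * (+ 2 * y - k - r)) - (+ 2 * (y - (m + k)) -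
          (+ 2 * y - k - r)) - + 2
        ≡ + 2 * ((+ 3 * k + + 3 * m + r) - (+ 1 + + 3 * y))
      alg = solve-∀

    t2 : A - V - + 1 ≡ + (tri k ℕ.+ tri m) - + r
    t2 = trans (alg (+ k) (+ m) (+ r) (+ y)) (cong (_- + r)
      (sym (trans (ℤP.pos-+ (tri k) (tri m)) (cong₂ _+_ (pos-tri k) (pos-tri m)))))
      where
      alg : ∀ k m r y → (+ 1 + m + + 2 * k) - (+ 2 * (y - (m + k)) - (+ 2 * y - k - r)) - + 1 ≡
          (+ 3 * k + + 3 * m) - r
      alg = solve-∀

    t3 : + 2 * B - V + X - + 2 ≡ + 2 * (+ (suc (tri y) ℕ.+ tri m) - + (r ℕ.+ r))
    t3 = trans (alg (+ k) (+ m) (+ r) (+ y)) (cong (+ 2 *_) (cong₂ _-_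
      (sym (trans (pos₃ 1 (tri y) (tri m)) (cong₂ (λ s t → + 1 + s + t) (pos-tri y) (pos-tri m))))
      (sym (ℤP.pos-+ r r))))
      where
      alg : ∀ k m r y → + 2 * (+ 1 + + 2 * m + k) - (+ 2 * (y - (m + k)) - (+ 2 * y - k - r)) + (+ 2 + + 3 *
          (+ 2 * y - k - r)) - + 2
        ≡ + 2 * ((+ 1 + + 3 * y + + 3 * m) - (r + r))
      alg = solve-∀

    t4 : X + V + + 2 * A - + 2 ≡ + 2 * (+ suc (tri y) - + r)
    t4 = trans (alg (+ k) (+ m) (+ r) (+ y)) (cong (λ t → + 2 * (t - + r))
      (sym (trans (ℤP.pos-+ 1 (tri y)) (cong (λ t → + 1 + t) (pos-tri y)))))
      where
      alg : ∀ k m r y → (+ 2 + + 3 * (+ 2 * y - k - r)) + (+ 2 * (y - (m + k)) - (+ 2 * y - k - r)) + + 2 *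
          (+ 1 + m + + 2 * k) - + 2
        ≡ + 2 * ((+ 1 + + 3 * y) - r)
      alg = solve-∀

    t5 : V + B - + 1 ≡ + r - + 0
    t5 = alg (+ k) (+ m) (+ r) (+ y)
      where
      alg : ∀ k m r y → (+ 2 * (y - (m + k)) - (+ 2 * y - k - r)) + (+ 1 + + 2 * m + k) - + 1 ≡ r - + 0
      alg = solve-∀

    t6 : V - X + + 2 * A - + 2 ≡ + 2 * (+ (tri k ℕ.+ (r ℕ.+ r)) - + suc (tri y))
    t6 = trans (alg (+ k) (+ m) (+ r) (+ y)) (cong (+ 2 *_) (cong₂ _-_
      (sym (trans (ℤP.pos-+ (tri k) (r ℕ.+ r)) (cong₂ _+_ (pos-tri k) (ℤP.pos-+ r r))))
      (sym (trans (ℤP.pos-+ 1 (tri y)) (cong (λ t → + 1 + t) (pos-tri y))))))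
      where
      alg : ∀ k m r y → (+ 2 * (y - (m + k)) - (+ 2 * y - k - r)) - (+ 2 + + 3 * (+ 2 * y - k - r)) + + 2 *
          (+ 1 + m + + 2 * k) - + 2
        ≡ + 2 * ((+ 3 * k + (r + r)) - (+ 1 + + 3 * y))
      alg = solve-∀

    nice⇒In : Nice A B (ι k m r y) → In k m r y
    nice⇒In N = mkIn (diff t4 n4) (diff t6 n6) (diff t3 n3) (diff t1 n1) (diff₁ t2 n2)
      where open Nice N

    In⇒nice : In k m r y → Nice A B (ι k m r y)
    In⇒nice i = nice (diff⁻ t1 hi′) (diff₁⁻ t2 top) (diff⁻ t3 lo′) (diff⁻ t4 lo) (diff₁⁻ t5 ℕ.z≤n) (diff⁻ t6 hi)
      where open In i

  nice-coords : ∀ k m c → Nice (side-a k m) (side-b k m) c → Σ ℕ λ r → Σ ℕ λ y → c ≡ ι k m r y × In k m r y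
  nice-coords k m c@(x , z) N = coords (row n5) (index (z + (+ m + + k)) refl)
    where
    open Nice N renaming (V to v)
    row : ∀ {i} → + 0 ≤ i → Σ ℕ λ r → + r ≡ i
    row {+ r} _ = r , refl
    index : ∀ i → i ≡ z + (+ m + + k) → Σ ℕ λ y → + y ≡ z + (+ m + + k)
    index (+ y)    e = y , e
    -- A negative index is impossible: `n4` says r ≤ 3y + 1, while r is non-negative by `n5`.
    index -[1+ y ] e with row n5
    ... | r , er = ⊥-elim (neg (subst (+ 0 ≤_) (trans (alg x z (+ k) (+ m))
        (cong₂ (λ s t → + 2 * ((+ 1 + + 3 * s) - t)) (sym e) (sym er))) n4))
      where
      alg : ∀ x z k m → (+ 2 + + 3 * x) + (+ 2 * z - x) + + 2 * (+ 1 + m + + 2 * k) - + 2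
        ≡ + 2 * ((+ 1 + + 3 * (z + (m + k))) - ((+ 2 * z - x) + (+ 1 + + 2 * m + k) - + 1))
      alg = solve-∀
      alg′ : ∀ y r → + 2 * ((+ 1 + + 3 * - (+ 1 + y)) - r) ≡ - (+ 4 + + 6 * y + + 2 * r)
      alg′ = solve-∀
      big : + 4 + + 6 * + y + + 2 * + r ≡ + (4 ℕ.+ 6 ℕ.* y ℕ.+ 2 ℕ.* r)
      big = sym (trans (pos₃ 4 (6 ℕ.* y) (2 ℕ.* r)) (cong₂ (λ s t → + 4 + s + t) (ℤP.pos-* 6 y) (ℤP.pos-* 2 r)))
      neg : + 0 ≤ + 2 * ((+ 1 + + 3 * -[1+ y ]) - + r) → ⊥
      neg p with subst (+ 0 ≤_) (trans (alg′ (+ y) (+ r)) (cong -_ big)) p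
      ... | ()
    coords : (Σ ℕ λ r → + r ≡ v + side-b k m - + 1) → (Σ ℕ λ y → + y ≡ z + (+ m + + k)) →
      Σ ℕ λ r → Σ ℕ λ y → c ≡ ι k m r y × In k m r y
    coords (r , er) (y , ey) = r , y , c≡ , Row.nice⇒In k m r y (subst (Nice _ _) c≡ N)
      where
      c≡ : c ≡ ι k m r y
      c≡ = sym (cong₂ _,_
        (trans (cong₂ (λ r y → + 2 * y - + k - r) er ey) (alg₁ x z (+ k) (+ m)))
        (trans (cong (_- (+ m + + k)) ey) (alg₂ z (+ k) (+ m))))
        where
        alg₁ : ∀ x z k m → + 2 * (z + (m + k)) - k - ((+ 2 * z - x) + (+ 1 + + 2 * m + k) - + 1) ≡ x
        alg₁ = solve-∀
        alg₂ : ∀ z k m → (z + (m + k)) - (m + k) ≡ z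
        alg₂ = solve-∀

-- Row coordinates for the lower half and, by conjugation, for the upper half.

module Charts where

  open import Defs
  open HalfBenzel
  open Hexagon
  open import Data.Nat as ℕ using (ℕ; suc)
  open import Data.Integer using (+_; _+_; _-_; _*_; -_)
  open import Data.Integer.Tactic.RingSolver using (solve-∀)

  -- Coordinates on a region in which the rows of one half are counted from its outer end.
  record Chart (R : Cell → Set) (B L : ℕ) : Set where
    field
      cell      : ℕ → ℕ → Cell
      cell-inj  : ∀ {r y r′ y′} → cell r y ≡ cell r′ y′ → r ≡ r′ × y ≡ y′
      decode    : ∀ {c} → R c → Σ ℕ λ r → Σ ℕ λ y → c ≡ cell r y × In B L r y
      encode    : ∀ {r y} → In B L r y → R (cell r y)
      tile      : NT → Tile
      allowed   : ∀ t → RightStonesAndBones (proj₁ (tile t))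
      tile-inj  : ∀ {t t′} → tile t ≡ tile t′ → t ≡ t′
      tile-cov  : ∀ {t r y} → Cov t r y → cell r y ∈ tileCells (tile t)
      tile-cov⁻ : ∀ {t c} → c ∈ tileCells (tile t) → Σ ℕ λ r → Σ ℕ λ y → Cov t r y × c ≡ cell r y
      untile    : ∀ {t} → RightStonesAndBones (proj₁ t) → All R (tileCells t) → Σ NT λ t′ → t ≡ tile t′

  private
    pos1 : ∀ n → + suc n ≡ + 1 + + n
    pos1 = ℤP.pos-+ 1
    pos2 : ∀ n → + suc (suc n) ≡ + 2 + + n
    pos2 = ℤP.pos-+ 2

    +-cancel : ∀ a {x y} → x - a ≡ y - a → x ≡ y
    +-cancel a {x} {y} e = trans (alg x a) (trans (cong (_+ a) e) (sym (alg y a)))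
      where
      alg : ∀ x a → x ≡ (x - a) + a
      alg = solve-∀

    +-cancelˡ : ∀ a {x y} → a + x ≡ a + y → x ≡ y
    +-cancelˡ a {x} {y} e = trans (alg x a) (trans (cong (_- a) e) (sym (alg y a)))
      where
      alg : ∀ x a → x ≡ (a + x) - a
      alg = solve-∀

    +-cancelʳ : ∀ a {x y} → x + a ≡ y + a → x ≡ y
    +-cancelʳ a {x} {y} e = +-cancelˡ a (trans (ℤP.+-comm a x) (trans e (ℤP.+-comm y a)))

  ⊕-cancel : ∀ a d {c} → a ⊕ d ≡ c ⊕ d → a ≡ c
  ⊕-cancel (a , a′) (d , d′) {c , c′} e = cong₂ _,_ (+-cancelʳ d (cong proj₁ e)) (+-cancelʳ d′ (cong proj₂ e))

  ι-inj : ∀ k m {r y r′ y′} → ι k m r y ≡ ι k m r′ y′ → r ≡ r′ × y ≡ y′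
  ι-inj k m {r} {y} {r′} {y′} e with ℤP.+-injective (+-cancel (+ m + + k) (cong proj₂ e))
  ... | refl = ℤP.+-injective (ℤP.neg-injective (+-cancelˡ (+ 2 * + y - + k) (cong proj₁ e))) , refl

  -- Complex conjugation in cell coordinates; it turns the upper half into a lower one with k and m
  -- exchanged.
  μ-cell : Cell → Cell
  μ-cell (x , y) = x , x - y

  μ-cell-inv : ∀ c → μ-cell (μ-cell c) ≡ c
  μ-cell-inv (x , y) = cong (x ,_) (alg x y)
    where
    alg : ∀ x y → x - (x - y) ≡ y
    alg = solve-∀

  module Cells (k m r y : ℕ) where
    x₀ = proj₁ (ι k m r y)
    y₀ = proj₂ (ι k m r y)

    ι₁₁ : ι k m (suc r) (suc y) ≡ (x₀ + + 1 , y₀ + + 1)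
    ι₁₁ = cong₂ _,_ (trans (cong₂ (λ s t → + 2 * s - + k - t) (pos1 y) (pos1 r)) (alg₁ (+ k) (+ r) (+ y)))
                    (trans (cong (_- (+ m + + k)) (pos1 y)) (alg₂ (+ k) (+ m) (+ y)))
      where
      alg₁ : ∀ k r y → + 2 * (+ 1 + y) - k - (+ 1 + r) ≡ (+ 2 * y - k - r) + + 1
      alg₁ = solve-∀
      alg₂ : ∀ k m y → (+ 1 + y) - (m + k) ≡ (y - (m + k)) + + 1
      alg₂ = solve-∀

    ι₁₀ : ι k m (suc r) y ≡ (x₀ - + 1 , y₀)
    ι₁₀ = cong (_, y₀) (trans (cong (λ t → + 2 * + y - + k - t) (pos1 r)) (alg₁ (+ k) (+ r) (+ y)))
      where
      alg₁ : ∀ k r y → + 2 * y - k - (+ 1 + r) ≡ (+ 2 * y - k - r) - + 1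
      alg₁ = solve-∀

    ι₂₀ : ι k m (suc (suc r)) y ≡ (x₀ - + 2 , y₀)
    ι₂₀ = cong (_, y₀) (trans (cong (λ t → + 2 * + y - + k - t) (pos2 r)) (alg₁ (+ k) (+ r) (+ y)))
      where
      alg₁ : ∀ k r y → + 2 * y - k - (+ 2 + r) ≡ (+ 2 * y - k - r) - + 2
      alg₁ = solve-∀

    ι₂₁ : ι k m (suc (suc r)) (suc y) ≡ (x₀ , y₀ + + 1)
    ι₂₁ = cong₂ _,_ (trans (cong₂ (λ s t → + 2 * s - + k - t) (pos1 y) (pos2 r)) (alg₁ (+ k) (+ r) (+ y)))
                    (trans (cong (_- (+ m + + k)) (pos1 y)) (alg₂ (+ k) (+ m) (+ y)))
      where
      alg₁ : ∀ k r y → + 2 * (+ 1 + y) - k - (+ 2 + r) ≡ + 2 * y - k - r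
      alg₁ = solve-∀
      alg₂ : ∀ k m y → (+ 1 + y) - (m + k) ≡ (y - (m + k)) + + 1
      alg₂ = solve-∀

    ι₂₂ : ι k m (suc (suc r)) (suc (suc y)) ≡ (x₀ + + 2 , y₀ + + 2)
    ι₂₂ = cong₂ _,_ (trans (cong₂ (λ s t → + 2 * s - + k - t) (pos2 y) (pos2 r)) (alg₁ (+ k) (+ r) (+ y)))
                    (trans (cong (_- (+ m + + k)) (pos2 y)) (alg₂ (+ k) (+ m) (+ y)))
      where
      alg₁ : ∀ k r y → + 2 * (+ 2 + y) - k - (+ 2 + r) ≡ (+ 2 * y - k - r) + + 2
      alg₁ = solve-∀
      alg₂ : ∀ k m y → (+ 2 + y) - (m + k) ≡ (y - (m + k)) + + 2
      alg₂ = solve-∀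

  private
    c-0 : ∀ a → a + + 0 ≡ a
    c-0 = ℤP.+-identityʳ
    c-21 : ∀ a → (a - + 2) + + 1 ≡ a - + 1
    c-21 = solve-∀
    c-22 : ∀ a → (a - + 2) + + 2 ≡ a
    c-22 = solve-∀
    m-11 : ∀ a b → (a + + 1) - (b + + 1) ≡ a - b
    m-11 = solve-∀
    m-22 : ∀ a b → (a + + 2) - (b + + 2) ≡ a - b
    m-22 = solve-∀
    m-1 : ∀ a b → a - (b + + 1) + + 1 ≡ a - b
    m-1 = solve-∀
    m11-1 : ∀ a b → (a + + 1) - (b + + 1) ≡ a - (b + + 1) + + 1
    m11-1 = solve-∀
    m-sub : ∀ a b → (a - + 2) - b + + 2 ≡ a - b
    m-sub = solve-∀
    m-sub1 : ∀ a b → (a - + 1) - b ≡ (a - + 2) - b + + 1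
    m-sub1 = solve-∀

  module Lower (R : Cell → Set) (k m : ℕ)
    (R⇒ : ∀ {c} → R c → Nice (side-a k m) (side-b k m) c)
    (R⇐ : ∀ {c} → Nice (side-a k m) (side-b k m) c → R c) where

    -- A falling bone is anchored at its left end, which is in its highest row; hence r + 2.
    tileL : NT → Tile
    tileL (RR , r , y) = rightStone , ι k m r y
    tileL (UU , r , y) = risingBone , ι k m r y
    tileL (DD , r , y) = fallingBone , ι k m (suc (suc r)) y

    lower : Chart R k m
    Chart.cell lower     = ι k m
    Chart.cell-inj lower = ι-inj k m
    Chart.decode lower {c} p = nice-coords k m c (R⇒ p)
    Chart.encode lower {r} {y} i = R⇐ (Row.In⇒nice k m r y i)
    Chart.tile lower = tileL
    Chart.allowed lower (RR , _) = rs
    Chart.allowed lower (UU , _) = rb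
    Chart.allowed lower (DD , _) = fb
    Chart.tile-inj lower {RR , _} {RR , _} e with ι-inj k m (cong proj₂ e)
    ... | refl , refl = refl
    Chart.tile-inj lower {UU , _} {UU , _} e with ι-inj k m (cong proj₂ e)
    ... | refl , refl = refl
    Chart.tile-inj lower {DD , _} {DD , _} e with ι-inj k m (cong proj₂ e)
    ... | refl , refl = refl
    Chart.tile-inj lower {RR , _} {UU , _} ()
    Chart.tile-inj lower {RR , _} {DD , _} ()
    Chart.tile-inj lower {UU , _} {RR , _} ()
    Chart.tile-inj lower {UU , _} {DD , _} ()
    Chart.tile-inj lower {DD , _} {RR , _} ()
    Chart.tile-inj lower {DD , _} {UU , _} ()
    Chart.tile-cov lower {RR , r , y} (cov o0 refl refl) = here refl
    Chart.tile-cov lower {RR , r , y} (cov o1 refl refl) = there (there (here ι₁₁))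
      where open Cells k m r y
    Chart.tile-cov lower {RR , r , y} (cov o2 refl refl) = there (here (trans ι₂₁ (cong (_, y₀ + + 1) (sym
        (c-0 x₀)))))
      where open Cells k m r y
    Chart.tile-cov lower {UU , r , y} (cov o0 refl refl) = here refl
    Chart.tile-cov lower {UU , r , y} (cov o1 refl refl) = there (here ι₁₁)
      where open Cells k m r y
    Chart.tile-cov lower {UU , r , y} (cov o2 refl refl) = there (there (here ι₂₂))
      where open Cells k m r y
    Chart.tile-cov lower {DD , r , y} (cov o2 refl refl) = here refl
    Chart.tile-cov lower {DD , r , y} (cov o1 refl refl) = there (here (trans ι₁₀
        (sym (trans (cong (λ c → c ⊕ (+ 1 , + 0)) ι₂₀) (cong₂ _,_ (c-21 x₀) (c-0 y₀))))))
      where open Cells k m r y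
    Chart.tile-cov lower {DD , r , y} (cov o0 refl refl) = there (there (here
        (sym (trans (cong (λ c → c ⊕ (+ 2 , + 0)) ι₂₀) (cong₂ _,_ (c-22 x₀) (c-0 y₀))))))
      where open Cells k m r y
    Chart.tile-cov⁻ lower {RR , r , y} (here refl) = _ , _ , cov o0 refl refl , refl
    Chart.tile-cov⁻ lower {RR , r , y} (there (there (here refl))) = _ , _ , cov o1 refl refl , sym ι₁₁
      where open Cells k m r y
    Chart.tile-cov⁻ lower {RR , r , y} (there (here refl)) =
        _ , _ , cov o2 refl refl , sym (trans ι₂₁ (cong (_, y₀ + + 1) (sym (c-0 x₀))))
      where open Cells k m r y
    Chart.tile-cov⁻ lower {UU , r , y} (here refl) = _ , _ , cov o0 refl refl , refl
    Chart.tile-cov⁻ lower {UU , r , y} (there (here refl)) = _ , _ , cov o1 refl refl , sym ι₁₁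
      where open Cells k m r y
    Chart.tile-cov⁻ lower {UU , r , y} (there (there (here refl))) = _ , _ , cov o2 refl refl , sym ι₂₂
      where open Cells k m r y
    Chart.tile-cov⁻ lower {DD , r , y} (here refl) = _ , _ , cov o2 refl refl , refl
    Chart.tile-cov⁻ lower {DD , r , y} (there (here refl)) = _ , _ , cov o1 refl refl ,
        sym (trans ι₁₀ (sym (trans (cong (λ c → c ⊕ (+ 1 , + 0)) ι₂₀) (cong₂ _,_ (c-21 x₀) (c-0 y₀)))))
      where open Cells k m r y
    Chart.tile-cov⁻ lower {DD , r , y} (there (there (here refl))) = _ , _ , cov o0 refl refl ,
        trans (cong (λ c → c ⊕ (+ 2 , + 0)) ι₂₀) (cong₂ _,_ (c-22 x₀) (c-0 y₀))
      where open Cells k m r y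
    Chart.untile lower {_ , c} rs (p ∷ _) = let r , y , e , _ = nice-coords k m c (R⇒ p) in
      (RR , r , y) , cong (rightStone ,_) e
    Chart.untile lower {_ , c} rb (p ∷ _) = let r , y , e , _ = nice-coords k m c (R⇒ p) in
      (UU , r , y) , cong (risingBone ,_) e
    Chart.untile lower {_ , c} fb (_ ∷ _ ∷ p ∷ []) = let r , y , e , _ = nice-coords k m _ (R⇒ p) in
      (DD , r , y) , cong (fallingBone ,_) (⊕-cancel c (+ 2 , + 0) (trans e (DD0 r y)))
      where
      DD0 : ∀ r y → ι k m r y ≡ ι k m (suc (suc r)) y ⊕ (+ 2 , + 0)
      DD0 r y = sym (trans (cong (λ c → c ⊕ (+ 2 , + 0)) ι₂₀) (cong₂ _,_ (c-22 x₀) (c-0 y₀)))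
        where open Cells k m r y

  module Upper (R : Cell → Set) (k m : ℕ)
    (R⇒ : ∀ {c} → R c → Nice (side-a m k) (side-b m k) (μ-cell c))
    (R⇐ : ∀ {c} → Nice (side-a m k) (side-b m k) (μ-cell c) → R c) where

    ιU : ℕ → ℕ → Cell
    ιU r y = μ-cell (ι m k r y)

    coordsU : ∀ {c} → R c → Σ ℕ λ r → Σ ℕ λ y → c ≡ ιU r y × In m k r y
    coordsU {c} p = let r , y , e , i = nice-coords m k (μ-cell c) (R⇒ p) in
      r , y , trans (sym (μ-cell-inv c)) (cong μ-cell e) , i

    ιU-inj : ∀ {r y r′ y′} → ιU r y ≡ ιU r′ y′ → r ≡ r′ × y ≡ y′
    ιU-inj {r} {y} {r′} {y′} e = ι-inj m k (trans (sym (μ-cell-inv (ι m k r y)))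
      (trans (cong μ-cell e) (μ-cell-inv (ι m k r′ y′))))

    -- Seen from above the bones change roles, and the anchor of a right stone, the lower of its
    -- stacked cells, is its innermost cell.
    tileU : NT → Tile
    tileU (RR , r , y) = rightStone , ιU (suc (suc r)) (suc y)
    tileU (UU , r , y) = fallingBone , ιU r y
    tileU (DD , r , y) = risingBone , ιU (suc (suc r)) y

    module U (r y : ℕ) where
      open Cells m k r y
      RR0 : ιU r y ≡ ιU (suc (suc r)) (suc y) ⊕ (+ 0 , + 1)
      RR0 = sym (trans (cong (λ c → μ-cell c ⊕ (+ 0 , + 1)) ι₂₁) (cong₂ _,_ (c-0 x₀) (m-1 x₀ y₀)))
      RR1 : ιU (suc r) (suc y) ≡ ιU (suc (suc r)) (suc y) ⊕ (+ 1 , + 1)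
      RR1 = trans (cong μ-cell ι₁₁) (trans (cong (x₀ + + 1 ,_) (m11-1 x₀ y₀))
        (sym (cong (λ c → μ-cell c ⊕ (+ 1 , + 1)) ι₂₁)))
      UU1 : ιU (suc r) (suc y) ≡ ιU r y ⊕ (+ 1 , + 0)
      UU1 = trans (cong μ-cell ι₁₁) (cong (x₀ + + 1 ,_) (trans (m-11 x₀ y₀) (sym (c-0 (x₀ - y₀)))))
      UU2 : ιU (suc (suc r)) (suc (suc y)) ≡ ιU r y ⊕ (+ 2 , + 0)
      UU2 = trans (cong μ-cell ι₂₂) (cong (x₀ + + 2 ,_) (trans (m-22 x₀ y₀) (sym (c-0 (x₀ - y₀)))))
      DD0 : ιU r y ≡ ιU (suc (suc r)) y ⊕ (+ 2 , + 2)
      DD0 = sym (trans (cong (λ c → μ-cell c ⊕ (+ 2 , + 2)) ι₂₀) (cong₂ _,_ (c-22 x₀) (m-sub x₀ y₀)))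
      DD1 : ιU (suc r) y ≡ ιU (suc (suc r)) y ⊕ (+ 1 , + 1)
      DD1 = trans (cong μ-cell ι₁₀) (trans (cong₂ _,_ (sym (c-21 x₀)) (m-sub1 x₀ y₀))
        (sym (cong (λ c → μ-cell c ⊕ (+ 1 , + 1)) ι₂₀)))

    upper : Chart R m k
    Chart.cell upper     = ιU
    Chart.cell-inj upper {r} {y} {r′} {y′} = ιU-inj {r} {y} {r′} {y′}
    Chart.decode upper   = coordsU
    Chart.encode upper {r} {y} i = R⇐ (subst (Nice _ _) (sym (μ-cell-inv (ι m k r y))) (Row.In⇒nice m k r y i))
    Chart.tile upper = tileU
    Chart.allowed upper (RR , _) = rs
    Chart.allowed upper (UU , _) = fb
    Chart.allowed upper (DD , _) = rb
    Chart.tile-inj upper {RR , r , y} {RR , r′ , y′} e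
      with ιU-inj {suc (suc r)} {suc y} {suc (suc r′)} {suc y′} (cong proj₂ e)
    ... | refl , refl = refl
    Chart.tile-inj upper {UU , r , y} {UU , r′ , y′} e with ιU-inj {r} {y} {r′} {y′} (cong proj₂ e)
    ... | refl , refl = refl
    Chart.tile-inj upper {DD , r , y} {DD , r′ , y′} e
      with ιU-inj {suc (suc r)} {y} {suc (suc r′)} {y′} (cong proj₂ e)
    ... | refl , refl = refl
    Chart.tile-inj upper {RR , _} {UU , _} ()
    Chart.tile-inj upper {RR , _} {DD , _} ()
    Chart.tile-inj upper {UU , _} {RR , _} ()
    Chart.tile-inj upper {UU , _} {DD , _} ()
    Chart.tile-inj upper {DD , _} {RR , _} ()
    Chart.tile-inj upper {DD , _} {UU , _} ()
    Chart.tile-cov upper {RR , r , y} (cov o0 refl refl) = there (here (U.RR0 r y))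
    Chart.tile-cov upper {RR , r , y} (cov o1 refl refl) = there (there (here (U.RR1 r y)))
    Chart.tile-cov upper {RR , r , y} (cov o2 refl refl) = here refl
    Chart.tile-cov upper {UU , r , y} (cov o0 refl refl) = here refl
    Chart.tile-cov upper {UU , r , y} (cov o1 refl refl) = there (here (U.UU1 r y))
    Chart.tile-cov upper {UU , r , y} (cov o2 refl refl) = there (there (here (U.UU2 r y)))
    Chart.tile-cov upper {DD , r , y} (cov o0 refl refl) = there (there (here (U.DD0 r y)))
    Chart.tile-cov upper {DD , r , y} (cov o1 refl refl) = there (here (U.DD1 r y))
    Chart.tile-cov upper {DD , r , y} (cov o2 refl refl) = here refl
    Chart.tile-cov⁻ upper {RR , r , y} (there (here refl)) = _ , _ , cov o0 refl refl , sym (U.RR0 r y)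
    Chart.tile-cov⁻ upper {RR , r , y} (there (there (here refl))) = _ , _ , cov o1 refl refl , sym (U.RR1 r y)
    Chart.tile-cov⁻ upper {RR , r , y} (here refl) = _ , _ , cov o2 refl refl , refl
    Chart.tile-cov⁻ upper {UU , r , y} (here refl) = _ , _ , cov o0 refl refl , refl
    Chart.tile-cov⁻ upper {UU , r , y} (there (here refl)) = _ , _ , cov o1 refl refl , sym (U.UU1 r y)
    Chart.tile-cov⁻ upper {UU , r , y} (there (there (here refl))) = _ , _ , cov o2 refl refl , sym (U.UU2 r y)
    Chart.tile-cov⁻ upper {DD , r , y} (there (there (here refl))) = _ , _ , cov o0 refl refl , sym (U.DD0 r y)
    Chart.tile-cov⁻ upper {DD , r , y} (there (here refl)) = _ , _ , cov o1 refl refl , sym (U.DD1 r y)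
    Chart.tile-cov⁻ upper {DD , r , y} (here refl) = _ , _ , cov o2 refl refl , refl
    Chart.untile upper {_ , c} rs (_ ∷ p ∷ _) = let r , y , e , _ = coordsU p in
      (RR , r , y) , cong (rightStone ,_) (⊕-cancel c (+ 0 , + 1) (trans e (U.RR0 r y)))
    Chart.untile upper {_ , c} fb (p ∷ _) = let r , y , e , _ = coordsU p in
      (UU , r , y) , cong (fallingBone ,_) e
    Chart.untile upper {_ , c} rb (_ ∷ _ ∷ p ∷ []) = let r , y , e , _ = coordsU p in
      (DD , r , y) , cong (risingBone ,_) (⊕-cancel c (+ 2 , + 2) (trans e (U.DD0 r y)))

    -- The row numbers are the height above the lower side and the depth below the upper one, which
    -- add up to a + b - 2 = 3k + 3m.
    rows-sum : ∀ {r y r′ y′} → ι k m r y ≡ ιU r′ y′ → r ℕ.+ r′ ≡ tri k ℕ.+ tri m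
    rows-sum {r} {y} {r′} {y′} e = ℤP.+-injective (trans (ℤP.pos-+ r r′)
      (trans (alg (+ k) (+ m) (+ r) (+ y) (+ r′) (+ y′))
        (trans (cong₂ (λ s t → (+ 3 * + k + + 3 * + m) + (s - X) + + 2 * (Y - t)) (sym (cong proj₁ e)) (sym
            (cong proj₂ e)))
          (trans (alg₂ _ X Y)
            (sym (trans (ℤP.pos-+ (tri k) (tri m)) (cong₂ _+_ (pos-tri k) (pos-tri m))))))))
      where
      X = + 2 * + y - + k - + r
      Y = + y - (+ m + + k)
      alg : ∀ k m r y r′ y′ → r + r′ ≡ (+ 3 * k + + 3 * m) + ((+ 2 * y′ - m - r′) - (+ 2 * y - k - r))
        + + 2 * ((y - (m + k)) - ((+ 2 * y′ - m - r′) - (y′ - (k + m))))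
      alg = solve-∀
      alg₂ : ∀ s X Y → s + (X - X) + + 2 * (Y - Y) ≡ s
      alg₂ = solve-∀

    centre : ∀ j → ι k m (tri m) (m ℕ.+ j) ≡ ιU (tri k) (k ℕ.+ j)
    centre j = cong₂ _,_
      (trans (cong₂ (λ s t → + 2 * s - + k - t) (ℤP.pos-+ m j) (pos-tri m))
        (trans (alg₁ (+ k) (+ m) (+ j)) (sym X≡)))
      (trans (cong (_- (+ m + + k)) (ℤP.pos-+ m j)) (trans (alg₂ (+ k) (+ m) (+ j))
        (sym (cong₂ _-_ X≡ (cong (_- (+ k + + m)) (ℤP.pos-+ k j))))))
      where
      X≡ : + 2 * + (k ℕ.+ j) - + m - + tri k ≡ + 2 * (+ k + + j) - + m - + 3 * + k
      X≡ = cong₂ (λ s t → + 2 * s - + m - t) (ℤP.pos-+ k j) (pos-tri k)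
      alg₁ : ∀ k m j → + 2 * (m + j) - k - + 3 * m ≡ + 2 * (k + j) - m - + 3 * k
      alg₁ = solve-∀
      alg₂ : ∀ k m j → (m + j) - (m + k) ≡ (+ 2 * (k + j) - m - + 3 * k) - ((k + j) - (k + m))
      alg₂ = solve-∀

-- Gluing the halves along the central row.

module Tilings where

  open import Defs
  open Configurations hiding (go)
  open HalfBenzel
  open Charts
  open import Data.Nat using (ℕ; zero; suc; _+_; _≤_; _<_; s≤s)
  open import Data.Nat.Properties
  open import Data.Bool using (Bool; true; false; not)
  open import Data.Sum.Properties using (inj₁-injective; inj₂-injective)
  open import Data.Fin using (zero; suc)
  open import Data.List.Relation.Unary.Unique.Propositional using (Unique)
  open import Relation.Binary.Definitions using (tri<; tri≈; tri>)

  addrs : ℕ → ℕ → List (ℕ × ℕ)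
  addrs L B = concatMap (λ q → map (q ,_) (upTo (suc (q + B)))) (upTo L)

  ∈-addrs⁺ : ∀ {L B q p} → q < L → p < suc (q + B) → (q , p) ∈ addrs L B
  ∈-addrs⁺ {L} {B} {q} q<L p< = ∈-concatMap⁺ (λ q → map (q ,_) (upTo (suc (q + B))))
    (Any.map (λ { refl → ∈-map⁺ (q ,_) (∈-upTo⁺ p<) }) (∈-upTo⁺ q<L))

  ∈-addrs⁻ : ∀ {L B q p} → (q , p) ∈ addrs L B → q < L × p < suc (q + B)
  ∈-addrs⁻ {L} {B} i with find (∈-concatMap⁻ (λ q → map (q ,_) (upTo (suc (q + B)))) {xs = upTo L} i)
  ... | q , q∈ , j with ∈-map⁻ (q ,_) j
  ...   | p , p∈ , refl = ∈-upTo⁻ q∈ , ∈-upTo⁻ p∈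

  addrs-unique : ∀ L B → Unique (addrs L B)
  addrs-unique L B = concatMap-AllPairs (λ q → map (q ,_) (upTo (suc (q + B))))
    (λ q → UP.map⁺ (λ { refl → refl }) (UP.upTo⁺ (suc (q + B)))) distinct (UP.upTo⁺ L)
    where
    distinct : ∀ {q q′} → q ≢ q′ → ∀ {u v : ℕ × ℕ} → u ∈ map (q ,_) (upTo (suc (q + B))) →
      v ∈ map (q′ ,_) (upTo (suc (q′ + B))) → u ≢ v
    distinct {q} {q′} q≢q′ u∈ v∈ refl with ∈-map⁻ (q ,_) u∈ | ∈-map⁻ (q′ ,_) v∈
    ... | _ , _ , refl | _ , _ , refl = q≢q′ refl

  Addr : Set
  Addr = (ℕ × ℕ) ⊎ (ℕ × ℕ)

  -- `IsTiling` asks for equal positions in the list, which is more than equal tiles; positions are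
  -- controlled through a duplicate-free list of addresses.
  index-unique : ∀ {X Y : Set} (f : X → Y) (Q : Y → Set) {xs} → Unique xs →
    (∀ {a b} → a ∈ xs → b ∈ xs → Q (f a) → Q (f b) → a ≡ b) →
    ∀ i j → Q (lookup (map f xs) i) → Q (lookup (map f xs) j) → i ≡ j
  index-unique f Q (x∉ ∷ u) e zero    zero    qi qj = refl
  index-unique f Q (_∷_ {x} {xs} x∉ u) e zero (suc j) qi qj with ∈-map⁻ f (∈-lookup {xs = map f xs} j)
  ... | b , b∈ , eq = ⊥-elim (All.lookup x∉ b∈ (e (here refl) (there b∈) qi (subst Q eq qj)))
  index-unique f Q (_∷_ {x} {xs} x∉ u) e (suc i) zero qi qj with ∈-map⁻ f (∈-lookup {xs = map f xs} i)
  ... | b , b∈ , eq = ⊥-elim (All.lookup x∉ b∈ (e (here refl) (there b∈) qj (subst Q eq qi)))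
  index-unique f Q (x∉ ∷ u) e (suc i) (suc j) qi qj =
    cong suc (index-unique f Q u (λ a∈ b∈ → e (there a∈) (there b∈)) i j qi qj)

  AllPairs-∈ : ∀ {X : Set} {P Q : X → X → Set} {xs} → (∀ {x y} → x ∈ xs → y ∈ xs → P x y → Q x y) →
    AllPairs P xs → AllPairs Q xs
  AllPairs-∈ e []        = []
  AllPairs-∈ e (px ∷ ps) = All.tabulate (λ y∈ → e (here refl) (there y∈) (All.lookup px y∈)) ∷
    AllPairs-∈ (λ x∈ y∈ → e (there x∈) (there y∈)) ps

  tl-inj : ∀ {q p c c′} → tl q p c ≡ tl q p c′ → c ≡ c′
  tl-inj {c = in0} {in0} e = refl
  tl-inj {c = in1} {in1} e = refl
  tl-inj {c = out} {out} e = refl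
  tl-inj {c = in0} {in1} ()
  tl-inj {c = in0} {out} ()
  tl-inj {c = in1} {in0} ()
  tl-inj {c = out} {in0} ()
  tl-inj {q} {c = in1} {out} e = ⊥-elim (1+n≢n (cong (proj₁ ∘ proj₂) e))
  tl-inj {q} {c = out} {in1} e = ⊥-elim (1+n≢n (sym (cong (proj₁ ∘ proj₂) e)))

  module Glue (R : Cell → Set) (k m : ℕ) (lo : Chart R k m) (up : Chart R m k)
    (rows-sum : ∀ {r y r′ y′} → Chart.cell lo r y ≡ Chart.cell up r′ y′ → r + r′ ≡ tri k + tri m)
    (centre : ∀ j → Chart.cell lo (tri m) (m + j) ≡ Chart.cell up (tri k) (k + j)) where

    private
      module lo = Chart lo
      module up = Chart up

    Tiles : List Tile → Set
    Tiles = IsTiling RightStonesAndBones R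

    tiles-unique : ∀ {T} → Tiles T → ∀ {t t′ c} → t ∈ T → t′ ∈ T → R c → c ∈ tileCells t → c ∈ tileCells t′ → t ≡ t′
    tiles-unique {T} (_ , cover) {t} {t′} {c} t∈ t′∈ Rc c∈ c∈′ =
      trans (AnyP.lookup-index t∈) (trans (cong (lookup T) same) (sym (AnyP.lookup-index t′∈)))
      where
      same : Any.index t∈ ≡ Any.index t′∈
      same = proj₂ (cover c Rc) _ _ (subst (λ t → c ∈ tileCells t) (AnyP.lookup-index t∈) c∈)
                                  (subst (λ t → c ∈ tileCells t) (AnyP.lookup-index t′∈) c∈′)

    module _ {T} (tiling : Tiles T) where
      module _ {B L} (ch : Chart R B L) where
        open Chart ch
        chart-tiling : IsNT B L (λ t → tile t ∈ T)
        IsNT.inside chart-tiling t∈ c with decode (All.lookup (proj₂ (All.lookup (proj₁ tiling) t∈)) (tile-cov c))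
        ... | r , y , e , i with cell-inj e
        ...   | refl , refl = i
        IsNT.cover chart-tiling {a} {b} i with proj₁ (proj₂ tiling (cell a b) (encode i))
        ... | j , c∈ with All.lookup (proj₁ tiling) (∈-lookup {xs = T} j)
        ...   | ok , inR with untile ok inR
        ...     | t , e with tile-cov⁻ {t} (subst (λ t → cell a b ∈ tileCells t) e c∈)
        ...       | a′ , b′ , c , e′ with cell-inj e′
        ...         | refl , refl = t , subst (_∈ T) e (∈-lookup {xs = T} j) , c
        IsNT.uniq chart-tiling {t} {t′} t∈ t′∈ c c′ = tile-inj (tiles-unique tiling t∈ t′∈
          (All.lookup (proj₂ (All.lookup (proj₁ tiling) t∈)) (tile-cov c)) (tile-cov c) (tile-cov c′))

      module FL = Forced (chart-tiling lo)
      module FU = Forced (chart-tiling up)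

      private
        same-cell : ∀ {u l j} → up.tile u ∈ T → lo.tile l ∈ T → j < m + k → Cov u (tri k) (k + j) →
            Cov l (tri m) (m + j) →
          up.tile u ≡ lo.tile l
        same-cell {u} {l} {j} u∈ l∈ j< cu cl = tiles-unique tiling u∈ l∈
          (up.encode {tri k} {k + j} (In-sg ≤-refl (subst (j <_) (+-comm m k) j<)))
          (up.tile-cov cu) (subst (_∈ tileCells (lo.tile l)) (centre j) (lo.tile-cov cl))

      -- If a central cell were reached from both sides, one tile would span five rows. If from
      -- neither, it would be the middle cell of its tile, which `no-row-below` forbids.
      opposite : ∀ j → j < k + m → FU.s k j ≡ not (FL.s m j)
      opposite j j< with FU.s k j in eu | FL.s m j in el
      ... | true  | false = refl
      ... | false | true  = refl
      ... | true  | true  = ⊥-elim (both (FU.s-cover ≤-refl eu j<) (FL.s-cover ≤-refl el (subst (j <_)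
          (+-comm k m) j<)))
        where
        both : (Σ NT λ t → up.tile t ∈ T × Cov t (tri k) (k + j) × Σ ℕ λ q → k ≡ suc q × Σ ℕ λ b →
            Cov t (suc (tri q)) b) →
               (Σ NT λ t → lo.tile t ∈ T × Cov t (tri m) (m + j) × Σ ℕ λ q → m ≡ suc q × Σ ℕ λ b →
                   Cov t (suc (tri q)) b) → ⊥
        both (u , u∈ , cu , q , refl , b , cu′) (l , l∈ , cl , q′ , refl , b′ , cl′)
          with up.tile-cov⁻ {u} (subst (λ t → lo.cell (suc (tri q′)) b′ ∈ tileCells t)
                 (sym (same-cell {u} {l} u∈ l∈ (subst (j <_) (+-comm k m) j<) cu cl)) (lo.tile-cov cl′))
        ... | a , b₁ , c₁ , e = <-irrefl (rows-sum e) (≤-<-trans (+-monoʳ-≤ (suc (tri q′)) (row-gap c₁ cu′))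
          (subst (suc (tri q′) + tri (suc q) <_) (+-comm (tri (suc q′)) (tri (suc q)))
            (+-monoˡ-< (tri (suc q)) (s≤s (s≤s (n≤1+n (tri q′)))))))
      ... | false | false = ⊥-elim (neither (IsNT.cover (chart-tiling up) (In-sg ≤-refl j<))
                                            (IsNT.cover (chart-tiling lo) (In-sg ≤-refl j<′)))
        where
        j<′ = subst (j <_) (+-comm k m) j<
        neither : (Σ NT λ t → up.tile t ∈ T × Cov t (tri k) (k + j)) → (Σ NT λ t →
            lo.tile t ∈ T × Cov t (tri m) (m + j)) → ⊥
        neither (u , u∈ , cu) (l , l∈ , cl) with FU.s-single ≤-refl j< u∈ cu | FL.s-single ≤-refl j<′ l∈ cl
        ... | inj₁ e | _ = false≢true (trans (sym eu) e)
        ... | _ | inj₁ e = false≢true (trans (sym el) e)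
        ... | inj₂ (y , du) | inj₂ (y′ , dl)
          with lo.tile-cov⁻ {l} (subst (up.cell (suc (tri k)) y ∈_)
                 (cong tileCells (same-cell {u} {l} u∈ l∈ j<′ cu cl)) (up.tile-cov du))
        ... | a , b , c , e = below m refl (+-cancelʳ-≡ (tri k) (suc a) (tri m)
                (trans (sym (+-suc a (tri k))) (trans (rows-sum (sym e)) (+-comm (tri k) (tri m)))))
          where
          below : ∀ m′ → m ≡ m′ → suc a ≡ tri m → ⊥
          below zero    refl ()
          below (suc q) refl refl = FL.no-row-below q ≤-refl l∈ c dl

      glued : Glued k m FU.f FL.f
      glued = FU.s , FL.s , FU.isHalf , FL.isHalf , λ {j} → opposite j

    addresses : List Addr
    addresses = map inj₁ (addrs k m) ++ map inj₂ (addrs m k)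

    Valid : Addr → Set
    Valid (inj₁ (q , p)) = q < k × p < suc (q + m)
    Valid (inj₂ (q , p)) = q < m × p < suc (q + k)

    ∈-addresses⁺ : ∀ {a} → Valid a → a ∈ addresses
    ∈-addresses⁺ {inj₁ (q , p)} (q< , p<) = ∈-++⁺ˡ (∈-map⁺ inj₁ (∈-addrs⁺ q< p<))
    ∈-addresses⁺ {inj₂ (q , p)} (q< , p<) = ∈-++⁺ʳ (map inj₁ (addrs k m)) (∈-map⁺ inj₂ (∈-addrs⁺ q< p<))

    ∈-addresses⁻ : ∀ {a} → a ∈ addresses → Valid a
    ∈-addresses⁻ a∈ with ∈-++⁻ (map inj₁ (addrs k m)) a∈
    ... | inj₁ i with ∈-map⁻ inj₁ i
    ...   | _ , j , refl = ∈-addrs⁻ j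
    ∈-addresses⁻ a∈ | inj₂ i with ∈-map⁻ inj₂ i
    ...   | _ , j , refl = ∈-addrs⁻ j

    addresses-unique : Unique addresses
    addresses-unique = APP.++⁺ (UP.map⁺ inj₁-injective (addrs-unique k m)) (UP.map⁺ inj₂-injective (addrs-unique m k))
      (All.tabulate λ u∈ → All.tabulate λ v∈ → distinct u∈ v∈)
      where
      distinct : ∀ {u v : Addr} → u ∈ map inj₁ (addrs k m) → v ∈ map inj₂ (addrs m k) → u ≢ v
      distinct u∈ v∈ with ∈-map⁻ inj₁ u∈ | ∈-map⁻ inj₂ v∈
      ... | _ , _ , refl | _ , _ , refl = λ ()

    tileAt : (f g : ℕ → ℕ → Ch) → Addr → Tile
    tileAt f g (inj₁ (q , p)) = up.tile (tl q p (f q p))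
    tileAt f g (inj₂ (q , p)) = lo.tile (tl q p (g q p))

    tilesOf : (f g : ℕ → ℕ → Ch) → List Tile
    tilesOf f g = map (tileAt f g) addresses

    ∈-tilesOf : ∀ {f g} a → Valid a → tileAt f g a ∈ tilesOf f g
    ∈-tilesOf {f} {g} a v = ∈-map⁺ (tileAt f g) (∈-addresses⁺ {a} v)

    module _ {f g} (G : Glued k m f g) where
      private
        s t : ℕ → ℕ → Bool
        s = proj₁ G
        t = proj₁ (proj₂ G)
        module BU = Built (proj₁ (proj₂ (proj₂ G)))
        module BL = Built (proj₁ (proj₂ (proj₂ (proj₂ G))))
        glue : ∀ {j} → j < k + m → s k j ≡ not (t m j)
        glue = proj₂ (proj₂ (proj₂ (proj₂ G)))

      -- The two row numbers of a common cell add up to 3k + 3m and neither exceeds its half, so the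
      -- cell is central; there both halves would occupy it, against complementarity.
      apart : ∀ {q p q′ p′ c} → Valid (inj₁ (q , p)) → Valid (inj₂ (q′ , p′)) →
        c ∈ tileCells (tileAt f g (inj₁ (q , p))) → c ∈ tileCells (tileAt f g (inj₂ (q′ , p′))) → ⊥
      apart {q} {p} {q′} {p′} (q< , p<) (q′< , p′<) c∈ c∈′
        with up.tile-cov⁻ {tl q p (f q p)} c∈ | lo.tile-cov⁻ {tl q′ p′ (g q′ p′)} c∈′
      ... | r , y , c , e | r′ , y′ , c′ , e′ = conflict (rows-sum (trans (sym e′) e)) (BU.owns q< p< c)
          (BL.owns q′< p′< c′) (trans (sym e′) e)
        where
        conflict : ∀ {r y r′ y′} → r′ + r ≡ tri k + tri m → BU.Own q p r y → BL.Own q′ p′ r′ y′ →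
            lo.cell r′ y′ ≡ up.cell r y → ⊥
        conflict {r} {y} {r′} {y′} sum o o′ e = at-centre r≡ r′≡ o o′ e
          where
          r≡ : r ≡ tri k
          r≡ = ≤-antisym (BU.own-row q< o) (+-cancelʳ-≤ (tri m) (tri k) r
            (≤-trans (≤-reflexive (sym sum)) (≤-trans (+-monoˡ-≤ r (BL.own-row q′< o′)) (≤-reflexive (+-comm
                (tri m) r)))))
          r′≡ : r′ ≡ tri m
          r′≡ = +-cancelʳ-≡ (tri k) r′ (tri m) (trans (cong (r′ +_) (sym r≡)) (trans sum (+-comm (tri k) (tri m))))
          at-centre : ∀ {r y r′ y′} → r ≡ tri k → r′ ≡ tri m → BU.Own q p r y → BL.Own q′ p′ r′ y′ →
              lo.cell r′ y′ ≡ up.cell r y → ⊥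
          at-centre refl refl o o′ e with BU.own-last q< o | BL.own-last q′< o′
          ... | j , refl , sj , j< | j′ , refl , tj , _ with +-cancelˡ-≡ m j′ j (proj₂ (lo.cell-inj (trans e
              (sym (centre j)))))
          ...   | refl = false≢true (sym (trans (sym sj) (trans (glue j<) (cong not tj))))

      owner-unique : ∀ {c} a b → Valid a → Valid b → c ∈ tileCells (tileAt f g a) →
          c ∈ tileCells (tileAt f g b) → a ≡ b
      owner-unique (inj₁ (q , p)) (inj₁ (q′ , p′)) (q< , p<) (q′< , p′<) c∈ c∈′
        with up.tile-cov⁻ {tl q p (f q p)} c∈ | up.tile-cov⁻ {tl q′ p′ (f q′ p′)} c∈′
      ... | r , y , c , refl | r′ , y′ , c′ , e with up.cell-inj {r} {y} {r′} {y′} e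
      ...   | refl , refl with BU.own-unique (BU.owns q< p< c) (BU.owns q′< p′< c′)
      ...     | refl , refl = refl
      owner-unique (inj₂ (q , p)) (inj₂ (q′ , p′)) (q< , p<) (q′< , p′<) c∈ c∈′
        with lo.tile-cov⁻ {tl q p (g q p)} c∈ | lo.tile-cov⁻ {tl q′ p′ (g q′ p′)} c∈′
      ... | r , y , c , refl | r′ , y′ , c′ , e with lo.cell-inj {r} {y} {r′} {y′} e
      ...   | refl , refl with BL.own-unique (BL.owns q< p< c) (BL.owns q′< p′< c′)
      ...     | refl , refl = refl
      owner-unique (inj₁ (q , p)) (inj₂ (q′ , p′)) v v′ c∈ c∈′ = ⊥-elim (apart {q} {p} {q′} {p′} v v′ c∈ c∈′)
      owner-unique (inj₂ (q , p)) (inj₁ (q′ , p′)) v v′ c∈ c∈′ = ⊥-elim (apart {q′} {p′} {q} {p} v′ v c∈′ c∈)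

      private
        Owned : Cell → Set
        Owned c = Σ Addr λ a → Valid a × c ∈ tileCells (tileAt f g a)

        from-U : ∀ {c r y} → c ≡ up.cell r y → BU.Covered r y → Owned c
        from-U refl (q , p , q< , p< , c) = inj₁ (q , p) , (q< , p<) , up.tile-cov c

        from-L : ∀ {c r y} → c ≡ lo.cell r y → BL.Covered r y → Owned c
        from-L refl (q , p , q< , p< , c) = inj₂ (q , p) , (q< , p<) , lo.tile-cov c

      owner : ∀ {c} → R c → Owned c
      owner {c} Rc with lo.decode Rc
      ... | r , y , e , i with <-cmp r (tri m)
      ...   | tri< r< _ _ = from-L e (BL.covered i r<)
      ...   | tri> _ _ r> with up.decode Rc
      ...     | r′ , y′ , e′ , i′ = from-U e′ (BU.covered i′ (+-cancelʳ-< (tri m) r′ (tri k)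
                  (≤-trans (+-monoʳ-< r′ r>) (≤-reflexive (trans (+-comm r′ r) (rows-sum (trans (sym e) e′)))))))
      -- On the central row the cell belongs to whichever half occupies its site.
      owner {c} Rc | r , y , e , i | tri≈ _ refl _ with In-sg⁻ i
      ...     | j , refl , j< with t m j in et
      ...       | true  = from-L e (BL.single-true ≤-refl j< et)
      ...       | false = from-U (trans e (centre j)) (BU.single-true ≤-refl j<′ (trans (glue j<′) (cong not et)))
        where
        j<′ = subst (j <_) (+-comm m k) j<

      private
        okAt : ∀ a → Valid a → RightStonesAndBones (proj₁ (tileAt f g a)) × All R (tileCells (tileAt f g a))
        okAt (inj₁ (q , p)) (q< , p<) = up.allowed _ , All.tabulate λ c∈ → cellU (up.tile-cov⁻ {tl q p (f q p)} c∈)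
          where
          cellU : ∀ {c} → (Σ ℕ λ r → Σ ℕ λ y → Cov (tl q p (f q p)) r y × c ≡ up.cell r y) → R c
          cellU (r , y , c , refl) = up.encode (BU.own-In q< p< (BU.owns q< p< c))
        okAt (inj₂ (q , p)) (q< , p<) = lo.allowed _ , All.tabulate λ c∈ → cellL (lo.tile-cov⁻ {tl q p (g q p)} c∈)
          where
          cellL : ∀ {c} → (Σ ℕ λ r → Σ ℕ λ y → Cov (tl q p (g q p)) r y × c ≡ lo.cell r y) → R c
          cellL (r , y , c , refl) = lo.encode (BL.own-In q< p< (BL.owns q< p< c))

      tilesOf-tiling : Tiles (tilesOf f g)
      tilesOf-tiling = AllP.map⁺ (All.tabulate λ {a} a∈ → okAt a (∈-addresses⁻ a∈)) , λ c Rc →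
        exists (owner Rc) ,
        index-unique (tileAt f g) (λ t → c ∈ tileCells t) addresses-unique
          (λ {a} {b} a∈ b∈ → owner-unique a b (∈-addresses⁻ a∈) (∈-addresses⁻ b∈))
        where
        exists : ∀ {c} → Owned c → ∃ λ i → c ∈ tileCells (lookup (tilesOf f g) i)
        exists {c} (a , v , c∈) = Any.index a∈ , subst (λ t → c ∈ tileCells t) (AnyP.lookup-index a∈) c∈
          where a∈ = ∈-tilesOf {f} {g} a v

      pair-U : ∀ {q p} → q < k → p < suc (q + m) → Cov (tl q p (f q p)) (suc (tri q)) (q + p)
      pair-U q< p< = proj₁ (BU.pair-cov q< p<)

      pair-L : ∀ {q p} → q < m → p < suc (q + k) → Cov (tl q p (g q p)) (suc (tri q)) (q + p)
      pair-L q< p< = proj₁ (BL.pair-cov q< p<)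

    -- In either tiling the first cell of a pair is covered by the tile of that pair, and this tile
    -- reveals the choice.
    same-codes : ∀ {f g f′ g′} → Glued k m f g → Glued k m f′ g′ → SameTiling (tilesOf f g) (tilesOf f′ g′) →
      (∀ {q p} → q < k → p < suc (q + m) → f q p ≡ f′ q p) × (∀ {q p} → q < m → p < suc (q + k) → g q p ≡ g′ q p)
    same-codes {f} {g} {f′} {g′} G G′ same =
      (λ {q} {p} q< p< → tl-inj (up.tile-inj (tiles-unique (tilesOf-tiling G′)
        (proj₁ (same _) (∈-tilesOf {f} {g} (inj₁ (q , p)) (q< , p<))) (∈-tilesOf {f′} {g′} (inj₁ (q , p)) (q< , p<))
        (up.encode (In-p1 q< p<)) (up.tile-cov (pair-U G q< p<)) (up.tile-cov (pair-U G′ q< p<))))) ,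
      (λ {q} {p} q< p< → tl-inj (lo.tile-inj (tiles-unique (tilesOf-tiling G′)
        (proj₁ (same _) (∈-tilesOf {f} {g} (inj₂ (q , p)) (q< , p<))) (∈-tilesOf {f′} {g′} (inj₂ (q , p)) (q< , p<))
        (lo.encode (In-p1 q< p<)) (lo.tile-cov (pair-L G q< p<)) (lo.tile-cov (pair-L G′ q< p<)))))

    tilesOf-cong : ∀ {f g f′ g′} → (∀ {q p} → q < k → p < suc (q + m) → f q p ≡ f′ q p) →
      (∀ {q p} → q < m → p < suc (q + k) → g q p ≡ g′ q p) → tilesOf f g ≡ tilesOf f′ g′
    tilesOf-cong {f} {g} {f′} {g′} e e′ = go addresses ∈-addresses⁻
      where
      at≡ : ∀ a → Valid a → tileAt f g a ≡ tileAt f′ g′ a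
      at≡ (inj₁ (q , p)) (q< , p<) = cong (λ c → up.tile (tl q p c)) (e q< p<)
      at≡ (inj₂ (q , p)) (q< , p<) = cong (λ c → lo.tile (tl q p c)) (e′ q< p<)
      go : ∀ xs → (∀ {a} → a ∈ xs → Valid a) → map (tileAt f g) xs ≡ map (tileAt f′ g′) xs
      go []       v = refl
      go (a ∷ xs) v = cong₂ _∷_ (at≡ a (v (here refl))) (go xs (v ∘ there))

    -- A tiling is recovered from its choice functions: each of its tiles has its outermost row
    -- inside the lower half, or, seen from above, inside the upper half.
    recover : ∀ {T} (τ : Tiles T) → SameTiling T (tilesOf (FU.f τ) (FL.f τ))
    recover {T} τ t = fwd , bwd
      where
      fwd : t ∈ T → t ∈ tilesOf (FU.f τ) (FL.f τ)
      fwd t∈ with All.lookup (proj₁ τ) t∈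
      ... | ok , inR with lo.untile ok inR | up.untile ok inR
      ...   | l , refl | u , eu = split (<-≤-connex (proj₁ (proj₂ l)) (tri m))
        where
        goal = lo.tile l ∈ tilesOf (FU.f τ) (FL.f τ)
        foundL : (Σ ℕ λ q → Σ ℕ λ p → q < m × p < suc (q + k) × l ≡ tl q p (FL.f τ q p)) → goal
        foundL (q , p , q< , p< , refl) = ∈-tilesOf {FU.f τ} {FL.f τ} (inj₂ (q , p)) (q< , p<)
        foundU : (Σ ℕ λ q → Σ ℕ λ p → q < k × p < suc (q + m) × u ≡ tl q p (FU.f τ q p)) → goal
        foundU (q , p , q< , p< , refl) =
          subst (_∈ tilesOf (FU.f τ) (FL.f τ)) (sym eu) (∈-tilesOf {FU.f τ} {FL.f τ} (inj₁ (q , p)) (q< , p<))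
        -- The outermost cell of the tile as seen from below is its innermost one as seen from above.
        below : (Σ ℕ λ r → Σ ℕ λ y → Cov l r y × up.cell (2 + proj₁ (proj₂ u)) _ ≡ lo.cell r y) →
          tri m ≤ proj₁ (proj₂ l) → proj₁ (proj₂ u) < tri k
        below (r , y , c , e) m≤ = +-cancelʳ-< (tri m) (proj₁ (proj₂ u)) (tri k)
          (≤-trans (s≤s (≤-trans (+-monoʳ-≤ (proj₁ (proj₂ u)) (≤-trans m≤ (row-≥ c))) (≤-reflexive (+-comm
              (proj₁ (proj₂ u)) r))))
            (≤-trans (n≤1+n _) (≤-reflexive (trans (sym (trans (+-suc r _) (cong suc (+-suc r _)))) (rows-sum
                (sym e))))))
        split : (proj₁ (proj₂ l) < tri m) ⊎ (tri m ≤ proj₁ (proj₂ l)) → goal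
        split (inj₁ r<) = foundL (FL.all-tl τ {l} t∈ r<)
        split (inj₂ m≤) = foundU (FU.all-tl τ {u} (subst (_∈ T) eu t∈)
          (below (lo.tile-cov⁻ {l} (subst (up.cell (2 + proj₁ (proj₂ u)) _ ∈_) (cong tileCells (sym eu))
              (up.tile-cov (cov o2 refl refl)))) m≤))
      bwd : t ∈ tilesOf (FU.f τ) (FL.f τ) → t ∈ T
      bwd t∈ with ∈-map⁻ (tileAt (FU.f τ) (FL.f τ)) t∈
      ... | inj₁ (q , p) , a∈ , refl = proj₁ (FU.P-f τ (proj₁ (∈-addresses⁻ a∈)) (proj₂ (∈-addresses⁻ a∈)))
      ... | inj₂ (q , p) , a∈ , refl = proj₁ (FL.P-f τ (proj₁ (∈-addresses⁻ a∈)) (proj₂ (∈-addresses⁻ a∈)))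

-- The number of tilings of the benzel.

open import Defs
open Configurations hiding (go)
open Remainders using (dbl; μ)
open Evaluation using (count-formula)
open HalfBenzel
open Hexagon
open Charts
open Tilings
open import Data.Nat using (ℕ; zero; suc; _+_; _*_; _∸_; _/_; _%_; _≤_; _<_; s≤s; _!)
open import Data.Nat.Properties
open import Data.Nat.DivMod using ([m+kn]%n≡m%n; m*n/n≡m; m≡m%n+[m/n]*n; m%n<n)
open import Data.Nat.Tactic.RingSolver using (solve-∀)
open import Data.Integer as ℤ using (ℤ; +_)
open ≡-Reasoning

module Count (R : Cell → Set) (k m : ℕ) (lo : Chart R k m) (up : Chart R m k)
  (rows-sum : ∀ {r y r′ y′} → Chart.cell lo r y ≡ Chart.cell up r′ y′ → r + r′ ≡ tri k + tri m)
  (centre : ∀ j → Chart.cell lo (tri m) (m + j) ≡ Chart.cell up (tri k) (k + j)) where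

  open Glue R k m lo up rows-sum centre

  config-tiles : Full k m → List Tile
  config-tiles x = tilesOf (get (proj₁ (codes x))) (get (proj₂ (codes x)))

  hasNTilings : HasNTilings RightStonesAndBones R (length (configs k m))
  hasNTilings = map config-tiles (configs k m) , LP.length-map config-tiles (configs k m) ,
    AllP.map⁺ (All.tabulate λ x∈ → tilesOf-tiling (configs-sound k m x∈)) ,
    complete ,
    APP.map⁺ (AllPairs-∈ (λ x∈ y∈ x≢y same → x≢y (codes≡ x∈ y∈ same)) (configs-distinct k m))
    where
    complete : ∀ T → Tiles T → Any (SameTiling T) (map config-tiles (configs k m))
    complete T τ with configs-complete k m (glued τ)
    ... | x , x∈ , e = AnyP.map⁺ (Any.map (λ { refl → subst (SameTiling T) tiles≡ (recover τ) }) x∈)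
      where
      tiles≡ : tilesOf (FU.f τ) (FL.f τ) ≡ config-tiles x
      tiles≡ = tilesOf-cong
        (λ {q} {p} q< p< → trans (sym (get-tabC k m (FU.f τ) q< p<)) (cong (λ c → get (proj₁ c) q p) (sym e)))
        (λ {q} {p} q< p< → trans (sym (get-tabC m k (FL.f τ) q< p<)) (cong (λ c → get (proj₂ c) q p) (sym e)))
    codes≡ : ∀ {x y} → x ∈ configs k m → y ∈ configs k m → SameTiling (config-tiles x) (config-tiles y) →
        codes x ≡ codes y
    codes≡ {x} {y} x∈ y∈ same with same-codes (configs-sound k m x∈) (configs-sound k m y∈) same
    ... | e , e′ = cong₂ _,_ (get-ext (proj₁ (codes x)) (proj₁ (codes y)) e) (get-ext (proj₂ (codes x)) (proj₂
        (codes y)) e′)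

benzel-count : ∀ k m → HasNTilings RightStonesAndBones (inBenzel (side-a k m) (side-b k m)) (length (configs k m))
benzel-count k m = Count.hasNTilings R k m lower upper (λ {r} {y} {r′} {y′} → rows-sum {r} {y} {r′} {y′}) centre
  where
  A = side-a k m
  B = side-b k m
  R = inBenzel A B
  -- The edge lengths come out as 3k + 1 and 3m + 1, positive even for k = 0, as `Hex` requires.
  short : ∀ k m → + 2 ℤ.* side-a k m ℤ.- side-b k m ≡ + suc (3 * k)
  short k m = trans (alg (+ k) (+ m)) (sym (trans (ℤP.pos-+ 1 (3 * k)) (cong (λ t → + 1 ℤ.+ t) (ℤP.pos-* 3 k))))
    where
    alg : ∀ k m → + 2 ℤ.* (+ 1 ℤ.+ m ℤ.+ + 2 ℤ.* k) ℤ.- (+ 1 ℤ.+ + 2 ℤ.* m ℤ.+ k) ≡ + 1 ℤ.+ + 3 ℤ.* k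
    alg = ℤSolver.solve-∀
  long : + 2 ℤ.* B ℤ.- A ≡ + suc (3 * m)
  long = trans (alg (+ k) (+ m)) (sym (trans (ℤP.pos-+ 1 (3 * m)) (cong (λ t → + 1 ℤ.+ t) (ℤP.pos-* 3 m))))
    where
    alg : ∀ k m → + 2 ℤ.* (+ 1 ℤ.+ + 2 ℤ.* m ℤ.+ k) ℤ.- (+ 1 ℤ.+ m ℤ.+ + 2 ℤ.* k) ≡ + 1 ℤ.+ + 3 ℤ.* m
    alg = ℤSolver.solve-∀
  swap : ∀ k m → side-b k m ≡ side-a m k
  swap k m = alg (+ k) (+ m)
    where
    alg : ∀ k m → + 1 ℤ.+ + 2 ℤ.* m ℤ.+ k ≡ + 1 ℤ.+ k ℤ.+ + 2 ℤ.* m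
    alg = ℤSolver.solve-∀
  module H = Hex A B (3 * k) (3 * m) (short k m) long
  open Lower R k m (λ {c} → H.to c) (λ {c} → H.from c)
  open Upper R k m
    (λ {c} p → subst (λ A → Nice A (side-b m k) (μ-cell c)) (swap k m)
      (subst (λ B′ → Nice B B′ (μ-cell c)) (sym (swap m k)) (nice-mirror c (H.to c p))))
    (λ {c} N → H.from c (subst (Nice A B) (μ-cell-inv c)
      (nice-mirror (μ-cell c) (subst (λ B′ → Nice B B′ (μ-cell c)) (swap m k)
        (subst (λ A → Nice A (side-b m k) (μ-cell c)) (sym (swap k m)) N)))))

-- Rearranging the factorials.

prod1-cong : ∀ k {f g : ℕ → ℕ} → (∀ {j} → j ≤ k → f j ≡ g j) → prod1 k f ≡ prod1 k g
prod1-cong zero    e = refl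
prod1-cong (suc k) e = cong₂ _*_ (prod1-cong k (λ j≤k → e (m≤n⇒m≤1+n j≤k))) (e ≤-refl)

prod1-* : ∀ k (f g : ℕ → ℕ) → prod1 k (λ j → f j * g j) ≡ prod1 k f * prod1 k g
prod1-* zero    f g = refl
prod1-* (suc k) f g = trans (cong (_* (f (suc k) * g (suc k))) (prod1-* k f g))
  (alg (prod1 k f) (prod1 k g) (f (suc k)) (g (suc k)))
  where
  alg : ∀ a b c d → a * b * (c * d) ≡ a * c * (b * d)
  alg = solve-∀

prod1-head : ∀ k f → prod1 (suc k) f ≡ f 1 * prod1 k (f ∘ suc)
prod1-head zero    f = trans (*-identityˡ (f 1)) (sym (*-identityʳ (f 1)))
prod1-head (suc k) f = trans (cong (_* f (suc (suc k))) (prod1-head k f)) (*-assoc (f 1) _ _)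

prod1-reverse : ∀ k f → prod1 k (λ j → f (suc k ∸ j)) ≡ prod1 k f
prod1-reverse zero    f = refl
prod1-reverse (suc k) f = begin
  prod1 (suc k) (λ j → f (suc (suc k) ∸ j))           ≡⟨ prod1-head k (λ j → f (suc (suc k) ∸ j)) ⟩
  f (suc k) * prod1 k (λ j → f (suc k ∸ j))           ≡⟨ cong (f (suc k) *_) (prod1-reverse k f) ⟩
  f (suc k) * prod1 k f                               ≡⟨ *-comm (f (suc k)) (prod1 k f) ⟩
  prod1 (suc k) f ∎

dbl≡2* : ∀ i → dbl i ≡ 2 * i
dbl≡2* zero    = refl
dbl≡2* (suc i) = trans (cong (suc ∘ suc) (dbl≡2* i)) (alg i)
  where
  alg : ∀ i → 2 + 2 * i ≡ 2 * (1 + i)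
  alg = solve-∀

μ-! : ∀ e → μ e * e ! ≡ dbl e !
μ-! zero    = refl
μ-! (suc e) = begin
  (4 * e + 2) * μ e * (suc e * e !)           ≡⟨ alg e (μ e) (e !) ⟩
  (2 + 2 * e) * ((1 + 2 * e) * (μ e * e !))   ≡⟨ cong₂ (λ d x → (2 + d) * ((1 + d) * x)) (sym (dbl≡2* e)) (μ-! e) ⟩
  dbl (suc e) ! ∎
  where
  alg : ∀ e u f → (4 * e + 2) * u * ((1 + e) * f) ≡ (2 + 2 * e) * ((1 + 2 * e) * (u * f))
  alg = solve-∀

-- Reversing the product turns μ(m+1-j) into μ(j+d), which the factorials (j+d)! of the denominator
-- complete to (2j+2d)!; here n = d + 1.
product-formula : ∀ k d → length (configs k (k + d)) * prod1 k (λ j → (j + suc d ∸ 1) ! * (j + suc d + k ∸ 1) !)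
  ≡ prod1 k (λ j → (2 * j) ! * (2 * j + 2 * suc d ∸ 2) !)
product-formula k d = begin
  N * prod1 k (λ j → (j + suc d ∸ 1) ! * (j + suc d + k ∸ 1) !)
    ≡⟨ cong (N *_) (prod1-cong k λ {j} _ → cong₂ (λ s t → s ! * t !) (ix₁ j) (ix₂ j)) ⟩
  N * prod1 k (λ j → (j + d) ! * (m + j) !)
    ≡⟨ cong (N *_) (prod1-* k (λ j → (j + d) !) (λ j → (m + j) !)) ⟩
  N * (prod1 k (λ j → (j + d) !) * prod1 k (λ j → (m + j) !))
    ≡⟨ alg₁ N (prod1 k (λ j → (j + d) !)) (prod1 k (λ j → (m + j) !)) ⟩
  N * prod1 k (λ j → (m + j) !) * prod1 k (λ j → (j + d) !)
    ≡⟨ cong (_* prod1 k (λ j → (j + d) !)) counted ⟩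
  prod1 k (λ j → dbl j ! * μ (suc m ∸ j)) * prod1 k (λ j → (j + d) !)
    ≡⟨ cong (_* prod1 k (λ j → (j + d) !)) (prod1-* k (λ j → dbl j !) (λ j → μ (suc m ∸ j))) ⟩
  prod1 k (λ j → dbl j !) * prod1 k (λ j → μ (suc m ∸ j)) * prod1 k (λ j → (j + d) !)
    ≡⟨ cong (λ t → prod1 k (λ j → dbl j !) * t * prod1 k (λ j → (j + d) !)) reversed ⟩
  prod1 k (λ j → dbl j !) * prod1 k (λ j → μ (j + d)) * prod1 k (λ j → (j + d) !)
    ≡⟨ *-assoc (prod1 k (λ j → dbl j !)) _ _ ⟩
  prod1 k (λ j → dbl j !) * (prod1 k (λ j → μ (j + d)) * prod1 k (λ j → (j + d) !))
    ≡⟨ cong (prod1 k (λ j → dbl j !) *_) (prod1-* k (λ j → μ (j + d)) (λ j → (j + d) !)) ⟨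
  prod1 k (λ j → dbl j !) * prod1 k (λ j → μ (j + d) * (j + d) !)
    ≡⟨ prod1-* k (λ j → dbl j !) (λ j → μ (j + d) * (j + d) !) ⟨
  prod1 k (λ j → dbl j ! * (μ (j + d) * (j + d) !))
    ≡⟨ prod1-cong k (λ {j} _ → cong₂ _*_ (cong _! (dbl≡2* j))
         (trans (μ-! (j + d)) (cong _! (trans (dbl≡2* (j + d)) (ix₃ j))))) ⟩
  prod1 k (λ j → (2 * j) ! * (2 * j + 2 * suc d ∸ 2) !) ∎
  where
  m = k + d
  N = length (configs k m)
  ix₁ : ∀ j → j + suc d ∸ 1 ≡ j + d
  ix₁ j = cong (_∸ 1) (+-suc j d)
  ix₂ : ∀ j → j + suc d + k ∸ 1 ≡ m + j
  ix₂ j = trans (cong (λ t → t + k ∸ 1) (+-suc j d)) (alg j d k)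
    where
    alg : ∀ j d k → j + d + k ≡ k + d + j
    alg = solve-∀
  ix₃ : ∀ j → 2 * (j + d) ≡ 2 * j + 2 * suc d ∸ 2
  ix₃ j = sym (trans (cong (_∸ 2) (alg j d)) (m+n∸m≡n 2 (2 * (j + d))))
    where
    alg : ∀ j d → 2 * j + 2 * (1 + d) ≡ 2 + 2 * (j + d)
    alg = solve-∀
  alg₁ : ∀ a b c → a * (b * c) ≡ a * c * b
  alg₁ = solve-∀
  counted : N * prod1 k (λ j → (m + j) !) ≡ prod1 k (λ j → dbl j ! * μ (suc m ∸ j))
  counted = ℤP.+-injective (trans (ℤP.pos-* N (prod1 k λ j → (m + j) !)) (trans (cong (ℤ._* + prod1 k (λ j →
      (m + j) !)) (length-configs k m)) (count-formula k m (m≤m+n k d))))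
  reversed : prod1 k (λ j → μ (suc m ∸ j)) ≡ prod1 k (λ j → μ (j + d))
  reversed = trans (prod1-cong k λ {j} j≤k → cong μ (trans (cong (λ t → suc t ∸ j) (+-comm k d))
      (trans (cong (_∸ j) (sym (+-suc d k))) (trans (+-∸-assoc d (m≤n⇒m≤1+n j≤k)) (+-comm d (suc k ∸ j))))))
    (prod1-reverse k (λ j → μ (j + d)))

-- Recovering k and n from a and b.

record Params (a b : ℕ) : Set where
  constructor params
  field
    k d : ℕ
    a≡  : a ≡ suc (k + d + 2 * k)
    b≡  : b ≡ suc (2 * (k + d) + k)

-- With d = b - a and e = 2a - b one has a + b = 2e + 3d, so the residue forces e = 3k + 1. Then n =
-- d + 1 and m = k + d.
get-params : ∀ a b → a ≤ b → b ≤ 2 * a → (a + b) % 3 ≡ 2 → Params a b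
get-params a b a≤b b≤2a res = from-residue (e % 3) (m%n<n e 3) (m≡m%n+[m/n]*n e 3)
  where
  d = b ∸ a
  e = a ∸ d
  t = e / 3
  b≡a+d : b ≡ a + d
  b≡a+d = sym (m+[n∸m]≡n a≤b)
  d≤a : d ≤ a
  d≤a = +-cancelˡ-≤ a d a (subst (a + d ≤_) (cong (λ t → a + t) (+-identityʳ a)) (subst (_≤ 2 * a) b≡a+d b≤2a))
  a≡d+e : a ≡ d + e
  a≡d+e = sym (m+[n∸m]≡n d≤a)
  sum : ∀ r → e ≡ r + t * 3 → a + b ≡ 2 * r + (2 * t + d) * 3
  sum r er = trans (cong (λ t → a + t) b≡a+d) (trans (cong (λ a → a + (a + d)) (trans a≡d+e (cong (λ t →
      d + t) er))) (alg r t d))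
    where
    alg : ∀ r t d → (d + (r + t * 3)) + ((d + (r + t * 3)) + d) ≡ 2 * r + (2 * t + d) * 3
    alg = solve-∀
  residue : ∀ r → e ≡ r + t * 3 → (2 * r) % 3 ≡ 2
  residue r er = trans (sym ([m+kn]%n≡m%n (2 * r) (2 * t + d) 3)) (trans (cong (_% 3) (sym (sum r er))) res)
  from-residue : ∀ r → r < 3 → e ≡ r + t * 3 → Params a b
  from-residue 0 _ er with residue 0 er
  ... | ()
  from-residue 1 _ er = params t d (trans a≡ (algᵃ t d)) (trans b≡a+d (trans (cong (_+ d) a≡) (algᵇ t d)))
    where
    a≡ : a ≡ d + (1 + t * 3)
    a≡ = trans a≡d+e (cong (λ t → d + t) er)
    algᵃ : ∀ t d → d + (1 + t * 3) ≡ 1 + (t + d + 2 * t)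
    algᵃ = solve-∀
    algᵇ : ∀ t d → d + (1 + t * 3) + d ≡ 1 + (2 * (t + d) + t)
    algᵇ = solve-∀
  from-residue 2 _ er with residue 2 er
  ... | ()
  from-residue (suc (suc (suc r))) (s≤s (s≤s (s≤s ()))) er

n-value : ∀ k d → suc (2 * (k + d) + k) + 1 ∸ suc (k + d + 2 * k) ≡ suc d
n-value k d = trans (cong (_∸ suc (k + d + 2 * k)) (alg k d)) (m+n∸m≡n (suc (k + d + 2 * k)) (suc d))
  where
  alg : ∀ k d → (1 + (2 * (k + d) + k)) + 1 ≡ (1 + (k + d + 2 * k)) + (1 + d)
  alg = solve-∀

k-value : ∀ k d → (2 * suc (k + d + 2 * k) ∸ suc (2 * (k + d) + k) ∸ 1) / 3 ≡ k
k-value k d = trans (cong (λ t → (t ∸ 1) / 3) (trans (cong (_∸ suc (2 * (k + d) + k)) (alg k d)) (m+n∸m≡n (suc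
    (2 * (k + d) + k)) (suc (k * 3)))))
  (m*n/n≡m k 3)
  where
  alg : ∀ k d → 2 * (1 + (k + d + 2 * k)) ≡ (1 + (2 * (k + d) + k)) + (1 + k * 3)
  alg = solve-∀

benzel-tilings : ∀ k d → HasNTilings RightStonesAndBones (inBenzel (+ suc (k + d + 2 * k)) (+ suc (2 *
    (k + d) + k))) (length (configs k (k + d)))
benzel-tilings k d = subst (λ A → HasNTilings RightStonesAndBones (inBenzel A (+ suc (2 * (k + d) + k)))
    (length (configs k (k + d)))) A≡
  (subst (λ B → HasNTilings RightStonesAndBones (inBenzel (side-a k (k + d)) B) (length (configs k
      (k + d)))) B≡ (benzel-count k (k + d)))
  where
  A≡ : side-a k (k + d) ≡ + suc (k + d + 2 * k)
  A≡ = sym (trans (ℤP.pos-+ (suc (k + d)) (2 * k)) (cong₂ ℤ._+_ (ℤP.pos-+ 1 (k + d)) (ℤP.pos-* 2 k)))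
  B≡ : side-b k (k + d) ≡ + suc (2 * (k + d) + k)
  B≡ = sym (trans (ℤP.pos-+ (suc (2 * (k + d))) k) (cong (ℤ._+ + k) (trans (ℤP.pos-+ 1 (2 * (k + d))) (cong
      (λ t → + 1 ℤ.+ t) (ℤP.pos-* 2 (k + d))))))

theorem1p1 : (a b : ℕ) → 2 ≤ a → a ≤ b → b ≤ 2 * a → (a + b) % 3 ≡ 2 →
    let n = b + 1 ∸ a
        k = (2 * a ∸ b ∸ 1) / 3
    in Σ ℕ (λ N → HasNTilings RightStonesAndBones (inBenzel (+ a) (+ b)) N ×
         N * prod1 k (λ j → ((j + n ∸ 1) !) * ((j + n + k ∸ 1) !))
           ≡ prod1 k (λ j → ((2 * j) !) * ((2 * j + 2 * n ∸ 2) !)))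
theorem1p1 a b _ a≤b b≤2a res with get-params a b a≤b b≤2a res
... | params k d refl refl rewrite n-value k d | k-value k d = length (configs k
    (k + d)) , benzel-tilings k d , product-formula k d
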